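{- Let $s,r,n\in\mathbb N$ with $n\ge s$ and $r\ge2$, and let $p,q,R,R',\eta\in\mathbb R$ satisfy $$0<q<\tfrac18,\quad 0<p\le\frac q{2^{10}r^2s^2},\quad R=2^{ -6}pn,\quad 0\le R'\le\frac R{16},\quad \eta=p^4\Big(\frac q2\Big)^{4s}.$$ Let $\mathcal F$ be a $(p,R')$-Janson $(s+1)$-uniform hypergraph with vertex set $U$, let $\mathcal H$ be an $s$-uniform hypergraph with vertex set $V$, $|V|=n$, and let $\pi:V\to U$ satisfy $|\pi(L)|\ge|L|/2$ for every $L\subset V$ and $|\pi(E)|=|E|$ for every $E\in\mathcal H$. Let $v$ be a vertex not in $U$. Then there is a family $\mathcal X\subset2^V$ with $|\mathcal X|\le4(2/q)^{4qn}$ such that: (1) if $I\subset V$ and $\pi_v(\mathcal H[I])\cup\mathcal F$ is not $(p,R'+\eta R)$-Janson, then $I\subset X$ for some $X\in\mathcal X$; (2) for each $X\in\mathcal X$ with $|X|\ge n/(8r)$ there exists $Y\subset X$ with $|Y|\ge|X|-2^{ -8}r^{ -1}n$ such that $\pi(\mathcal H[Y])$ is not $(p,R)$-Janson.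
   Context: A hypergraph is identified with its edge set; $\mathcal H[I]=\{E\in\mathcal H:E\subset I\}$. For a hypergraph $\mathcal G$ on $V$, $\pi(\mathcal G)=\{\pi(E):E\in\mathcal G\}$ and $\pi_v(\mathcal G)=\{\pi(E)\cup\{v\}:E\in\mathcal G\}$; the union of two hypergraphs is the hypergraph on the union of their vertex sets whose edge set is the union of their edge sets. For $\nu:\mathcal G\to\mathbb R_{\ge0}$: $e(\nu)=\sum_E\nu(E)$, $d_\nu(L)=\sum_{E\in\mathcal G,L\subset E}\nu(E)$, $\Lambda_p(\nu)=\sum_{L\subset V(\mathcal G),|L|\ge2}d_\nu(L)^2p^{ -|L|}$. For $R>0$, $\mathcal G$ is $(p,R)$-Janson if some $\nu:\mathcal G\to\mathbb R_{\ge0}$ has $\Lambda_p(\nu)<e(\nu)^2/R$; every hypergraph is $(p,0)$-Janson. -}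

module Defs where

open import Algebra.Bundles using (CommutativeRing; Semiring)
open import Algebra.Definitions.RawSemiring using () renaming (_^_ to pow; _×_ to mult)
open import Algebra.Structures using (IsCommutativeRing)
open import Data.Bool.Properties using () renaming (_≟_ to _≟ᵇ_)
open import Data.Fin using (Fin)
open import Data.Fin.Properties using (any?) renaming (_≟_ to _≟ᶠ_)
open import Data.Fin.Subset using (Subset; inside; outside; _∈_; _⊆_; _∪_; ⁅_⁆; ∣_∣)
open import Data.Fin.Subset.Properties using (_∈?_; _⊆?_; anySubset?; p⊆p∪q; q⊆p∪q; x∈p∪q⁻; x∈p∪q⁺; ⊆-trans)
open import Data.List using (List; []; _∷_; _++_; map; filter; foldr)
open import Data.Nat as ℕ using (ℕ; zero; suc)
open import Data.Product using (Σ-syntax; ∃; ∃-syntax; _×_; _,_)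
open import Data.Sum using (_⊎_; [_,_]′) renaming (map₁ to ⊎-map₁)
open import Data.Vec using ([]; _∷_; tabulate)
open import Data.Vec.Properties using (≡-dec; lookup∘tabulate; []=⇒lookup; lookup⇒[]=)
open import Level using (0ℓ)
open import Relation.Binary.Core using (Rel)
open import Relation.Binary.PropositionalEquality using (_≡_; refl; sym; trans)
open import Relation.Binary.Structures using (IsTotalOrder)
open import Relation.Nullary using (¬_; Dec; does; yes; no)
open import Relation.Nullary.Decidable using (_×-dec_; _⊎-dec_; dec-true)
open import Relation.Unary using (Pred; Decidable)
import Relation.Binary.Construct.NonStrictToStrict as ToStrict

-- The real numbers, given axiomatically as a Dedekind-complete ordered field
-- (unique up to isomorphism). `_⁻¹` and `⋁` are total; their values are only
-- constrained at nonzero elements and at nonempty sets bounded above.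
record CompleteOrderedField : Set₁ where
  infix  4 _≈_ _≤_ _<_
  infixl 6 _+_
  infixl 7 _*_ _/_
  infixr 8 _^_
  infix  8 -_
  infix  9 _⁻¹
  field
    Carrier : Set
    _≈_ _≤_ : Rel Carrier 0ℓ
    _+_ _*_ : Carrier → Carrier → Carrier
    -_ _⁻¹  : Carrier → Carrier
    0# 1#   : Carrier
    ⋁       : Pred Carrier 0ℓ → Carrier

    isCommutativeRing : IsCommutativeRing _≈_ _+_ _*_ -_ 0# 1#
    0≉1               : ¬ (0# ≈ 1#)
    ⁻¹-cong           : ∀ {x y} → x ≈ y → x ⁻¹ ≈ y ⁻¹
    ⁻¹-inverse        : ∀ {x} → ¬ (x ≈ 0#) → x * x ⁻¹ ≈ 1#

    isTotalOrder : IsTotalOrder _≈_ _≤_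
    +-monoˡ-≤    : ∀ {x y} z → x ≤ y → x + z ≤ y + z
    *-nonneg     : ∀ {x y} → 0# ≤ x → 0# ≤ y → 0# ≤ x * y

    ⋁-upper : ∀ (P : Pred Carrier 0ℓ) → (∃[ b ] ∀ x → P x → x ≤ b) →
              ∀ x → P x → x ≤ ⋁ P
    ⋁-least : ∀ (P : Pred Carrier 0ℓ) → ∃ P →
              ∀ b → (∀ x → P x → x ≤ b) → ⋁ P ≤ b

  commutativeRing : CommutativeRing 0ℓ 0ℓ
  commutativeRing = record { isCommutativeRing = isCommutativeRing }

  open CommutativeRing commutativeRing public using (semiring; _-_)

  _<_ : Rel Carrier 0ℓ
  _<_ = ToStrict._<_ _≈_ _≤_

  _/_ : Carrier → Carrier → Carrier
  x / y = x * y ⁻¹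

  _^_ : Carrier → ℕ → Carrier
  _^_ = pow (Semiring.rawSemiring semiring)

  ⟦_⟧ : ℕ → Carrier
  ⟦ k ⟧ = mult (Semiring.rawSemiring semiring) k 1#

  -- x ^ᴿ y = sup { x^(m/k) : m/k ∈ ℚ, 0 ≤ m/k ≤ y }, where x^(m/k) is the
  -- w ≥ 0 with w^k = x^m. This is the real power for x ≥ 1 and y ≥ 0, the only
  -- range in which it is used.
  infixr 8 _^ᴿ_
  _^ᴿ_ : Carrier → Carrier → Carrier
  x ^ᴿ y = ⋁ λ w → ∃[ m ] ∃[ k ]
    (1 ℕ.≤ k) × (⟦ m ⟧ / ⟦ k ⟧ ≤ y) × (0# ≤ w) × (w ^ k ≈ x ^ m)

  ∑ : {A : Set} → List A → (A → Carrier) → Carrier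
  ∑ xs f = foldr (λ x acc → f x + acc) 0# xs

allSubsets : ∀ n → List (Subset n)
allSubsets zero    = [] ∷ []
allSubsets (suc n) = map (outside ∷_) (allSubsets n) ++ map (inside ∷_) (allSubsets n)

-- A finite hypergraph whose vertex set is a subset of the ambient set Fin N.
record Hypergraph (N : ℕ) : Set₁ where
  field
    vertices : Subset N
    Edge     : Pred (Subset N) 0ℓ
    Edge?    : Decidable Edge
    edge⊆    : ∀ {E} → Edge E → E ⊆ vertices

  edges : List (Subset N)
  edges = filter Edge? (allSubsets N)

open Hypergraph public

Uniform : ∀ {N} → ℕ → Hypergraph N → Set
Uniform k G = ∀ E → Edge G E → ∣ E ∣ ≡ k

module _ {M N : ℕ} (π : Fin M → Fin N) where

  private
    inImage? : (L : Subset M) → ∀ u → Dec (∃[ x ] x ∈ L × π x ≡ u)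
    inImage? L u = any? λ x → (x ∈? L) ×-dec (π x ≟ᶠ u)

  image : Subset M → Subset N
  image L = tabulate λ u → does (inImage? L u)

  ∈-image⁺ : ∀ {L x} → x ∈ L → π x ∈ image L
  ∈-image⁺ {L} {x} x∈L = lookup⇒[]= (π x) (image L)
    (trans (lookup∘tabulate _ (π x)) (dec-true (inImage? L (π x)) (x , x∈L , refl)))

  ∈-image⁻ : ∀ {L u} → u ∈ image L → ∃[ x ] x ∈ L × π x ≡ u
  ∈-image⁻ {L} {u} u∈ with inImage? L u | trans (sym (lookup∘tabulate (λ w → does (inImage? L w)) u)) ([]=⇒lookup u∈)
  ... | yes p | _  = p
  ... | no _  | ()

  image-mono : ∀ {K L} → K ⊆ L → image K ⊆ image L
  image-mono {K} {L} K⊆L u∈ with ∈-image⁻ {K} u∈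
  ... | x , x∈K , refl = ∈-image⁺ {L} (K⊆L x∈K)

_≟ˢ_ : ∀ {n} (K L : Subset n) → Dec (K ≡ L)
_≟ˢ_ = ≡-dec _≟ᵇ_

infix 10 _[_]
_[_] : ∀ {N} → Hypergraph N → Subset N → Hypergraph N
G [ I ] = record
  { vertices = I
  ; Edge     = λ E → Edge G E × E ⊆ I
  ; Edge?    = λ E → Edge? G E ×-dec (E ⊆? I)
  ; edge⊆    = λ (_ , E⊆I) → E⊆I
  }

imageᴴ : ∀ {M N} → (Fin M → Fin N) → Hypergraph M → Hypergraph N
imageᴴ π G = record
  { vertices = image π (vertices G)
  ; Edge     = λ D → ∃[ E ] Edge G E × D ≡ image π E
  ; Edge?    = λ D → anySubset? λ E → Edge? G E ×-dec (D ≟ˢ image π E)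
  ; edge⊆    = λ { (E , E∈G , refl) → image-mono π {E} (edge⊆ G E∈G) }
  }

imageᴴ₊ : ∀ {M N} → (Fin M → Fin N) → Fin N → Hypergraph M → Hypergraph N
imageᴴ₊ π v G = record
  { vertices = image π (vertices G) ∪ ⁅ v ⁆
  ; Edge     = λ D → ∃[ E ] Edge G E × D ≡ image π E ∪ ⁅ v ⁆
  ; Edge?    = λ D → anySubset? λ E → Edge? G E ×-dec (D ≟ˢ (image π E ∪ ⁅ v ⁆))
  ; edge⊆    = λ { (E , E∈G , refl) x∈ →
      x∈p∪q⁺ (⊎-map₁ (image-mono π {E} (edge⊆ G E∈G)) (x∈p∪q⁻ (image π E) ⁅ v ⁆ x∈)) }
  }

infixr 6 _∪ᴴ_
_∪ᴴ_ : ∀ {N} → Hypergraph N → Hypergraph N → Hypergraph N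
G ∪ᴴ G′ = record
  { vertices = vertices G ∪ vertices G′
  ; Edge     = λ E → Edge G E ⊎ Edge G′ E
  ; Edge?    = λ E → Edge? G E ⊎-dec Edge? G′ E
  ; edge⊆    = [ (λ e → ⊆-trans (edge⊆ G e) (p⊆p∪q (vertices G′)))
               , (λ e → ⊆-trans (edge⊆ G′ e) (q⊆p∪q (vertices G) (vertices G′))) ]′
  }

-- A weight function ν : G → ℝ is represented by a function on all subsets, whose
-- values off the edge set of G are never used.
module Janson (ℝ : CompleteOrderedField) where
  open CompleteOrderedField ℝ

  module _ {N : ℕ} (G : Hypergraph N) (ν : Subset N → Carrier) where

    totalWeight : Carrier
    totalWeight = ∑ (edges G) ν

    degree : Subset N → Carrier
    degree L = ∑ (filter (L ⊆?_) (edges G)) ν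

    Λ : Carrier → Carrier
    Λ p = ∑ (filter (λ L → (L ⊆? vertices G) ×-dec (2 ℕ.≤? ∣ L ∣)) (allSubsets N))
            λ L → degree L ^ 2 * (p ⁻¹) ^ ∣ L ∣

  IsJanson : ∀ {N} → Carrier → Carrier → Hypergraph N → Set
  IsJanson {N} p R G =
    (R ≈ 0#) ⊎
    ((0# < R) × Σ[ ν ∈ (Subset N → Carrier) ]
      (∀ E → Edge G E → 0# ≤ ν E) × (Λ G ν p < totalWeight G ν ^ 2 / R))

{-# OPTIONS --safe #-}
-- Write e(ν) for the total weight of ν and d(L) for the weight of the edges containing L. Call an edge
-- of H good if its image correlates little with a fixed Janson weight of F. A weight ν on the good edges
-- of H[I] improves the Janson constant of F as soon as Λ(ν)/e(ν)² (with the vertex v included) is below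
-- a constant times 1/(ηR), so a bad set I, one to which (1) applies, carries no such ν.
-- A container is determined by two fingerprints S₁, S₂ ⊆ I.
--
-- For a q-random subset A of V let μ(S) be the probability that A ∪ S lies in a bad set, and let S₁
-- minimise 2^|S| μ(S). Then |S₁| ≤ 3qn, and μ(S₁ ∪ L) ≥ 2^-|L| μ(S₁) for all L ⊆ I. Call a good edge E
-- scarce if μ(S₁ ∪ E) < 2^-s μ(S₁). No scarce edge lies in I, whereas a spread weight on good edges that
-- are not scarce keeps, on average over A, a (q/2)^s-fraction of itself inside a bad set: impossible.
--
-- For S containing no scarce edge let J(S) be the supremum, over weights ν on scarce edges, of
-- 2 e(ν) - Σ d(L)² p^-|L|, where L runs over the nonempty sets disjoint from S; thus 0 ≤ J(S) ≤ pn. Let S₂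
-- maximise J(S) - (p/q)|S|, so that |S₂| ≤ qn and the container
-- X = {u : J(S₂ ∪ u) ≤ J(S₂) + p/q} contains I. Perturbing an almost optimal ν at the edges through u
-- shows that every u ∈ X carries little of the quadratic form, and then testing ν against a weight on
-- the scarce edges inside X shows that no such weight is Janson.
--
-- If (2) fails for X, averaging n Janson weights, each of which avoids the vertices that are already
-- heavy, yields a Janson weight on H[X] of bounded degree. By Cauchy–Schwarz and Markov half of it sits
-- on good edges, which contradicts one of the two previous paragraphs.
module Submission where

open import Defs renaming (allSubsets to 𝒫)
open import Algebra.Bundles using (CommutativeRing)
import Algebra.Properties.CommutativeSemiring.Exp as CExp
import Algebra.Properties.Ring as RingProperties
import Algebra.Properties.Semiring.Exp as Exp
import Algebra.Properties.Semiring.Mult as Mult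
import Algebra.Solver.Ring as RingSolver
open import Algebra.Solver.Ring.AlmostCommutativeRing using (fromCommutativeRing; _-Raw-AlmostCommutative⟶_)
open import Axiom.ExcludedMiddle using (ExcludedMiddle)
open import Data.Bool.Properties using (∨-identityʳ)
open import Data.Empty using (⊥; ⊥-elim)
open import Data.Fin using (Fin; zero; suc)
open import Data.Fin.Properties using (suc-injective) renaming (_≟_ to _≟ᶠ_)
open import Data.Fin.Subset using (Subset; inside; outside; _∈_; _∉_; _⊆_; _∪_; ⁅_⁆; ∣_∣) renaming (⊥ to ∅)
open import Data.Fin.Subset.Properties using (_∈?_; _⊆?_; ⊥⊆; drop-there; drop-∷-⊆; out⊆; in⊆in; s⊆s; ⊆-antisym; p⊆q⇒∣p∣≤∣q∣; p⊆p∪q; q⊆p∪q; x∈p∪q⁻; ∪-assoc; ∪-comm; ∪-identityˡ; ∪-identityʳ; x∈⁅x⁆; x∈⁅y⁆⇒x≡y; ∣⁅x⁆∣≡1; ∣⊥∣≡0; nonempty?; Empty-unique)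
open import Data.Integer as ℤ using (ℤ; -[1+_]) renaming (+_ to pos)
import Data.Integer.Properties as ℤ
open import Data.List using (List; []; _∷_; _++_; map; filter; length; allFin; cartesianProduct; deduplicate)
open import Data.List.Membership.Propositional using () renaming (_∈_ to _∈ˡ_)
open import Data.List.Membership.Propositional.Properties using (∈-allFin; ∈-map⁺; ∈-map⁻; ∈-++⁺ˡ; ∈-++⁺ʳ; ∈-filter⁺; ∈-filter⁻; ∈-cartesianProduct⁺; ∈-deduplicate⁺; ∈-deduplicate⁻)
import Data.List.Properties as List
open import Data.List.Relation.Unary.Any using () renaming (here to hereˡ; there to thereˡ)
open import Data.List.Relation.Unary.Unique.Propositional using (Unique)
import Data.List.Relation.Unary.Unique.DecPropositional.Properties as Unique
open import Data.Maybe using (Maybe; just; nothing)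
open import Data.Nat as ℕ using (ℕ; zero; suc)
import Data.Nat.Properties as ℕ
open import Data.Product using (Σ-syntax; ∃-syntax; _×_; _,_; proj₁; proj₂)
import Data.Sign as Sign
open import Data.Sum using (_⊎_; inj₁; inj₂; [_,_]′)
open import Data.Vec using ([]; _∷_; here; there; tabulate)
open import Data.Vec.Properties using (∷-injective; ∷-injectiveʳ; lookup∘tabulate; []=⇒lookup; lookup⇒[]=)
open import Function using (_∘_; id)
open import Level using (0ℓ)
open import Relation.Binary.PropositionalEquality as ≡ using (_≡_)
open import Relation.Binary.Structures using (IsTotalOrder)
open import Relation.Nullary using (¬_; Dec; yes; no; does)
open import Relation.Nullary.Decidable using (_×-dec_; ¬?; dec-true)

-- The obstacle is that `Λ` only sees sets of size at least two, while adding v turns the singleton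
-- {y} into the pair {y, v} and charges d(y)²p⁻². A Janson weight alone says nothing about d(y), so
-- bounded degrees have to be won by averaging; the loss of 2⁻⁸n/r vertices in (2) is what pays for
-- this. J counts singletons as well: they give the bound pn, and they keep the degrees of an almost
-- optimal weight small on the container.
--
-- The first fingerprint replaces badness, a statement about weights and F, by independence: I
-- contains no edge of a hypergraph that depends on S₁ alone. The second fingerprint is then a
-- container argument for independent sets of that hypergraph, so the pair (S₁, S₂) determines X
-- without knowledge of I.
--
-- Goodness controls the one term of `Λ` that mixes the two weights. The weight found in a bad set
-- has total of order (q/2)^s, so normalising it multiplies `Λ` by about (q/2)^(-2s); the vertex v
-- contributes a further factor of order r s²/p. The powers of q/2 and p in η absorb both.

module Proof (em : ExcludedMiddle 0ℓ) (ℝ : CompleteOrderedField) where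

  -- Arithmetic of the ordered field

  open CompleteOrderedField ℝ
  open Janson ℝ
  open CommutativeRing commutativeRing
    using ( setoid; refl; sym; trans; +-cong; +-congˡ; +-congʳ; *-cong; *-congˡ; *-congʳ; -‿cong
          ; +-comm; +-assoc; *-comm; *-assoc; +-identityˡ; +-identityʳ; *-identityˡ; *-identityʳ
          ; distribˡ; distribʳ; zeroˡ; zeroʳ; -‿inverseʳ; commutativeSemiring)
    renaming (reflexive to ≈-reflexive)
  open IsTotalOrder isTotalOrder
    using (total) renaming (refl to ≤-refl; trans to ≤-trans; reflexive to ≤-reflexive; antisym to ≤-antisym)

  open import Relation.Binary.Reasoning.Setoid setoid using (begin_; _∎; step-≈-⟩; step-≈-⟨)

  private variable
    α β ϕ ψ : Set
    n : ℕ

  private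
    module RP = RingProperties (CommutativeRing.ring commutativeRing)
    module MP = Mult semiring
    module EP = Exp semiring
    module CEP = CExp commutativeSemiring

  ⟦⟧-+ : ∀ m n → ⟦ m ℕ.+ n ⟧ ≈ ⟦ m ⟧ + ⟦ n ⟧
  ⟦⟧-+ = MP.×-homo-+ 1#

  ⟦⟧-* : ∀ m n → ⟦ m ℕ.* n ⟧ ≈ ⟦ m ⟧ * ⟦ n ⟧
  ⟦⟧-* = MP.×1-homo-*

  ⟦1⟧≈1 : ⟦ 1 ⟧ ≈ 1#
  ⟦1⟧≈1 = +-identityʳ 1#

  -- The coefficient 1 is sent to 1# itself, and not to ⟦ 1 ⟧ = 1# + 0#, so that
  -- ring identities containing 1# can be handed to the solver verbatim.
  private
    ι′ ι : ℤ → Carrier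
    ι′ (pos n)    = ⟦ n ⟧
    ι′ (-[1+ n ]) = - ⟦ suc n ⟧
    ι (pos 1)          = 1#
    ι (pos n)          = ⟦ n ⟧
    ι (-[1+ 0 ])       = - 1#
    ι (-[1+ (suc n) ]) = - ⟦ suc (suc n) ⟧

    ι≈ι′ : ∀ i → ι i ≈ ι′ i
    ι≈ι′ (pos 0)             = refl
    ι≈ι′ (pos 1)             = sym ⟦1⟧≈1
    ι≈ι′ (pos (suc (suc n))) = refl
    ι≈ι′ (-[1+ 0 ])          = -‿cong (sym ⟦1⟧≈1)
    ι≈ι′ (-[1+ (suc n) ])    = refl

    cancel-1 : ∀ x y z → (z + x) + - (z + y) ≈ x + - y
    cancel-1 x y z = begin
      (z + x) + - (z + y)     ≈⟨ +-congˡ (sym (RP.-‿+-comm z y)) ⟩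
      (z + x) + (- z + - y)   ≈⟨ +-congʳ (+-comm z x) ⟩
      (x + z) + (- z + - y)   ≈⟨ +-assoc x z _ ⟩
      x + (z + (- z + - y))   ≈⟨ +-congˡ (+-assoc z (- z) (- y)) ⟨
      x + ((z + - z) + - y)   ≈⟨ +-congˡ (+-congʳ (-‿inverseʳ z)) ⟩
      x + (0# + - y)          ≈⟨ +-congˡ (+-identityˡ (- y)) ⟩
      x + - y ∎

    ι′-⊖ : ∀ m n → ι′ (m ℤ.⊖ n) ≈ ⟦ m ⟧ + - ⟦ n ⟧
    ι′-⊖ zero    zero    = sym (-‿inverseʳ 0#)
    ι′-⊖ zero    (suc n) = sym (+-identityˡ _)
    ι′-⊖ (suc m) zero    = sym (trans (+-congˡ RP.-0#≈0#) (+-identityʳ _))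
    ι′-⊖ (suc m) (suc n) = trans (≈-reflexive (≡.cong ι′ (ℤ.[1+m]⊖[1+n]≡m⊖n m n)))
      (trans (ι′-⊖ m n) (sym (cancel-1 ⟦ m ⟧ ⟦ n ⟧ 1#)))

    ι′-neg : ∀ i → ι′ (ℤ.- i) ≈ - ι′ i
    ι′-neg (pos zero)   = sym RP.-0#≈0#
    ι′-neg (pos (suc n))  = refl
    ι′-neg (-[1+ n ]) = sym (RP.-‿involutive _)

    ι′-+ : ∀ i j → ι′ (i ℤ.+ j) ≈ ι′ i + ι′ j
    ι′-+ (pos m)      (pos n)      = ⟦⟧-+ m n
    ι′-+ (pos m)      (-[1+ n ]) = ι′-⊖ m (suc n)
    ι′-+ (-[1+ m ]) (pos n)      = trans (ι′-⊖ n (suc m)) (+-comm _ _)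
    ι′-+ (-[1+ m ]) (-[1+ n ]) = trans (-‿cong (trans (≈-reflexive (≡.cong ⟦_⟧ (≡.cong suc (≡.sym (ℕ.+-suc m n))))) (⟦⟧-+ (suc m) (suc n))))
      (sym (RP.-‿+-comm _ _))

    ι′-◃ : ∀ k → ι′ (Sign.- ℤ.◃ k) ≈ - ⟦ k ⟧
    ι′-◃ zero    = sym RP.-0#≈0#
    ι′-◃ (suc k) = refl

    ι′-* : ∀ i j → ι′ (i ℤ.* j) ≈ ι′ i * ι′ j
    ι′-* (pos m)      (pos n)      = trans (≈-reflexive (≡.cong ι′ (ℤ.+◃n≡+n (m ℕ.* n)))) (⟦⟧-* m n)
    ι′-* (pos m)      (-[1+ n ]) = trans (ι′-◃ (m ℕ.* suc n)) (trans (-‿cong (⟦⟧-* m (suc n))) (RP.-‿distribʳ-* _ _))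
    ι′-* (-[1+ m ]) (pos n)      = trans (ι′-◃ (suc m ℕ.* n)) (trans (-‿cong (⟦⟧-* (suc m) n)) (RP.-‿distribˡ-* _ _))
    ι′-* (-[1+ m ]) (-[1+ n ]) = trans (⟦⟧-* (suc m) (suc n)) (begin
      ⟦ suc m ⟧ * ⟦ suc n ⟧          ≈⟨ RP.-‿involutive _ ⟨
      - - (⟦ suc m ⟧ * ⟦ suc n ⟧)    ≈⟨ -‿cong (RP.-‿distribʳ-* _ _) ⟩
      - (⟦ suc m ⟧ * - ⟦ suc n ⟧)    ≈⟨ RP.-‿distribˡ-* _ _ ⟩
      - ⟦ suc m ⟧ * - ⟦ suc n ⟧ ∎)

    ℤ⟶ℝ : ℤ.+-*-rawRing -Raw-AlmostCommutative⟶ fromCommutativeRing commutativeRing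
    ℤ⟶ℝ = record
      { ⟦_⟧    = ι
      ; +-homo = λ i j → trans (ι≈ι′ (i ℤ.+ j)) (trans (ι′-+ i j) (+-cong (sym (ι≈ι′ i)) (sym (ι≈ι′ j))))
      ; *-homo = λ i j → trans (ι≈ι′ (i ℤ.* j)) (trans (ι′-* i j) (*-cong (sym (ι≈ι′ i)) (sym (ι≈ι′ j))))
      ; -‿homo = λ i → trans (ι≈ι′ (ℤ.- i)) (trans (ι′-neg i) (-‿cong (sym (ι≈ι′ i))))
      ; 0-homo = refl
      ; 1-homo = refl
      }

    coefficient≟ : ∀ i j → Maybe (ι i ≈ ι j)
    coefficient≟ i j with i ℤ.≟ j
    ... | yes i≡j = just (≈-reflexive (≡.cong ι i≡j))
    ... | no  _   = nothing

  open RingSolver ℤ.+-*-rawRing (fromCommutativeRing commutativeRing) ℤ⟶ℝ coefficient≟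
    using (solve; con; _:+_; _:*_; _:-_; :-_; _:^_; _:=_; Polynomial)

  κ : ∀ {n} → ℕ → Polynomial n
  κ m = con (pos m)

  ≤-respˡ : ∀ {x y z} → x ≈ y → x ≤ z → y ≤ z
  ≤-respˡ x≈y x≤z = ≤-trans (≤-reflexive (sym x≈y)) x≤z

  ≤-respʳ : ∀ {x y z} → y ≈ z → x ≤ y → x ≤ z
  ≤-respʳ y≈z x≤y = ≤-trans x≤y (≤-reflexive y≈z)

  ≤-resp₂ : ∀ {x y x′ y′} → x ≈ x′ → y ≈ y′ → x ≤ y → x′ ≤ y′
  ≤-resp₂ e f = λ h → ≤-respˡ e (≤-respʳ f h)

  +-mono-≤ : ∀ {x y u v} → x ≤ y → u ≤ v → x + u ≤ y + v
  +-mono-≤ {x} {y} {u} {v} x≤y u≤v =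
    ≤-trans (+-monoˡ-≤ u x≤y) (≤-resp₂ (+-comm u y) (+-comm v y) (+-monoˡ-≤ y u≤v))

  0≤+ : ∀ {x y} → 0# ≤ x → 0# ≤ y → 0# ≤ x + y
  0≤+ 0≤x 0≤y = ≤-respˡ (+-identityˡ 0#) (+-mono-≤ 0≤x 0≤y)

  ≤⇒0≤ : ∀ {x y} → x ≤ y → 0# ≤ y - x
  ≤⇒0≤ {x} {y} x≤y = ≤-respˡ (-‿inverseʳ x) (+-monoˡ-≤ (- x) x≤y)

  0≤⇒≤ : ∀ {x y} → 0# ≤ y - x → x ≤ y
  0≤⇒≤ {x} {y} h = ≤-resp₂ (+-identityˡ x) (solve 2 (λ x y → (y :- x) :+ x := y) refl x y) (+-monoˡ-≤ x h)

  -- Most inequalities below are certificates: the solver checks the identity for `y - x`, and `c`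
  -- is written as a sum of products of quantities already known to be nonnegative.
  by-cert : ∀ {x y c} → y - x ≈ c → 0# ≤ c → x ≤ y
  by-cert eq 0≤c = 0≤⇒≤ (≤-respʳ (sym eq) 0≤c)

  *-monoˡ-≤ : ∀ {x y} c → 0# ≤ c → x ≤ y → c * x ≤ c * y
  *-monoˡ-≤ {x} {y} c 0≤c x≤y =
    by-cert (solve 3 (λ c x y → c :* y :- c :* x := c :* (y :- x)) refl c x y) (*-nonneg 0≤c (≤⇒0≤ x≤y))

  *-monoʳ-≤ : ∀ {x y} c → 0# ≤ c → x ≤ y → x * c ≤ y * c
  *-monoʳ-≤ {x} {y} c 0≤c x≤y = ≤-resp₂ (*-comm c x) (*-comm c y) (*-monoˡ-≤ c 0≤c x≤y)

  *-mono-≤ : ∀ {x y u v} → 0# ≤ x → 0# ≤ u → x ≤ y → u ≤ v → x * u ≤ y * v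
  *-mono-≤ {x} {y} {u} {v} 0≤x 0≤u x≤y u≤v =
    ≤-trans (*-monoʳ-≤ u 0≤u x≤y) (*-monoˡ-≤ y (≤-trans 0≤x x≤y) u≤v)

  0≤sq : ∀ x → 0# ≤ x * x
  0≤sq x with total 0# x
  ... | inj₁ 0≤x = *-nonneg 0≤x 0≤x
  ... | inj₂ x≤0 = ≤-respʳ (solve 1 (λ x → (κ 0 :- x) :* (κ 0 :- x) := x :* x) refl x)
                     (*-nonneg (≤⇒0≤ x≤0) (≤⇒0≤ x≤0))

  0≤1 : 0# ≤ 1#
  0≤1 = ≤-respʳ (*-identityˡ 1#) (0≤sq 1#)

  0≤⟦⟧ : ∀ n → 0# ≤ ⟦ n ⟧
  0≤⟦⟧ zero    = ≤-refl
  0≤⟦⟧ (suc n) = 0≤+ 0≤1 (0≤⟦⟧ n)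

  ⟦⟧-mono : ∀ {m n} → m ℕ.≤ n → ⟦ m ⟧ ≤ ⟦ n ⟧
  ⟦⟧-mono {n = n} ℕ.z≤n = 0≤⟦⟧ n
  ⟦⟧-mono (ℕ.s≤s m≤n)   = +-mono-≤ ≤-refl (⟦⟧-mono m≤n)

  <⇒≤ : ∀ {x y} → x < y → x ≤ y
  <⇒≤ = proj₁

  <⇒≱ : ∀ {x y} → x < y → ¬ (y ≤ x)
  <⇒≱ (x≤y , x≉y) y≤x = x≉y (≤-antisym x≤y y≤x)

  ≰⇒> : ∀ {x y} → ¬ (x ≤ y) → y < x
  ≰⇒> {x} {y} x≰y with total x y
  ... | inj₁ x≤y = ⊥-elim (x≰y x≤y)
  ... | inj₂ y≤x = y≤x , λ y≈x → x≰y (≤-reflexive (sym y≈x))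

  <-≤-trans : ∀ {x y z} → x < y → y ≤ z → x < z
  <-≤-trans x<y y≤z = ≰⇒> λ z≤x → <⇒≱ x<y (≤-trans y≤z z≤x)

  ≤-<-trans : ∀ {x y z} → x ≤ y → y < z → x < z
  ≤-<-trans x≤y y<z = ≰⇒> λ z≤x → <⇒≱ y<z (≤-trans z≤x x≤y)

  <-respʳ : ∀ {x y z} → y ≈ z → x < y → x < z
  <-respʳ y≈z x<y = <-≤-trans x<y (≤-reflexive y≈z)

  0<1 : 0# < 1#
  0<1 = 0≤1 , 0≉1

  0<⇒≉ : ∀ {x} → 0# < x → ¬ (x ≈ 0#)
  0<⇒≉ (_ , 0≉x) x≈0 = 0≉x (sym x≈0)

  inverseʳ : ∀ {x} → 0# < x → x * x ⁻¹ ≈ 1#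
  inverseʳ 0<x = ⁻¹-inverse (0<⇒≉ 0<x)

  inverseˡ : ∀ {x} → 0# < x → x ⁻¹ * x ≈ 1#
  inverseˡ 0<x = trans (*-comm _ _) (inverseʳ 0<x)

  0<⁻¹ : ∀ {x} → 0# < x → 0# < x ⁻¹
  0<⁻¹ {x} 0<x = ≰⇒> λ x⁻¹≤0 → <⇒≱ 0<1
    (≤-resp₂ (inverseʳ 0<x) (zeroʳ x) (*-monoˡ-≤ x (<⇒≤ 0<x) x⁻¹≤0))

  *-cancelˡ-≤ : ∀ {x y} c → 0# < c → c * x ≤ c * y → x ≤ y
  *-cancelˡ-≤ {x} {y} c 0<c h = ≤-resp₂ (e x) (e y) (*-monoˡ-≤ (c ⁻¹) (<⇒≤ (0<⁻¹ 0<c)) h)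
    where
    e : ∀ z → c ⁻¹ * (c * z) ≈ z
    e z = trans (sym (*-assoc _ _ _)) (trans (*-congʳ (inverseˡ 0<c)) (*-identityˡ z))

  0<* : ∀ {x y} → 0# < x → 0# < y → 0# < x * y
  0<* {x} {y} 0<x 0<y = ≰⇒> λ xy≤0 → <⇒≱ 0<y (*-cancelˡ-≤ x 0<x (≤-respʳ (sym (zeroʳ x)) xy≤0))

  0<+ : ∀ {x y} → 0# < x → 0# ≤ y → 0# < x + y
  0<+ {x} {y} 0<x 0≤y = <-≤-trans 0<x (≤-respˡ (+-identityʳ x) (+-mono-≤ ≤-refl 0≤y))

  0<⟦suc⟧ : ∀ n → 0# < ⟦ suc n ⟧
  0<⟦suc⟧ n = 0<+ 0<1 (0≤⟦⟧ n)

  0<2 : 0# < ⟦ 2 ⟧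
  0<2 = 0<⟦suc⟧ 1

  1≤2 : 1# ≤ ⟦ 2 ⟧
  1≤2 = ≤-respˡ ⟦1⟧≈1 (⟦⟧-mono {1} {2} (ℕ.s≤s ℕ.z≤n))

  0≤^ : ∀ {x} n → 0# ≤ x → 0# ≤ x ^ n
  0≤^ zero    0≤x = 0≤1
  0≤^ (suc n) 0≤x = *-nonneg 0≤x (0≤^ n 0≤x)

  0<^ : ∀ {x} n → 0# < x → 0# < x ^ n
  0<^ zero    0<x = 0<1
  0<^ (suc n) 0<x = 0<* 0<x (0<^ n 0<x)

  ^-mono-≤ : ∀ {x y} n → 0# ≤ x → x ≤ y → x ^ n ≤ y ^ n
  ^-mono-≤ zero    0≤x x≤y = ≤-refl
  ^-mono-≤ (suc n) 0≤x x≤y = *-mono-≤ 0≤x (0≤^ n 0≤x) x≤y (^-mono-≤ n 0≤x x≤y)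

  1≤^ : ∀ {x} n → 1# ≤ x → 1# ≤ x ^ n
  1≤^ zero    1≤x = ≤-refl
  1≤^ (suc n) 1≤x = ≤-respˡ (*-identityˡ 1#) (*-mono-≤ 0≤1 0≤1 1≤x (1≤^ n 1≤x))

  ^≤1 : ∀ {x} n → 0# ≤ x → x ≤ 1# → x ^ n ≤ 1#
  ^≤1 zero    0≤x x≤1 = ≤-refl
  ^≤1 (suc n) 0≤x x≤1 = ≤-respʳ (*-identityˡ 1#) (*-mono-≤ 0≤x (0≤^ n 0≤x) x≤1 (^≤1 n 0≤x x≤1))

  ^-monoʳ : ∀ {x} → 1# ≤ x → ∀ {m n} → m ℕ.≤ n → x ^ m ≤ x ^ n
  ^-monoʳ 1≤x {n = n} ℕ.z≤n = 1≤^ n 1≤x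
  ^-monoʳ 1≤x (ℕ.s≤s m≤n)   = *-monoˡ-≤ _ (≤-trans 0≤1 1≤x) (^-monoʳ 1≤x m≤n)

  ^-+ : ∀ x m n → x ^ (m ℕ.+ n) ≈ x ^ m * x ^ n
  ^-+ = EP.^-homo-*

  ^-* : ∀ x y n → (x * y) ^ n ≈ x ^ n * y ^ n
  ^-* = CEP.^-distrib-*

  ^-^ : ∀ x m n → (x ^ m) ^ n ≈ x ^ (m ℕ.* n)
  ^-^ = EP.^-assocʳ

  ^-congˡ : ∀ {x y} n → x ≈ y → x ^ n ≈ y ^ n
  ^-congˡ n = EP.^-congˡ n

  1^ : ∀ n → 1# ^ n ≈ 1#
  1^ zero    = refl
  1^ (suc n) = trans (*-identityˡ _) (1^ n)

  -- Since `_<_` is `_≤_` together with inequality, equality has to be decided here, which takes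
  -- excluded middle.
  ≮⇒≥ : ∀ {x y} → ¬ (x < y) → y ≤ x
  ≮⇒≥ {x} {y} x≮y with total y x
  ... | inj₁ y≤x = y≤x
  ... | inj₂ x≤y with em {x ≈ y}
  ...   | yes x≈y = ≤-reflexive (sym x≈y)
  ...   | no  x≉y = ⊥-elim (x≮y (x≤y , x≉y))

  0<- : ∀ {x y} → x < y → 0# < y - x
  0<- {x} {y} x<y = ≰⇒> λ d≤0 → <⇒≱ x<y
    (by-cert (solve 2 (λ x y → x :- y := κ 0 :- (y :- x)) refl x y) (≤⇒0≤ d≤0))

  *-monoˡ-< : ∀ {x y} c → 0# < c → x < y → c * x < c * y
  *-monoˡ-< c 0<c x<y = ≰⇒> λ h → <⇒≱ x<y (*-cancelˡ-≤ c 0<c h)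

  sq-cancel-≤ : ∀ {x y} → 0# ≤ y → x * x ≤ y * y → x ≤ y
  sq-cancel-≤ {x} {y} 0≤y h = ≮⇒≥ λ y<x →
    <⇒≱ (≤-<-trans (*-monoʳ-≤ y 0≤y (<⇒≤ y<x)) (*-monoˡ-< x (≤-<-trans 0≤y y<x) y<x)) h

  -- Finite sums

  -- Conditions enter sums as factors and not as filtered lists, so that linearity and the exchange
  -- of sums apply to them directly.
  𝟙 : Dec ϕ → Carrier
  𝟙 (yes _) = 1#
  𝟙 (no _)  = 0#

  𝟙-yes : (d : Dec ϕ) → ϕ → 𝟙 d ≈ 1#
  𝟙-yes (yes _) p = refl
  𝟙-yes (no ¬p) p = ⊥-elim (¬p p)

  𝟙-no : (d : Dec ϕ) → ¬ ϕ → 𝟙 d ≈ 0#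
  𝟙-no (yes p) ¬p = ⊥-elim (¬p p)
  𝟙-no (no _)  ¬p = refl

  0≤𝟙 : (d : Dec ϕ) → 0# ≤ 𝟙 d
  0≤𝟙 (yes _) = 0≤1
  0≤𝟙 (no _)  = ≤-refl

  𝟙≤1 : (d : Dec ϕ) → 𝟙 d ≤ 1#
  𝟙≤1 (yes _) = ≤-refl
  𝟙≤1 (no _)  = 0≤1

  𝟙-mono : (ϕ → ψ) → (d : Dec ϕ) (e : Dec ψ) → 𝟙 d ≤ 𝟙 e
  𝟙-mono f (yes p) e = ≤-reflexive (sym (𝟙-yes e (f p)))
  𝟙-mono f (no _)  e = 0≤𝟙 e

  𝟙-iff : (ϕ → ψ) → (ψ → ϕ) → (d : Dec ϕ) (e : Dec ψ) → 𝟙 d ≈ 𝟙 e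
  𝟙-iff f g (yes p) e = sym (𝟙-yes e (f p))
  𝟙-iff f g (no ¬p) e = sym (𝟙-no e (¬p ∘ g))

  𝟙-× : (d : Dec ϕ) (e : Dec ψ) → 𝟙 (d ×-dec e) ≈ 𝟙 d * 𝟙 e
  𝟙-× (yes p) (yes q) = sym (*-identityˡ 1#)
  𝟙-× (yes p) (no ¬q) = sym (zeroʳ 1#)
  𝟙-× (no ¬p) e       = sym (zeroˡ (𝟙 e))

  𝟙-¬ : (d : Dec ϕ) → 𝟙 d + 𝟙 (¬? d) ≈ 1#
  𝟙-¬ (yes p) = +-identityʳ 1#
  𝟙-¬ (no ¬p) = +-identityˡ 1#

  𝟙*-mono : ∀ {x y} (d : Dec ϕ) → (ϕ → x ≤ y) → 𝟙 d * x ≤ 𝟙 d * y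
  𝟙*-mono (yes p) h = *-monoˡ-≤ 1# 0≤1 (h p)
  𝟙*-mono {x = x} {y} (no ¬p) h = ≤-resp₂ (sym (zeroˡ x)) (sym (zeroˡ y)) ≤-refl

  𝟙*-cong : ∀ {x y} (d : Dec ϕ) → (ϕ → x ≈ y) → 𝟙 d * x ≈ 𝟙 d * y
  𝟙*-cong (yes p) h = *-congˡ (h p)
  𝟙*-cong {x = x} {y} (no ¬p) h = trans (zeroˡ x) (sym (zeroˡ y))

  𝟙*≤ : ∀ {x} (d : Dec ϕ) → 0# ≤ x → 𝟙 d * x ≤ x
  𝟙*≤ {x = x} d 0≤x = ≤-respʳ (*-identityˡ x) (*-monoʳ-≤ x 0≤x (𝟙≤1 d))

  ∑-cong : (xs : List α) {f g : α → Carrier} → (∀ x → f x ≈ g x) → ∑ xs f ≈ ∑ xs g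
  ∑-cong []       f≈g = refl
  ∑-cong (x ∷ xs) f≈g = +-cong (f≈g x) (∑-cong xs f≈g)

  ∑-mono : (xs : List α) {f g : α → Carrier} → (∀ x → f x ≤ g x) → ∑ xs f ≤ ∑ xs g
  ∑-mono []       f≤g = ≤-refl
  ∑-mono (x ∷ xs) f≤g = +-mono-≤ (f≤g x) (∑-mono xs f≤g)

  ∑-zero : (xs : List α) → ∑ xs (λ _ → 0#) ≈ 0#
  ∑-zero []       = refl
  ∑-zero (x ∷ xs) = trans (+-identityˡ _) (∑-zero xs)

  ∑-0≤ : (xs : List α) {f : α → Carrier} → (∀ x → 0# ≤ f x) → 0# ≤ ∑ xs f
  ∑-0≤ xs 0≤f = ≤-respˡ (∑-zero xs) (∑-mono xs 0≤f)

  ∑-≈0 : (xs : List α) {f : α → Carrier} → (∀ x → f x ≈ 0#) → ∑ xs f ≈ 0#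
  ∑-≈0 xs f≈0 = trans (∑-cong xs f≈0) (∑-zero xs)

  ∑-+ : (xs : List α) (f g : α → Carrier) → ∑ xs (λ x → f x + g x) ≈ ∑ xs f + ∑ xs g
  ∑-+ []       f g = sym (+-identityˡ 0#)
  ∑-+ (x ∷ xs) f g = trans (+-congˡ (∑-+ xs f g))
    (solve 4 (λ a b c d → (a :+ b) :+ (c :+ d) := (a :+ c) :+ (b :+ d)) refl (f x) (g x) (∑ xs f) (∑ xs g))

  ∑-*ˡ : (xs : List α) (c : Carrier) (f : α → Carrier) → ∑ xs (λ x → c * f x) ≈ c * ∑ xs f
  ∑-*ˡ []       c f = sym (zeroʳ c)
  ∑-*ˡ (x ∷ xs) c f = trans (+-congˡ (∑-*ˡ xs c f)) (sym (distribˡ c _ _))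

  ∑-*ʳ : (xs : List α) (c : Carrier) (f : α → Carrier) → ∑ xs (λ x → f x * c) ≈ ∑ xs f * c
  ∑-*ʳ xs c f = trans (∑-cong xs (λ x → *-comm (f x) c)) (trans (∑-*ˡ xs c f) (*-comm c _))

  ∑-swap : (xs : List α) (ys : List β) (f : α → β → Carrier) →
           ∑ xs (λ x → ∑ ys (f x)) ≈ ∑ ys (λ y → ∑ xs (λ x → f x y))
  ∑-swap []       ys f = sym (∑-zero ys)
  ∑-swap (x ∷ xs) ys f = trans (+-congˡ (∑-swap xs ys f)) (sym (∑-+ ys (f x) _))

  ∑-++ : (xs ys : List α) (f : α → Carrier) → ∑ (xs ++ ys) f ≈ ∑ xs f + ∑ ys f
  ∑-++ []       ys f = sym (+-identityˡ _)
  ∑-++ (x ∷ xs) ys f = trans (+-congˡ (∑-++ xs ys f)) (sym (+-assoc _ _ _))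

  ∑-map : (h : α → β) (xs : List α) (f : β → Carrier) → ∑ (map h xs) f ≈ ∑ xs (f ∘ h)
  ∑-map h []       f = refl
  ∑-map h (x ∷ xs) f = +-congˡ (∑-map h xs f)

  ∑-filter : {ϕ : α → Set} (ϕ? : ∀ x → Dec (ϕ x)) (xs : List α) (f : α → Carrier) →
             ∑ (filter ϕ? xs) f ≈ ∑ xs (λ x → 𝟙 (ϕ? x) * f x)
  ∑-filter ϕ? []       f = refl
  ∑-filter ϕ? (x ∷ xs) f with ϕ? x
  ... | yes _ = +-cong (sym (*-identityˡ _)) (∑-filter ϕ? xs f)
  ... | no  _ = trans (∑-filter ϕ? xs f) (sym (trans (+-congʳ (zeroˡ _)) (+-identityˡ _)))

  ∑-sq : (xs : List α) {f : α → Carrier} → (∀ x → 0# ≤ f x) →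
         ∑ xs (λ x → f x * f x) ≤ ∑ xs f * ∑ xs f
  ∑-sq []           0≤f = ≤-reflexive (sym (zeroˡ 0#))
  ∑-sq (x ∷ xs) {f} 0≤f = ≤-trans (+-mono-≤ ≤-refl (∑-sq xs 0≤f))
    (by-cert (solve 2 (λ a b → (a :+ b) :* (a :+ b) :- (a :* a :+ b :* b) := (a :* b) :+ (a :* b)) refl (f x) (∑ xs f))
      (0≤+ (*-nonneg (0≤f x) (∑-0≤ xs 0≤f)) (*-nonneg (0≤f x) (∑-0≤ xs 0≤f))))

  ∑ˢ : (Subset n → Carrier) → Carrier
  ∑ˢ {n} = ∑ (𝒫 n)

  ∑ᶠ : (Fin n → Carrier) → Carrier
  ∑ᶠ {n} = ∑ (allFin n)

  ∑ˢ-suc : (f : Subset (suc n) → Carrier) →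
           ∑ˢ f ≈ ∑ˢ (f ∘ (outside ∷_)) + ∑ˢ (f ∘ (inside ∷_))
  ∑ˢ-suc {n} f = trans (∑-++ (map (outside ∷_) (𝒫 n)) _ f)
    (+-cong (∑-map _ (𝒫 n) f) (∑-map _ (𝒫 n) f))

  ∑ᶠ-suc : (f : Fin (suc n) → Carrier) → ∑ᶠ f ≈ f zero + ∑ᶠ (f ∘ suc)
  ∑ᶠ-suc {n} f = +-congˡ (trans (≈-reflexive (≡.cong (λ xs → ∑ xs f) (≡.sym (List.map-tabulate id suc)))) (∑-map suc (allFin n) f))

  ∑ˢ-point : (K : Subset n) (f : Subset n → Carrier) → ∑ˢ (λ L → 𝟙 (L ≟ˢ K) * f L) ≈ f K
  ∑ˢ-point []       f = trans (+-identityʳ _) (*-identityˡ _)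
  ∑ˢ-point {suc n} (b ∷ K) f = trans (∑ˢ-suc (λ L → 𝟙 (L ≟ˢ (b ∷ K)) * f L)) (split b f)
    where
    same : ∀ b (g : Subset n → Carrier) → ∑ˢ (λ L → 𝟙 ((b ∷ L) ≟ˢ (b ∷ K)) * g L) ≈ g K
    same b g = trans (∑-cong (𝒫 n) λ L →
      *-congʳ (𝟙-iff ∷-injectiveʳ (≡.cong (b ∷_)) ((b ∷ L) ≟ˢ (b ∷ K)) (L ≟ˢ K))) (∑ˢ-point K g)
    diff : ∀ b c → ¬ (b ≡ c) → (g : Subset n → Carrier) → ∑ˢ (λ L → 𝟙 ((b ∷ L) ≟ˢ (c ∷ K)) * g L) ≈ 0#
    diff b c b≢c g = ∑-≈0 (𝒫 n) λ L →
      trans (*-congʳ (𝟙-no ((b ∷ L) ≟ˢ (c ∷ K)) (b≢c ∘ proj₁ ∘ ∷-injective))) (zeroˡ _)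
    split : ∀ b (f : Subset (suc n) → Carrier) →
      ∑ˢ (λ L → 𝟙 ((outside ∷ L) ≟ˢ (b ∷ K)) * f (outside ∷ L)) +
      ∑ˢ (λ L → 𝟙 ((inside ∷ L) ≟ˢ (b ∷ K)) * f (inside ∷ L)) ≈ f (b ∷ K)
    split outside f = trans (+-cong (same outside _) (diff inside outside (λ ()) _)) (+-identityʳ _)
    split inside  f = trans (+-cong (diff outside inside (λ ()) _) (same inside _)) (+-identityˡ _)

  ∑ˢ-empty : (f : Subset n → Carrier) → ∑ˢ (λ L → 𝟙 (∣ L ∣ ℕ.≟ 0) * f L) ≈ f ∅
  ∑ˢ-empty {zero}  f = trans (+-identityʳ _) (*-identityˡ _)
  ∑ˢ-empty {suc n} f = begin
    ∑ˢ (λ L → 𝟙 (∣ L ∣ ℕ.≟ 0) * f L)                           ≈⟨ ∑ˢ-suc (λ L → 𝟙 (∣ L ∣ ℕ.≟ 0) * f L) ⟩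
    ∑ˢ (λ L → 𝟙 (∣ L ∣ ℕ.≟ 0) * f (outside ∷ L)) +
      ∑ˢ {n} (λ L → 𝟙 (suc ∣ L ∣ ℕ.≟ 0) * f (inside ∷ L))      ≈⟨ +-cong (∑ˢ-empty (f ∘ (outside ∷_)))
                                                                   (∑-≈0 (𝒫 n) λ L → trans (*-congʳ (𝟙-no (suc ∣ L ∣ ℕ.≟ 0) λ ())) (zeroˡ _)) ⟩
    f ∅ + 0#                                                   ≈⟨ +-identityʳ _ ⟩
    f ∅ ∎

  ∑ˢ-singletons : (f : Subset n → Carrier) → ∑ˢ (λ L → 𝟙 (∣ L ∣ ℕ.≟ 1) * f L) ≈ ∑ᶠ (λ u → f ⁅ u ⁆)
  ∑ˢ-singletons {zero}  f = trans (+-identityʳ _) (zeroˡ _)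
  ∑ˢ-singletons {suc n} f = begin
    ∑ˢ (λ L → 𝟙 (∣ L ∣ ℕ.≟ 1) * f L)                           ≈⟨ ∑ˢ-suc (λ L → 𝟙 (∣ L ∣ ℕ.≟ 1) * f L) ⟩
    ∑ˢ (λ L → 𝟙 (∣ L ∣ ℕ.≟ 1) * f (outside ∷ L)) +
      ∑ˢ {n} (λ L → 𝟙 (suc ∣ L ∣ ℕ.≟ 1) * f (inside ∷ L))      ≈⟨ +-cong (∑ˢ-singletons (f ∘ (outside ∷_)))
                                                                   (trans (∑-cong (𝒫 n) λ L → *-congʳ (𝟙-iff ℕ.suc-injective (≡.cong suc) (suc ∣ L ∣ ℕ.≟ 1) (∣ L ∣ ℕ.≟ 0)))
                                                                          (∑ˢ-empty (f ∘ (inside ∷_)))) ⟩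
    ∑ᶠ (λ u → f (outside ∷ ⁅ u ⁆)) + f (inside ∷ ∅)            ≈⟨ +-comm _ _ ⟩
    f (inside ∷ ∅) + ∑ᶠ (λ u → f (outside ∷ ⁅ u ⁆))            ≈⟨ ∑ᶠ-suc (λ u → f ⁅ u ⁆) ⟨
    ∑ᶠ (λ u → f ⁅ u ⁆) ∎

  -- Adding `u` is a bijection from the sets that avoid `u` to the sets that contain it.
  ∑ˢ-insert : (u : Fin n) (f : Subset n → Carrier) →
              ∑ˢ (λ L → 𝟙 (¬? (u ∈? L)) * f (L ∪ ⁅ u ⁆)) ≈ ∑ˢ (λ L → 𝟙 (u ∈? L) * f L)
  ∑ˢ-insert {suc n} zero f = trans (∑ˢ-suc (λ L → 𝟙 (¬? (zero ∈? L)) * f (L ∪ ⁅ zero ⁆)))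
    (trans (+-cong
      (∑-cong (𝒫 n) λ L → trans (*-identityˡ _) (≈-reflexive (≡.cong (λ K → f (inside ∷ K)) (∪-identityʳ L))))
      (∑-≈0 (𝒫 n) λ L → zeroˡ _))
    (sym (trans (∑ˢ-suc (λ L → 𝟙 (zero ∈? L) * f L)) (trans (+-cong
      (∑-≈0 (𝒫 n) λ L → zeroˡ _)
      (∑-cong (𝒫 n) λ L → *-identityˡ _)) (+-comm _ _)))))
  ∑ˢ-insert {suc n} (suc u) f = trans (∑ˢ-suc (λ L → 𝟙 (¬? (suc u ∈? L)) * f (L ∪ ⁅ suc u ⁆)))
    (trans (+-cong (half outside) (half inside)) (sym (∑ˢ-suc (λ L → 𝟙 (suc u ∈? L) * f L))))
    where
    half : ∀ b → ∑ˢ (λ L → 𝟙 (¬? (suc u ∈? (b ∷ L))) * f ((b ∷ L) ∪ ⁅ suc u ⁆)) ≈ ∑ˢ (λ L → 𝟙 (suc u ∈? (b ∷ L)) * f (b ∷ L))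
    half b = begin
      ∑ˢ (λ L → 𝟙 (¬? (suc u ∈? (b ∷ L))) * f ((b ∷ L) ∪ ⁅ suc u ⁆)) ≈⟨ (∑-cong (𝒫 n) λ L → *-cong
          (𝟙-iff (_∘ there) (_∘ drop-there) (¬? (suc u ∈? (b ∷ L))) (¬? (u ∈? L)))
          (≈-reflexive (≡.cong (λ c → f (c ∷ (L ∪ ⁅ u ⁆))) (∨-identityʳ b)))) ⟩
      ∑ˢ (λ L → 𝟙 (¬? (u ∈? L)) * f (b ∷ (L ∪ ⁅ u ⁆)))               ≈⟨ ∑ˢ-insert u (f ∘ (b ∷_)) ⟩
      ∑ˢ (λ L → 𝟙 (u ∈? L) * f (b ∷ L))                              ≈⟨ (∑-cong (𝒫 n) λ L → *-congʳ
          (𝟙-iff there drop-there (u ∈? L) (suc u ∈? (b ∷ L)))) ⟩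
      ∑ˢ (λ L → 𝟙 (suc u ∈? (b ∷ L)) * f (b ∷ L)) ∎

  ∑ᶠ-∈ : (X : Subset n) → ∑ᶠ (λ u → 𝟙 (u ∈? X)) ≈ ⟦ ∣ X ∣ ⟧
  ∑ᶠ-∈ []       = refl
  ∑ᶠ-∈ {suc n} (b ∷ X) = trans (∑ᶠ-suc (λ u → 𝟙 (u ∈? (b ∷ X))))
    (trans (+-congˡ (trans (∑-cong (allFin n) λ u → 𝟙-iff drop-there there (suc u ∈? (b ∷ X)) (u ∈? X)) (∑ᶠ-∈ X))) (first b))
    where
    first : ∀ b → 𝟙 (zero ∈? (b ∷ X)) + ⟦ ∣ X ∣ ⟧ ≈ ⟦ ∣ b ∷ X ∣ ⟧
    first outside = +-identityˡ _
    first inside  = refl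

  -- The binomial theorem: every vertex of `V` contributes `1#` or `x` independently.
  ∑ˢ-⊆-^ : (V : Subset n) (x : Carrier) → ∑ˢ (λ S → 𝟙 (S ⊆? V) * x ^ ∣ S ∣) ≈ (1# + x) ^ ∣ V ∣
  ∑ˢ-⊆-^ []       x = trans (+-identityʳ _) (*-identityˡ 1#)
  ∑ˢ-⊆-^ {suc n} (b ∷ V) x = trans (∑ˢ-suc (λ S → 𝟙 (S ⊆? (b ∷ V)) * x ^ ∣ S ∣)) (trans (+-congʳ (trans
    (∑-cong (𝒫 n) λ S → *-congʳ (𝟙-iff drop-∷-⊆ out⊆ ((outside ∷ S) ⊆? (b ∷ V)) (S ⊆? V))) (∑ˢ-⊆-^ V x))) (second b))
    where
    second : ∀ b → (1# + x) ^ ∣ V ∣ + ∑ˢ (λ S → 𝟙 ((inside ∷ S) ⊆? (b ∷ V)) * x ^ suc ∣ S ∣) ≈ (1# + x) ^ ∣ b ∷ V ∣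
    second outside = trans (+-congˡ (∑-≈0 (𝒫 n) λ S →
      trans (*-congʳ (𝟙-no ((inside ∷ S) ⊆? (outside ∷ V)) λ h → case (h here))) (zeroˡ _))) (+-identityʳ _)
      where
      case : ¬ (zero ∈ (outside ∷ V))
      case ()
    second inside = begin
      (1# + x) ^ ∣ V ∣ + ∑ˢ (λ S → 𝟙 ((inside ∷ S) ⊆? (inside ∷ V)) * x ^ suc ∣ S ∣) ≈⟨ +-congˡ (∑-cong (𝒫 n) λ S → trans
         (*-congʳ (𝟙-iff drop-∷-⊆ in⊆in ((inside ∷ S) ⊆? (inside ∷ V)) (S ⊆? V)))
         (solve 3 (λ a b c → a :* (b :* c) := b :* (a :* c)) refl (𝟙 (S ⊆? V)) x (x ^ ∣ S ∣))) ⟩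
      (1# + x) ^ ∣ V ∣ + ∑ˢ (λ S → x * (𝟙 (S ⊆? V) * x ^ ∣ S ∣)) ≈⟨ +-congˡ (trans (∑-*ˡ (𝒫 n) x _) (*-congˡ (∑ˢ-⊆-^ V x))) ⟩
      (1# + x) ^ ∣ V ∣ + x * (1# + x) ^ ∣ V ∣                    ≈⟨ solve 2 (λ x y → y :+ x :* y := (κ 1 :+ x) :* y) refl x _ ⟩
      (1# + x) ^ suc ∣ V ∣ ∎

  ∑-∈ : {A : Set} {xs : List A} {x : A} (f : A → Carrier) → (∀ y → 0# ≤ f y) → x ∈ˡ xs → f x ≤ ∑ xs f
  ∑-∈ {xs = y ∷ xs} f 0≤f (hereˡ ≡.refl) =
    ≤-respˡ (+-identityʳ (f y)) (+-mono-≤ ≤-refl (∑-0≤ xs 0≤f))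
  ∑-∈ {xs = y ∷ xs} f 0≤f (thereˡ x∈) =
    ≤-respˡ (+-identityˡ _) (+-mono-≤ (0≤f y) (∑-∈ f 0≤f x∈))

  -- Degrees and the quadratic forms built from them

  module Form {A B : Set} (as : List A) (bs : List B) (k : B → A → Carrier) where

    -- The incidence `k` stays abstract because two are needed: L ⊆ E for degrees in H, and K ⊆ π(E)
    -- for degrees in π(H) of a weight that still lives on the edges of H.
    deg : (A → Carrier) → B → Carrier
    deg ν b = ∑ as (λ a → k b a * ν a)

    form : (B → Carrier) → (A → Carrier) → (A → Carrier) → Carrier
    form c ν μ = ∑ bs (λ b → c b * (deg ν b * deg μ b))

    deg-+* : ∀ ν μ t b → deg (λ a → ν a + t * μ a) b ≈ deg ν b + t * deg μ b
    deg-+* ν μ t b = trans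
      (∑-cong as λ a → solve 4 (λ k x t y → k :* (x :+ t :* y) := k :* x :+ t :* (k :* y)) refl (k b a) (ν a) t (μ a))
      (trans (∑-+ as _ _) (+-congˡ (∑-*ˡ as t _)))

    deg-* : ∀ ν t b → deg (λ a → t * ν a) b ≈ t * deg ν b
    deg-* ν t b = trans
      (∑-cong as λ a → solve 3 (λ k t x → k :* (t :* x) := t :* (k :* x)) refl (k b a) t (ν a)) (∑-*ˡ as t _)

    form-+* : ∀ c ν μ t → form c (λ a → ν a + t * μ a) (λ a → ν a + t * μ a)
                          ≈ form c ν ν + (⟦ 2 ⟧ * t * form c ν μ + t * t * form c μ μ)
    form-+* c ν μ t = trans
      (∑-cong bs λ b → trans (*-congˡ (*-cong (deg-+* ν μ t b) (deg-+* ν μ t b)))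
        (solve 4 (λ c x t y → c :* ((x :+ t :* y) :* (x :+ t :* y))
                              := c :* (x :* x) :+ (κ 2 :* t :* (c :* (x :* y)) :+ t :* t :* (c :* (y :* y))))
           refl (c b) (deg ν b) t (deg μ b)))
      (trans (∑-+ bs _ _) (+-congˡ (trans (∑-+ bs _ _) (+-cong (∑-*ˡ bs _ _) (∑-*ˡ bs _ _)))))

    form-* : ∀ c ν t → form c (λ a → t * ν a) (λ a → t * ν a) ≈ t * t * form c ν ν
    form-* c ν t = trans
      (∑-cong bs λ b → trans (*-congˡ (*-cong (deg-* ν t b) (deg-* ν t b)))
        (solve 3 (λ c t x → c :* ((t :* x) :* (t :* x)) := t :* t :* (c :* (x :* x))) refl (c b) t (deg ν b)))
      (∑-*ˡ bs _ _)

    module _ (0≤k : ∀ b a → 0# ≤ k b a) where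

      0≤deg : ∀ {ν} → (∀ a → 0# ≤ ν a) → ∀ b → 0# ≤ deg ν b
      0≤deg 0≤ν b = ∑-0≤ as λ a → *-nonneg (0≤k b a) (0≤ν a)

      deg-mono : ∀ {ν μ} → (∀ a → ν a ≤ μ a) → ∀ b → deg ν b ≤ deg μ b
      deg-mono ν≤μ b = ∑-mono as λ a → *-monoˡ-≤ (k b a) (0≤k b a) (ν≤μ a)

      form-mono : ∀ {c ν μ} → (∀ b → 0# ≤ c b) → (∀ a → 0# ≤ ν a) → (∀ a → ν a ≤ μ a) → form c ν ν ≤ form c μ μ
      form-mono 0≤c 0≤ν ν≤μ = ∑-mono bs λ b → *-monoˡ-≤ _ (0≤c b)
        (*-mono-≤ (0≤deg 0≤ν b) (0≤deg 0≤ν b) (deg-mono ν≤μ b) (deg-mono ν≤μ b))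

    0≤form : ∀ {c} ν → (∀ b → 0# ≤ c b) → 0# ≤ form c ν ν
    0≤form ν 0≤c = ∑-0≤ bs λ b → *-nonneg (0≤c b) (0≤sq (deg ν b))

  -- The potential J and the second fingerprint

  Weights : ℕ → Set
  Weights n = Subset n → Carrier

  ⁅⁆⊆ : ∀ {u : Fin n} {L} → u ∈ L → ⁅ u ⁆ ⊆ L
  ⁅⁆⊆ {u = u} {L} u∈L x∈ = ≡.subst (_∈ L) (≡.sym (x∈⁅y⁆⇒x≡y u x∈)) u∈L

  ⁅⁆⊆⁻ : ∀ {u : Fin n} {L} → ⁅ u ⁆ ⊆ L → u ∈ L
  ⁅⁆⊆⁻ {u = u} h = h (x∈⁅x⁆ u)

  ∪⁅⁆⊆ : ∀ {u : Fin n} {L E} → L ⊆ E → u ∈ E → L ∪ ⁅ u ⁆ ⊆ E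
  ∪⁅⁆⊆ {u = u} {L} L⊆E u∈E x∈ = [ L⊆E , ⁅⁆⊆ u∈E ]′ (x∈p∪q⁻ L ⁅ u ⁆ x∈)

  ∈⇒∪⁅⁆≡ : ∀ {u : Fin n} {L} → u ∈ L → L ∪ ⁅ u ⁆ ≡ L
  ∈⇒∪⁅⁆≡ {u = u} u∈L = ⊆-antisym (∪⁅⁆⊆ id u∈L) (p⊆p∪q ⁅ u ⁆)

  ∣∪⁅⁆∣ : ∀ {u : Fin n} {L} → u ∉ L → ∣ L ∪ ⁅ u ⁆ ∣ ≡ suc ∣ L ∣
  ∣∪⁅⁆∣ {u = zero}  {outside ∷ L} u∉ = ≡.cong (suc ∘ ∣_∣) (∪-identityʳ L)
  ∣∪⁅⁆∣ {u = zero}  {inside ∷ L}  u∉ = ⊥-elim (u∉ here)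
  ∣∪⁅⁆∣ {u = suc u} {outside ∷ L} u∉ = ∣∪⁅⁆∣ (u∉ ∘ there)
  ∣∪⁅⁆∣ {u = suc u} {inside ∷ L}  u∉ = ≡.cong suc (∣∪⁅⁆∣ (u∉ ∘ there))

  Disjoint : Subset n → Subset n → Set
  Disjoint L S = ∀ u → u ∈ L → u ∉ S

  ∈-allSubsets : (L : Subset n) → L ∈ˡ 𝒫 n
  ∈-allSubsets []            = hereˡ ≡.refl
  ∈-allSubsets (outside ∷ L) = ∈-++⁺ˡ (∈-map⁺ (outside ∷_) (∈-allSubsets L))
  ∈-allSubsets (inside ∷ L)  = ∈-++⁺ʳ (map (outside ∷_) (𝒫 _)) (∈-map⁺ (inside ∷_) (∈-allSubsets L))

  ∑ᶠ-⁅⁆⊆ : (E : Subset n) → ∑ᶠ (λ u → 𝟙 (⁅ u ⁆ ⊆? E)) ≈ ⟦ ∣ E ∣ ⟧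
  ∑ᶠ-⁅⁆⊆ E = trans (∑-cong (allFin _) λ u → 𝟙-iff ⁅⁆⊆⁻ ⁅⁆⊆ (⁅ u ⁆ ⊆? E) (u ∈? E)) (∑ᶠ-∈ E)

  nonempty : {L : Subset n} → 1 ℕ.≤ ∣ L ∣ → ∃[ u ] u ∈ L
  nonempty {n} {L} 1≤ with nonempty? L
  ... | yes h = h
  ... | no ¬h = ⊥-elim (ℕ.<⇒≢ 1≤ (≡.sym (≡.trans (≡.cong ∣_∣ (Empty-unique ¬h)) (∣⊥∣≡0 n))))

  module Potential {M : ℕ} (V : Subset M) (𝓔 : Subset M → Set) (𝓔⊆V : ∀ E → 𝓔 E → E ⊆ V)
    (p ρ : Carrier) (0<p : 0# < p) (p≤1 : p ≤ 1#) (pρ≈1 : p * ρ ≈ 1#) where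

    -- No nonempty subset of an edge inside `S` is disjoint from `S`, so the weight of such an edge
    -- would enter `Φ S` only linearly and the supremum `J S` would be infinite.
    Free : Subset M → Set
    Free S = ∀ E → 𝓔 E → ¬ (E ⊆ S)

    Admissible : Weights M → Set
    Admissible ν = (∀ E → 0# ≤ ν E) × (∀ E → ¬ 𝓔 E → ν E ≈ 0#)

    open Form (𝒫 M) (𝒫 M) (λ L E → 𝟙 (L ⊆? E)) public

    0≤k : ∀ (L E : Subset M) → 0# ≤ 𝟙 (L ⊆? E)
    0≤k L E = 0≤𝟙 (L ⊆? E)

    coeff : Subset M → Subset M → Carrier
    coeff S L = 𝟙 (1 ℕ.≤? ∣ L ∣) * (𝟙 (em {Disjoint L S}) * ρ ^ ∣ L ∣)

    Q : Subset M → Weights M → Carrier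
    Q S ν = form (coeff S) ν ν

    Φ : Subset M → Weights M → Carrier
    Φ S ν = ⟦ 2 ⟧ * ∑ˢ ν - Q S ν

    J : Subset M → Carrier
    J S = ⋁ λ z → Σ[ ν ∈ Weights M ] Admissible ν × z ≈ Φ S ν

    0≤p : 0# ≤ p
    0≤p = <⇒≤ 0<p

    0≤ρ : 0# ≤ ρ
    0≤ρ = *-cancelˡ-≤ p 0<p (≤-resp₂ (sym (zeroʳ p)) (sym pρ≈1) 0≤1)

    0≤coeff : ∀ S L → 0# ≤ coeff S L
    0≤coeff S L = *-nonneg (0≤𝟙 (1 ℕ.≤? ∣ L ∣)) (*-nonneg (0≤𝟙 (em {Disjoint L S})) (0≤^ ∣ L ∣ 0≤ρ))

    coeff-⁅⁆ : ∀ {S u} → u ∉ S → coeff S ⁅ u ⁆ ≈ ρ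
    coeff-⁅⁆ {S} {u} u∉S rewrite ∣⁅x⁆∣≡1 u = begin
      1# * (𝟙 (em {Disjoint ⁅ u ⁆ S}) * (ρ * 1#)) ≈⟨ *-congˡ (*-congʳ (𝟙-yes (em {Disjoint ⁅ u ⁆ S})
                                                       λ x x∈ x∈S → u∉S (≡.subst (_∈ S) (x∈⁅y⁆⇒x≡y u x∈) x∈S))) ⟩
      1# * (1# * (ρ * 1#))                       ≈⟨ solve 1 (λ ρ → κ 1 :* (κ 1 :* (ρ :* κ 1)) := ρ) refl ρ ⟩
      ρ ∎

    coeff-∪ : ∀ S u L → coeff (S ∪ ⁅ u ⁆) L ≈ 𝟙 (¬? (u ∈? L)) * coeff S L
    coeff-∪ S u L = trans (*-congˡ (*-congʳ
        (trans (𝟙-iff to from (em {Disjoint L (S ∪ ⁅ u ⁆)}) (¬? (u ∈? L) ×-dec em {Disjoint L S})) (𝟙-× (¬? (u ∈? L)) (em {Disjoint L S})))))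
      (solve 4 (λ a b c d → a :* ((b :* c) :* d) := b :* (a :* (c :* d))) refl
         (𝟙 (1 ℕ.≤? ∣ L ∣)) (𝟙 (¬? (u ∈? L))) (𝟙 (em {Disjoint L S})) (ρ ^ ∣ L ∣))
      where
      to : Disjoint L (S ∪ ⁅ u ⁆) → u ∉ L × Disjoint L S
      to h = (λ u∈L → h u u∈L (q⊆p∪q S ⁅ u ⁆ (x∈⁅x⁆ u))) , λ x x∈L x∈S → h x x∈L (p⊆p∪q ⁅ u ⁆ x∈S)
      from : u ∉ L × Disjoint L S → Disjoint L (S ∪ ⁅ u ⁆)
      from (u∉L , h) x x∈L x∈ = [ h x x∈L , (λ x∈u → u∉L (≡.subst (_∈ L) (x∈⁅y⁆⇒x≡y u x∈u) x∈L)) ]′ (x∈p∪q⁻ S ⁅ u ⁆ x∈)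

    -- One more vertex multiplies ρ^|L| by ρ = 1/p. The two sides differ only at L = ∅, where the
    -- coefficient on the left vanishes.
    coeff-insert : ∀ {S u L} → u ∉ S → u ∉ L → coeff S L ≤ p * coeff S (L ∪ ⁅ u ⁆)
    coeff-insert {S} {u} {L} u∉S u∉L rewrite ∣∪⁅⁆∣ u∉L = ≤-respʳ
      (begin
        𝟙 (em {Disjoint L S}) * ρ ^ ∣ L ∣                              ≈⟨ solve 2 (λ a b → a :* b := κ 1 :* (a :* (κ 1 :* b))) refl _ _ ⟩
        1# * (𝟙 (em {Disjoint L S}) * (1# * ρ ^ ∣ L ∣))                ≈⟨ *-congˡ (*-cong (𝟙-iff ins (λ h x x∈L → h x (p⊆p∪q ⁅ u ⁆ x∈L)) (em {Disjoint L S}) (em {Disjoint (L ∪ ⁅ u ⁆) S})) (*-congʳ (sym pρ≈1))) ⟩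
        1# * (𝟙 (em {Disjoint (L ∪ ⁅ u ⁆) S}) * (p * ρ * ρ ^ ∣ L ∣))   ≈⟨ solve 4 (λ a p ρ b → κ 1 :* (a :* (p :* ρ :* b)) := p :* (κ 1 :* (a :* (ρ :* b)))) refl _ p ρ _ ⟩
        p * (1# * (𝟙 (em {Disjoint (L ∪ ⁅ u ⁆) S}) * (ρ * ρ ^ ∣ L ∣))) ∎)
      (𝟙*≤ (1 ℕ.≤? ∣ L ∣) (*-nonneg (0≤𝟙 (em {Disjoint L S})) (0≤^ ∣ L ∣ 0≤ρ)))
      where
      ins : Disjoint L S → Disjoint (L ∪ ⁅ u ⁆) S
      ins h x x∈ = [ h x , (λ x∈u x∈S → u∉S (≡.subst (_∈ S) (x∈⁅y⁆⇒x≡y u x∈u) x∈S)) ]′ (x∈p∪q⁻ L ⁅ u ⁆ x∈)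

    singletons≤Q : ∀ S ν → ∑ᶠ (λ u → coeff S ⁅ u ⁆ * (deg ν ⁅ u ⁆ * deg ν ⁅ u ⁆)) ≤ Q S ν
    singletons≤Q S ν = ≤-respˡ (∑ˢ-singletons (λ L → coeff S L * (deg ν L * deg ν L)))
      (∑-mono (𝒫 M) λ L → 𝟙*≤ (∣ L ∣ ℕ.≟ 1) (*-nonneg (0≤coeff S L) (0≤sq (deg ν L))))

    -- Freeness gives every edge a vertex outside `S`, so the total weight is at most the sum of the
    -- singleton degrees over V minus S. Their squares occur in `Q S ν`, and what remains at each
    -- vertex is a parabola with maximum `p`.
    Φ≤pn : ∀ {S ν} → Free S → Admissible ν → Φ S ν ≤ p * ⟦ ∣ V ∣ ⟧
    Φ≤pn {S} {ν} free (0≤ν , ν≈0) = ≤-trans step₁ (≤-trans step₂ step₃)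
      where
      m : Fin M → Carrier
      m u = 𝟙 (u ∈? V) * 𝟙 (¬? (u ∈? S))
      0≤m : ∀ u → 0# ≤ m u
      0≤m u = *-nonneg (0≤𝟙 (u ∈? V)) (0≤𝟙 (¬? (u ∈? S)))
      D : Fin M → Carrier
      D u = deg ν ⁅ u ⁆
      hit : ∀ E → ν E ≤ ∑ᶠ (λ u → m u * (𝟙 (⁅ u ⁆ ⊆? E) * ν E))
      hit E with em {𝓔 E}
      ... | no ¬E = ≤-respˡ (sym (ν≈0 E ¬E)) (∑-0≤ (allFin M) λ u → *-nonneg (0≤m u) (*-nonneg (0≤k ⁅ u ⁆ E) (0≤ν E)))
      ... | yes e with em {∃[ u ] u ∈ E × u ∉ S}
      ...   | no none = ⊥-elim (free E e λ {u} u∈E → inside-S u u∈E)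
        where
        inside-S : ∀ u → u ∈ E → u ∈ S
        inside-S u u∈E with u ∈? S
        ... | yes u∈S = u∈S
        ... | no  u∉S = ⊥-elim (none (u , u∈E , u∉S))
      ...   | yes (u , u∈E , u∉S) = ≤-respˡ
        (trans (*-cong (*-cong (𝟙-yes (u ∈? V) (𝓔⊆V E e u∈E)) (𝟙-yes (¬? (u ∈? S)) u∉S)) (*-congʳ (𝟙-yes (⁅ u ⁆ ⊆? E) (⁅⁆⊆ u∈E))))
          (solve 1 (λ x → κ 1 :* κ 1 :* (κ 1 :* x) := x) refl (ν E)))
        (∑-∈ (λ u → m u * (𝟙 (⁅ u ⁆ ⊆? E) * ν E)) (λ u → *-nonneg (0≤m u) (*-nonneg (0≤k ⁅ u ⁆ E) (0≤ν E))) (∈-allFin u))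
      e≤ : ∑ˢ ν ≤ ∑ᶠ (λ u → m u * D u)
      e≤ = ≤-respʳ (trans (∑-swap (𝒫 M) (allFin M) _) (∑-cong (allFin M) λ u → ∑-*ˡ (𝒫 M) (m u) _))
        (∑-mono (𝒫 M) hit)
      step₁ : Φ S ν ≤ ∑ᶠ (λ u → m u * (⟦ 2 ⟧ * D u - ρ * (D u * D u)))
      step₁ = ≤-respʳ (trans (trans (+-cong (sym (∑-*ˡ (allFin M) ⟦ 2 ⟧ _)) (trans (solve 1 (λ x → :- x := :- κ 1 :* x) refl _) (sym (∑-*ˡ (allFin M) (- 1#) _)))) (sym (∑-+ (allFin M) _ _)))
          (∑-cong (allFin M) λ u → solve 3 (λ m d r → κ 2 :* (m :* d) :+ :- κ 1 :* (m :* (r :* (d :* d))) := m :* (κ 2 :* d :- r :* (d :* d))) refl (m u) (D u) ρ))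
        (by-cert (solve 4 (λ e e′ q q′ → (κ 2 :* e′ :- q′) :- (κ 2 :* e :- q) := κ 2 :* (e′ :- e) :+ (q :- q′)) refl (∑ˢ ν) _ (Q S ν) _)
          (0≤+ (*-nonneg (0≤⟦⟧ 2) (≤⇒0≤ e≤)) (≤⇒0≤ (≤-trans (∑-mono (allFin M) single) (singletons≤Q S ν)))))
        where
        single : ∀ u → m u * (ρ * (D u * D u)) ≤ coeff S ⁅ u ⁆ * (D u * D u)
        single u with u ∈? S
        ... | yes _ = ≤-respˡ (solve 2 (λ a x → κ 0 := a :* κ 0 :* x) refl (𝟙 (u ∈? V)) _) (*-nonneg (0≤coeff S ⁅ u ⁆) (0≤sq (D u)))
        ... | no u∉S = ≤-respʳ (*-congʳ (sym (coeff-⁅⁆ u∉S)))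
                         (≤-respˡ (solve 2 (λ a x → a :* x := a :* κ 1 :* x) refl (𝟙 (u ∈? V)) _)
                           (𝟙*≤ (u ∈? V) (*-nonneg 0≤ρ (0≤sq (D u)))))
      step₂ : ∑ᶠ (λ u → m u * (⟦ 2 ⟧ * D u - ρ * (D u * D u))) ≤ ∑ᶠ (λ u → p * 𝟙 (u ∈? V))
      step₂ = ∑-mono (allFin M) λ u → ≤-trans (*-monoˡ-≤ (m u) (0≤m u) (parabola (D u)))
        (≤-resp₂ (solve 3 (λ a b p → p :* (a :* b) := a :* b :* p) refl (𝟙 (u ∈? V)) (𝟙 (¬? (u ∈? S))) p) (*-congˡ (*-identityʳ _))
          (*-monoˡ-≤ p 0≤p (*-monoˡ-≤ _ (0≤𝟙 (u ∈? V)) (𝟙≤1 (¬? (u ∈? S))))))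
        where
        -- p - 2d + ρd² = p (1 - ρd)²
        parabola : ∀ d → ⟦ 2 ⟧ * d - ρ * (d * d) ≤ p
        parabola d = by-cert (begin
          p - (⟦ 2 ⟧ * d - ρ * (d * d))            ≈⟨ solve 3 (λ p ρ d → p :- (κ 2 :* d :- ρ :* (d :* d)) := p :+ :- (κ 2 :* κ 1 :* d) :+ κ 1 :* ρ :* (d :* d)) refl p ρ d ⟩
          p + - (⟦ 2 ⟧ * 1# * d) + 1# * ρ * (d * d) ≈⟨ +-cong (+-congˡ (-‿cong (*-congʳ (*-congˡ (sym pρ≈1))))) (*-congʳ (*-congʳ (sym pρ≈1))) ⟩
          p + - (⟦ 2 ⟧ * (p * ρ) * d) + p * ρ * ρ * (d * d) ≈⟨ solve 3 (λ p ρ d → p :+ :- (κ 2 :* (p :* ρ) :* d) :+ p :* ρ :* ρ :* (d :* d) := p :* ((κ 1 :- ρ :* d) :* (κ 1 :- ρ :* d))) refl p ρ d ⟩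
          p * ((1# - ρ * d) * (1# - ρ * d)) ∎) (*-nonneg 0≤p (0≤sq _))
      step₃ : ∑ᶠ (λ u → p * 𝟙 (u ∈? V)) ≤ p * ⟦ ∣ V ∣ ⟧
      step₃ = ≤-reflexive (trans (∑-*ˡ (allFin M) p _) (*-congˡ (∑ᶠ-∈ V)))

    Φ≤J : ∀ {S ν} → Free S → Admissible ν → Φ S ν ≤ J S
    Φ≤J {S} {ν} free adm = ⋁-upper _ (p * ⟦ ∣ V ∣ ⟧ , λ { x (μ , admμ , x≈) → ≤-respˡ (sym x≈) (Φ≤pn free admμ) }) _ (ν , adm , refl)

    zero-admissible : Admissible (λ _ → 0#)
    zero-admissible = (λ _ → ≤-refl) , λ _ _ → refl

    J≤pn : ∀ {S} → Free S → J S ≤ p * ⟦ ∣ V ∣ ⟧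
    J≤pn free = ⋁-least _ (_ , (λ _ → 0#) , zero-admissible , refl) _ λ { x (μ , admμ , x≈) → ≤-respˡ (sym x≈) (Φ≤pn free admμ) }

    0≤J : ∀ {S} → Free S → 0# ≤ J S
    0≤J {S} free = ≤-respˡ Φ0≈0 (Φ≤J free zero-admissible)
      where
      deg0 : ∀ L → deg (λ _ → 0#) L ≈ 0#
      deg0 L = ∑-≈0 (𝒫 M) λ E → zeroʳ _
      Φ0≈0 : Φ S (λ _ → 0#) ≈ 0#
      Φ0≈0 = trans (+-cong (*-congˡ (∑-zero (𝒫 M))) (-‿cong (∑-≈0 (𝒫 M) λ L → trans (*-congˡ (*-congʳ (deg0 L))) (solve 2 (λ a b → a :* (κ 0 :* b) := κ 0) refl _ _))))
        (solve 0 (κ 2 :* κ 0 :- κ 0 := κ 0) refl)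

    -- A maximiser would require compactness. A defect `τ` is enough, because the estimates that use
    -- `ν` have slack.
    near-optimal : ∀ {S} τ → 0# < τ → Σ[ ν ∈ Weights M ] Admissible ν × J S - τ ≤ Φ S ν
    near-optimal {S} τ 0<τ with em {Σ[ ν ∈ Weights M ] Admissible ν × J S - τ ≤ Φ S ν}
    ... | yes h = h
    ... | no ¬h = ⊥-elim (<⇒≱ 0<τ (by-cert (solve 2 (λ j t → κ 0 :- t := (j :- t) :- j) refl (J S) τ) (≤⇒0≤
            (⋁-least _ (_ , (λ _ → 0#) , zero-admissible , refl) (J S - τ)
              λ { x (μ , admμ , x≈) → ≤-respˡ (sym x≈) (<⇒≤ (≰⇒> λ le → ¬h (μ , admμ , le))) }))))

    restrict : Fin M → Weights M → Weights M
    restrict u ν E = 𝟙 (u ∈? E) * ν E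

    boost : Weights M → Fin M → Carrier → Weights M
    boost ν u t E = ν E + t * restrict u ν E

    -- By `coeff-∪` this is the part of `Q S ν` that disappears when `u` joins `S`.
    T : Subset M → Weights M → Fin M → Carrier
    T S ν u = ∑ˢ λ L → 𝟙 (u ∈? L) * (coeff S L * (deg ν L * deg ν L))

    0≤T : ∀ S ν u → 0# ≤ T S ν u
    0≤T S ν u = ∑-0≤ (𝒫 M) λ L → *-nonneg (0≤𝟙 (u ∈? L)) (*-nonneg (0≤coeff S L) (0≤sq (deg ν L)))

    deg-restrict : ∀ u ν L → deg (restrict u ν) L ≈ deg ν (L ∪ ⁅ u ⁆)
    deg-restrict u ν L = ∑-cong (𝒫 M) λ E → trans (sym (*-assoc _ _ _)) (*-congʳ (trans
      (sym (𝟙-× (L ⊆? E) (u ∈? E)))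
      (𝟙-iff (to E) (from E) (L ⊆? E ×-dec u ∈? E) (L ∪ ⁅ u ⁆ ⊆? E))))
      where
      to : ∀ E → L ⊆ E × u ∈ E → L ∪ ⁅ u ⁆ ⊆ E
      to E (L⊆E , u∈E) = ∪⁅⁆⊆ L⊆E u∈E
      from : ∀ E → L ∪ ⁅ u ⁆ ⊆ E → L ⊆ E × u ∈ E
      from E h = (λ x∈L → h (p⊆p∪q ⁅ u ⁆ x∈L)) , h (q⊆p∪q L ⁅ u ⁆ (x∈⁅x⁆ u))

    boost-admissible : ∀ {ν u t} → Admissible ν → 0# ≤ 1# + t → Admissible (boost ν u t)
    boost-admissible {ν} {u} {t} (0≤ν , ν≈0) 0≤1+t =
      (λ E → ≤-respʳ (solve 3 (λ x t a → x :* (κ 1 :+ t :* a) := x :+ t :* (a :* x)) refl (ν E) t (𝟙 (u ∈? E)))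
         (*-nonneg (0≤ν E) (factor (u ∈? E)))) ,
      λ E ¬E → trans (+-cong (ν≈0 E ¬E) (*-congˡ (*-congˡ (ν≈0 E ¬E)))) (solve 2 (λ t a → κ 0 :+ t :* (a :* κ 0) := κ 0) refl t (𝟙 (u ∈? E)))
      where
      factor : ∀ {P : Set} (d : Dec P) → 0# ≤ 1# + t * 𝟙 d
      factor (yes _) = ≤-respʳ (+-congˡ (sym (*-identityʳ t))) 0≤1+t
      factor (no _)  = ≤-respʳ (solve 1 (λ t → κ 1 := κ 1 :+ t :* κ 0) refl t) 0≤1

    -- Perturbing an almost optimal weight at one vertex

    module Pick (S : Subset M) (u : Fin M) (u∉S : u ∉ S) (ν : Weights M) where

      private
        c d d′ g₁ g₂ g₃ : Subset M → Carrier
        c = coeff S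
        d = deg ν
        d′ = deg (restrict u ν)
        g₁ L = c L * (d L * d L)
        g₂ L = c L * (d L * d′ L)
        g₃ L = c L * (d′ L * d′ L)
        χ χ̄ : Subset M → Carrier
        χ L = 𝟙 (u ∈? L)
        χ̄ L = 𝟙 (¬? (u ∈? L))

        on : (Subset M → Carrier) → Carrier
        on g = ∑ˢ (λ L → χ L * g L)
        off : (Subset M → Carrier) → Carrier
        off g = ∑ˢ (λ L → χ̄ L * g L)

        split : ∀ g → ∑ˢ g ≈ on g + off g
        split g = trans (∑-cong (𝒫 M) λ L → trans (sym (*-identityˡ (g L)))
          (trans (*-congʳ (sym (𝟙-¬ (u ∈? L)))) (distribʳ (g L) _ _))) (∑-+ (𝒫 M) _ _)

        d′≈d : ∀ L → u ∈ L → d′ L ≈ d L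
        d′≈d L u∈L = trans (deg-restrict u ν L) (≈-reflexive (≡.cong d (∈⇒∪⁅⁆≡ u∈L)))

        t = T S ν u

        on₂ : on g₂ ≈ t
        on₂ = ∑-cong (𝒫 M) λ L → 𝟙*-cong (u ∈? L) λ u∈L → *-congˡ (*-congˡ (d′≈d L u∈L))
        on₃ : on g₃ ≈ t
        on₃ = ∑-cong (𝒫 M) λ L → 𝟙*-cong (u ∈? L) λ u∈L → *-congˡ (*-cong (d′≈d L u∈L) (d′≈d L u∈L))

        -- At a set L that avoids `u`, the restricted weight has the degree of `ν` at L ∪ u.
        -- Re-indexing by L ∪ u yields the sum `t`, and the change of coefficient yields the factor
        -- `p`.
        off₃≤ : off g₃ ≤ p * t
        off₃≤ = ≤-respʳ (trans (∑ˢ-insert u (λ L → p * g₁ L))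
            (trans (∑-cong (𝒫 M) λ L → solve 3 (λ a p b → a :* (p :* b) := p :* (a :* b)) refl (χ L) p (g₁ L)) (∑-*ˡ (𝒫 M) p _)))
          (∑-mono (𝒫 M) λ L → 𝟙*-mono (¬? (u ∈? L)) λ u∉L →
            ≤-respˡ (*-congˡ (*-cong (sym (deg-restrict u ν L)) (sym (deg-restrict u ν L))))
              (≤-respʳ (*-assoc p _ _) (*-monoʳ-≤ _ (0≤sq (d (L ∪ ⁅ u ⁆))) (coeff-insert u∉S u∉L))))

        off-form : ∀ (g : Subset M → Carrier) → ∑ˢ (λ L → coeff (S ∪ ⁅ u ⁆) L * g L) ≈ off (λ L → c L * g L)
        off-form g = ∑-cong (𝒫 M) λ L → trans (*-congʳ (coeff-∪ S u L)) (*-assoc _ _ _)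

        e δ a b b′ : Carrier
        e = ∑ˢ ν
        δ = ∑ˢ (restrict u ν)
        a = off g₁
        b = off g₂
        b′ = off g₃

        e-boost : ∀ y → ∑ˢ (boost ν u y) ≈ e + y * δ
        e-boost y = trans (∑-+ (𝒫 M) _ _) (+-congˡ (∑-*ˡ (𝒫 M) y _))

        Φ-old : Φ S ν ≈ ⟦ 2 ⟧ * e - (t + a)
        Φ-old = +-congˡ (-‿cong (split g₁))

        Φ-boost : ∀ y → Φ S (boost ν u y) ≈ ⟦ 2 ⟧ * (e + y * δ) - ((t + a) + (⟦ 2 ⟧ * y * (t + b) + y * y * (t + b′)))
        Φ-boost y = +-cong (*-congˡ (e-boost y)) (-‿cong (trans (form-+* (coeff S) ν (restrict u ν) y)
          (+-cong (split g₁) (+-cong (*-congˡ (trans (split g₂) (+-congʳ on₂))) (*-congˡ (trans (split g₃) (+-congʳ on₃)))))))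

        Φ-pick : ∀ y → Φ (S ∪ ⁅ u ⁆) (boost ν u y) ≈ ⟦ 2 ⟧ * (e + y * δ) - (a + (⟦ 2 ⟧ * y * b + y * y * b′))
        Φ-pick y = +-cong (*-congˡ (e-boost y)) (-‿cong (trans (form-+* (coeff (S ∪ ⁅ u ⁆)) ν (restrict u ν) y)
          (+-cong (off-form _) (+-cong (*-congˡ (off-form _)) (*-congˡ (off-form _))))))

        ½ : Carrier
        ½ = ⟦ 2 ⟧ ⁻¹
        2½ : ⟦ 2 ⟧ * ½ ≈ 1#
        2½ = inverseʳ (0<⟦suc⟧ 1)
        0≤½ : 0# ≤ ½
        0≤½ = <⇒≤ (0<⁻¹ (0<⟦suc⟧ 1))
        1-½≈½ : 1# + - ½ ≈ ½
        1-½≈½ = trans (+-congʳ (sym 2½)) (solve 1 (λ h → κ 2 :* h :+ :- h := h) refl ½)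

      -- Test ν - ν_u/2 against J S and ν + (ρ/2) ν_u against J (S ∪ ⁅ u ⁆).
      T-bound : ∀ {x τ} → Free S → Free (S ∪ ⁅ u ⁆) → Admissible ν → 0# ≤ τ → J S - τ ≤ Φ S ν →
                J (S ∪ ⁅ u ⁆) ≤ J S + x → T S ν u ≤ ⟦ 4 ⟧ * (p * x) + ⟦ 8 ⟧ * τ
      T-bound {x} {τ} free free′ adm 0≤τ near le = by-cert
        (trans (+-congˡ (-‿cong (sym (trans (*-congʳ pρ≈1) (*-identityˡ t)))))
          (trans (solve 5 (λ p ρ t x τ → (κ 4 :* (p :* x) :+ κ 8 :* τ) :- p :* ρ :* t
               := p :* (κ 4 :* x :+ κ 4 :* τ :- ρ :* t :+ κ 4 :* ρ :* τ) :+ κ 4 :* τ :* (κ 1 :- p) :+ κ 4 :* τ :* (κ 1 :- p :* ρ)) refl p ρ t x τ)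
            (trans (+-congˡ (trans (*-congˡ (trans (+-congˡ (-‿cong pρ≈1)) (-‿inverseʳ 1#))) (zeroʳ _))) (+-identityʳ _))))
        (0≤+ (*-nonneg 0≤p key) (*-nonneg (*-nonneg (0≤⟦⟧ 4) 0≤τ) (≤⇒0≤ p≤1)))
        where
        j = J S
        j′ = J (S ∪ ⁅ u ⁆)
        φ = ⟦ 2 ⟧ * e - (t + a)
        near′ : j - τ ≤ φ
        near′ = ≤-respʳ Φ-old near
        drop : Φ S (boost ν u (- ½)) ≤ j
        drop = Φ≤J free (boost-admissible {u = u} adm (≤-respʳ (sym 1-½≈½) 0≤½))
        drop′ : ⟦ 2 ⟧ * (e + - ½ * δ) - ((t + a) + (⟦ 2 ⟧ * - ½ * (t + b) + - ½ * - ½ * (t + b′))) ≤ j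
        drop′ = ≤-respˡ (Φ-boost (- ½)) drop
        0≤ρ½ : 0# ≤ ρ * ½
        0≤ρ½ = *-nonneg 0≤ρ 0≤½
        pick : Φ (S ∪ ⁅ u ⁆) (boost ν u (ρ * ½)) ≤ j′
        pick = Φ≤J free′ (boost-admissible {u = u} adm (0≤+ 0≤1 0≤ρ½))
        pick′ : ⟦ 2 ⟧ * (e + ρ * ½ * δ) - (a + (⟦ 2 ⟧ * (ρ * ½) * b + ρ * ½ * (ρ * ½) * b′)) ≤ j′
        pick′ = ≤-respˡ (Φ-pick (ρ * ½)) pick
        -- the two tests, multiplied by 4
        I₁ : 0# ≤ ⟦ 4 ⟧ * j - (⟦ 4 ⟧ * φ - ⟦ 4 ⟧ * δ + ⟦ 4 ⟧ * (t + b) - (t + b′))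
        I₁ = ≤-respʳ (trans
          (solve 8 (λ j e δ t a b b′ h → κ 4 :* (j :- (κ 2 :* (e :+ :- h :* δ) :- ((t :+ a) :+ (κ 2 :* :- h :* (t :+ b) :+ :- h :* :- h :* (t :+ b′)))))
              := κ 4 :* j :- (κ 4 :* (κ 2 :* e :- (t :+ a)) :- κ 4 :* (κ 2 :* h) :* δ :+ κ 4 :* (κ 2 :* h) :* (t :+ b) :- κ 2 :* h :* (κ 2 :* h) :* (t :+ b′))) refl j e δ t a b b′ ½)
          (+-congˡ (-‿cong (+-cong (+-cong (+-congˡ (-‿cong (*-congʳ (trans (*-congˡ 2½) (*-identityʳ _))))) (*-congʳ (trans (*-congˡ 2½) (*-identityʳ _))))
             (-‿cong (trans (*-congʳ (trans (*-cong 2½ 2½) (*-identityˡ 1#))) (*-identityˡ _)))))))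
          (*-nonneg (0≤⟦⟧ 4) (≤⇒0≤ drop′))
        I₂ : 0# ≤ ⟦ 4 ⟧ * j′ - (⟦ 4 ⟧ * φ + ⟦ 4 ⟧ * t + ρ * (⟦ 4 ⟧ * (δ - b)) - ρ * ρ * b′)
        I₂ = ≤-respʳ (trans
          (solve 9 (λ j e δ t a b b′ h ρ → κ 4 :* (j :- (κ 2 :* (e :+ ρ :* h :* δ) :- (a :+ (κ 2 :* (ρ :* h) :* b :+ ρ :* h :* (ρ :* h) :* b′))))
              := κ 4 :* j :- (κ 4 :* (κ 2 :* e :- (t :+ a)) :+ κ 4 :* t :+ κ 2 :* h :* (ρ :* (κ 4 :* (δ :- b))) :- κ 2 :* h :* (κ 2 :* h) :* (ρ :* ρ :* b′))) refl j′ e δ t a b b′ ½ ρ)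
          (+-congˡ (-‿cong (+-cong (+-congˡ (trans (*-congʳ 2½) (*-identityˡ _)))
             (-‿cong (trans (*-congʳ (trans (*-cong 2½ 2½) (*-identityˡ 1#))) (*-identityˡ _)))))))
          (*-nonneg (0≤⟦⟧ 4) (≤⇒0≤ pick′))
        ρb′≤ : ρ * ρ * b′ ≤ ρ * t
        ρb′≤ = ≤-respʳ (trans (solve 3 (λ p ρ t → ρ :* ρ :* (p :* t) := ρ :* (p :* ρ) :* t) refl p ρ t) (*-congʳ (trans (*-congˡ pρ≈1) (*-identityʳ ρ))))
          (*-monoˡ-≤ (ρ * ρ) (*-nonneg 0≤ρ 0≤ρ) off₃≤)
        b′≤t : b′ ≤ t
        b′≤t = ≤-trans off₃≤ (≤-respʳ (*-identityˡ t) (*-monoʳ-≤ t (0≤T S ν u) p≤1))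
        -- Adding ρ times the first test to the second cancels `δ` and `b`, for which there is no
        -- bound. What is left is -3ρt + ρb′ + ρ²b′ up to the harmless -4t; as b′ ≤ pt ≤ t, each of
        -- the last two terms gives back at most ρt, and -ρt survives.
        key : 0# ≤ ⟦ 4 ⟧ * x + ⟦ 4 ⟧ * τ - ρ * t + ⟦ 4 ⟧ * ρ * τ
        key = ≤-respʳ
          (solve 10 (λ j j′ φ δ t b b′ ρ x τ →
               (κ 4 :* j′ :- (κ 4 :* φ :+ κ 4 :* t :+ ρ :* (κ 4 :* (δ :- b)) :- ρ :* ρ :* b′))
               :+ ρ :* (κ 4 :* j :- (κ 4 :* φ :- κ 4 :* δ :+ κ 4 :* (t :+ b) :- (t :+ b′)))
               :+ (κ 4 :+ κ 4 :* ρ) :* (φ :- (j :- τ)) :+ κ 4 :* ((j :+ x) :- j′)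
               :+ (ρ :* t :- ρ :* ρ :* b′) :+ ρ :* (t :- b′) :+ κ 4 :* t
               := κ 4 :* x :+ κ 4 :* τ :- ρ :* t :+ κ 4 :* ρ :* τ) refl j j′ φ δ t b b′ ρ x τ)
          (0≤+ (0≤+ (0≤+ (0≤+ (0≤+ (0≤+ I₂ (*-nonneg 0≤ρ I₁))
            (*-nonneg (0≤+ (0≤⟦⟧ 4) (*-nonneg (0≤⟦⟧ 4) 0≤ρ)) (≤⇒0≤ near′)))
            (*-nonneg (0≤⟦⟧ 4) (≤⇒0≤ le)))
            (≤⇒0≤ ρb′≤)) (*-nonneg 0≤ρ (≤⇒0≤ b′≤t))) (*-nonneg (0≤⟦⟧ 4) (0≤T S ν u)))

    deg-off : ∀ {ν X} → (∀ E → ¬ (E ⊆ X) → ν E ≈ 0#) → ∀ L → ¬ (L ⊆ X) → deg ν L ≈ 0#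
    deg-off {ν} {X} ν≈0 L L⊈X = ∑-≈0 (𝒫 M) λ E → term E (L ⊆? E)
      where
      term : ∀ E (d : Dec (L ⊆ E)) → 𝟙 d * ν E ≈ 0#
      term E (yes L⊆E) = trans (*-congˡ (ν≈0 E λ E⊆X → L⊈X λ x∈ → E⊆X (L⊆E x∈))) (zeroʳ _)
      term E (no _)    = zeroˡ _

    Λ₂ : Weights M → Carrier
    Λ₂ ν = form (λ L → 𝟙 (2 ℕ.≤? ∣ L ∣) * ρ ^ ∣ L ∣) ν ν

    -- A spread weight inside the container contradicts near-optimality

    module Spread (s : ℕ) (1≤s : 1 ℕ.≤ s) (uniform : ∀ E → 𝓔 E → ∣ E ∣ ≡ s)
      (x : Carrier) (0<x : 0# < x) (x-small : ⟦ 16 ⟧ * ⟦ 16 ⟧ * ⟦ 16 ⟧ * (⟦ s ⟧ * ⟦ s ⟧) * x ≤ 1#)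
      (S X : Subset M) (free : Free S) (X⊆V : X ⊆ V)
      (X-light : ∀ u → u ∈ X → Free (S ∪ ⁅ u ⁆) × J (S ∪ ⁅ u ⁆) ≤ J S + x)
      (0<V : 1 ℕ.≤ ∣ V ∣)
      (ν′ : Weights M) (adm′ : Admissible ν′) (supp : ∀ E → ¬ (E ⊆ X) → ν′ E ≈ 0#)
      (3≤8e : ⟦ 3 ⟧ ≤ ⟦ 8 ⟧ * ∑ˢ ν′)
      (Λ-small : p * ⟦ ∣ V ∣ ⟧ * Λ₂ ν′ ≤ ⟦ 64 ⟧) where

      private
        s̄ N e′ Q′ t τ : Carrier
        s̄ = ⟦ s ⟧
        N = p * ⟦ ∣ V ∣ ⟧
        e′ = ∑ˢ ν′
        Q′ = Q S ν′
        -- The step length in the direction `ν′`, so short that the second-order term t²Q′ is at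
        -- most t/16. The defect `τ` is then chosen to satisfy both τ ≤ t/32 and 8τ ≤ px.
        t = (⟦ 16 ⟧ * (1# + Q′)) ⁻¹
        τ = t * (p * x) * ⟦ 32 ⟧ ⁻¹
        d′ : Subset M → Carrier
        d′ = deg ν′

        0<s̄ : 0# < s̄
        0<s̄ = <-≤-trans (0<⟦suc⟧ 0) (⟦⟧-mono 1≤s)
        0<N : 0# < N
        0<N = 0<* 0<p (<-≤-trans (0<⟦suc⟧ 0) (⟦⟧-mono 0<V))
        0≤Q′ : 0# ≤ Q′
        0≤Q′ = 0≤form ν′ (0≤coeff S)
        0≤d′ : ∀ L → 0# ≤ d′ L
        0≤d′ = 0≤deg 0≤k (proj₁ adm′)
        0<den : 0# < ⟦ 16 ⟧ * (1# + Q′)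
        0<den = 0<* (0<⟦suc⟧ 15) (0<+ 0<1 0≤Q′)
        0<t : 0# < t
        0<t = 0<⁻¹ 0<den
        t-eq : ⟦ 16 ⟧ * (1# + Q′) * t ≈ 1#
        t-eq = inverseʳ 0<den
        0<px : 0# < p * x
        0<px = 0<* 0<p 0<x
        0<τ : 0# < τ
        0<τ = 0<* (0<* 0<t 0<px) (0<⁻¹ (0<⟦suc⟧ 31))
        32τ : ⟦ 32 ⟧ * τ ≈ t * (p * x)
        32τ = trans (solve 3 (λ a b c → a :* (b :* c) := b :* (a :* c)) refl ⟦ 32 ⟧ (t * (p * x)) (⟦ 32 ⟧ ⁻¹))
          (trans (*-congˡ (inverseʳ (0<⟦suc⟧ 31))) (*-identityʳ _))
        1≤s̄ : 1# ≤ s̄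
        1≤s̄ = ≤-respˡ ⟦1⟧≈1 (⟦⟧-mono 1≤s)
        1≤s̄² : 1# ≤ s̄ * s̄
        1≤s̄² = ≤-respˡ (*-identityˡ 1#) (*-mono-≤ 0≤1 0≤1 1≤s̄ 1≤s̄)
        4096x≤1 : ⟦ 16 ⟧ * ⟦ 16 ⟧ * ⟦ 16 ⟧ * x ≤ 1#
        4096x≤1 = ≤-trans (by-cert (solve 3 (λ c s x → c :* s :* x :- c :* x := c :* x :* (s :- κ 1)) refl (⟦ 16 ⟧ * ⟦ 16 ⟧ * ⟦ 16 ⟧) (s̄ * s̄) x)
          (*-nonneg (*-nonneg (*-nonneg (*-nonneg (0≤⟦⟧ 16) (0≤⟦⟧ 16)) (0≤⟦⟧ 16)) (<⇒≤ 0<x)) (≤⇒0≤ 1≤s̄²))) x-small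
        x≤1 : x ≤ 1#
        x≤1 = ≤-trans (by-cert (solve 1 (λ x → κ 16 :* κ 16 :* κ 16 :* x :- x := κ 4095 :* x) refl x) (*-nonneg (0≤⟦⟧ 4095) (<⇒≤ 0<x))) 4096x≤1
        px≤1 : p * x ≤ 1#
        px≤1 = ≤-respʳ (*-identityˡ 1#) (*-mono-≤ 0≤p (<⇒≤ 0<x) p≤1 x≤1)
        t≤1 : t ≤ 1#
        t≤1 = ≤-respʳ t-eq (by-cert (solve 2 (λ t q → κ 16 :* (κ 1 :+ q) :* t :- t := κ 15 :* t :+ κ 16 :* (q :* t)) refl t Q′)
          (0≤+ (*-nonneg (0≤⟦⟧ 15) (<⇒≤ 0<t)) (*-nonneg (0≤⟦⟧ 16) (*-nonneg 0≤Q′ (<⇒≤ 0<t)))))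
        32τ≤t : ⟦ 32 ⟧ * τ ≤ t
        32τ≤t = ≤-respˡ (sym 32τ) (≤-respʳ (*-identityʳ t) (*-monoˡ-≤ t (<⇒≤ 0<t) px≤1))
        8τ≤px : ⟦ 8 ⟧ * τ ≤ p * x
        8τ≤px = ≤-trans (by-cert (solve 1 (λ τ → κ 32 :* τ :- κ 8 :* τ := κ 24 :* τ) refl τ) (*-nonneg (0≤⟦⟧ 24) (<⇒≤ 0<τ)))
          (≤-respˡ (sym 32τ) (≤-respʳ (*-identityˡ _) (*-monoʳ-≤ (p * x) (<⇒≤ 0<px) t≤1)))

        opt : Σ[ ν ∈ Weights M ] Admissible ν × J S - τ ≤ Φ S ν
        opt = near-optimal {S} τ 0<τ
        ν : Weights M
        ν = proj₁ opt
        adm : Admissible ν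
        adm = proj₁ (proj₂ opt)
        near : J S - τ ≤ Φ S ν
        near = proj₂ (proj₂ opt)
        d : Subset M → Carrier
        d = deg ν
        0≤d : ∀ L → 0# ≤ d L
        0≤d = 0≤deg 0≤k (proj₁ adm)

        T≤ : ∀ u → u ∈ X → u ∉ S → T S ν u ≤ ⟦ 5 ⟧ * (p * x)
        T≤ u u∈X u∉S = ≤-trans (Pick.T-bound S u u∉S ν free (proj₁ (X-light u u∈X)) adm (<⇒≤ 0<τ) near (proj₂ (X-light u u∈X)))
          (by-cert (solve 2 (λ y τ → κ 5 :* y :- (κ 4 :* y :+ κ 8 :* τ) := y :- κ 8 :* τ) refl (p * x) τ) (≤⇒0≤ 8τ≤px))

        ρdd≤T : ∀ u → u ∉ S → ρ * (d ⁅ u ⁆ * d ⁅ u ⁆) ≤ T S ν u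
        ρdd≤T u u∉S = ≤-respˡ (trans (*-congʳ (𝟙-yes (u ∈? ⁅ u ⁆) (x∈⁅x⁆ u))) (trans (*-identityˡ _) (*-congʳ (coeff-⁅⁆ u∉S))))
          (∑-∈ (λ L → 𝟙 (u ∈? L) * (coeff S L * (d L * d L))) (λ L → *-nonneg (0≤𝟙 (u ∈? L)) (*-nonneg (0≤coeff S L) (0≤sq (d L)))) (∈-allSubsets ⁅ u ⁆))

        -- The singleton term of `T` alone gives d(u)² ≤ p T ≤ 5p²x, and 256 s² · 5x ≤ 1 follows
        -- from 4096 s² x ≤ 1.
        16sd≤p : ∀ u → u ∈ X → u ∉ S → ⟦ 16 ⟧ * s̄ * d ⁅ u ⁆ ≤ p
        16sd≤p u u∈X u∉S = sq-cancel-≤ 0≤p (≤-trans (by-cert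
            (solve 3 (λ s D b → (κ 16 :* κ 16 :* (s :* s)) :* b :- (κ 16 :* s :* D) :* (κ 16 :* s :* D) := (κ 16 :* κ 16 :* (s :* s)) :* (b :- D :* D)) refl s̄ (d ⁅ u ⁆) (⟦ 5 ⟧ * (p * (p * x))))
            (*-nonneg (*-nonneg (*-nonneg (0≤⟦⟧ 16) (0≤⟦⟧ 16)) (0≤sq s̄)) (≤⇒0≤ dd≤)))
          (by-cert (solve 3 (λ s p x → p :* p :- (κ 16 :* κ 16 :* (s :* s)) :* (κ 5 :* (p :* (p :* x)))
              := p :* p :* (κ 1 :- κ 16 :* κ 16 :* κ 16 :* (s :* s) :* x) :+ (κ 11 :* κ 16 :* κ 16) :* (p :* p :* (s :* s) :* x)) refl s̄ p x)
            (0≤+ (*-nonneg (0≤sq p) (≤⇒0≤ x-small)) (*-nonneg (*-nonneg (*-nonneg (0≤⟦⟧ 11) (0≤⟦⟧ 16)) (0≤⟦⟧ 16)) (*-nonneg (*-nonneg (0≤sq p) (0≤sq s̄)) (<⇒≤ 0<x))))))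
          where
          dd≤ : d ⁅ u ⁆ * d ⁅ u ⁆ ≤ ⟦ 5 ⟧ * (p * (p * x))
          dd≤ = ≤-resp₂ (trans (sym (*-assoc p ρ _)) (trans (*-congʳ pρ≈1) (*-identityˡ _))) (solve 2 (λ p x → p :* (κ 5 :* (p :* x)) := κ 5 :* (p :* (p :* x))) refl p x)
            (*-monoˡ-≤ p 0≤p (≤-trans (ρdd≤T u u∉S) (T≤ u u∈X u∉S)))

        G : Subset M → Carrier
        G L = coeff S L * (d L * d′ L)

        singles pairs : Carrier
        singles = ∑ˢ (λ L → 𝟙 (∣ L ∣ ℕ.≟ 1) * G L)
        pairs = ∑ˢ (λ L → 𝟙 (2 ℕ.≤? ∣ L ∣) * G L)

        inner-split : form (coeff S) ν ν′ ≈ singles + pairs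
        inner-split = trans (∑-cong (𝒫 M) λ L → pointwise L) (∑-+ (𝒫 M) _ _)
          where
          cases : ∀ k g → 𝟙 (1 ℕ.≤? k) * g ≈ 𝟙 (k ℕ.≟ 1) * (𝟙 (1 ℕ.≤? k) * g) + 𝟙 (2 ℕ.≤? k) * (𝟙 (1 ℕ.≤? k) * g)
          cases 0 g = solve 1 (λ g → κ 0 :* g := κ 0 :* (κ 0 :* g) :+ κ 0 :* (κ 0 :* g)) refl g
          cases 1 g = solve 1 (λ g → κ 1 :* g := κ 1 :* (κ 1 :* g) :+ κ 0 :* (κ 1 :* g)) refl g
          cases (suc (suc k)) g = solve 1 (λ g → κ 1 :* g := κ 0 :* (κ 1 :* g) :+ κ 1 :* (κ 1 :* g)) refl g
          pointwise : ∀ L → G L ≈ 𝟙 (∣ L ∣ ℕ.≟ 1) * G L + 𝟙 (2 ℕ.≤? ∣ L ∣) * G L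
          pointwise L = trans (*-assoc _ _ _) (trans (cases ∣ L ∣ _) (+-cong (*-congˡ (sym (*-assoc _ _ _))) (*-congˡ (sym (*-assoc _ _ _)))))

        ∑d′ : ∑ᶠ (λ u → d′ ⁅ u ⁆) ≈ s̄ * e′
        ∑d′ = trans (∑-swap (allFin M) (𝒫 M) _) (trans (∑-cong (𝒫 M) λ E →
          trans (∑-*ʳ (allFin M) (ν′ E) _) (trans (*-congʳ (∑ᶠ-⁅⁆⊆ E)) (size′ E em))) (∑-*ˡ (𝒫 M) s̄ _))
          where
          size′ : ∀ E → Dec (𝓔 E) → ⟦ ∣ E ∣ ⟧ * ν′ E ≈ s̄ * ν′ E
          size′ E (yes e) = *-congʳ (≈-reflexive (≡.cong ⟦_⟧ (uniform E e)))
          size′ E (no ¬e) = trans (*-congˡ (proj₂ adm′ E ¬e)) (trans (zeroʳ _) (sym (trans (*-congˡ (proj₂ adm′ E ¬e)) (zeroʳ _))))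

        -- At a vertex of X outside S the term ρ d(u) d′(u) is at most d′(u)/(16s), and the degrees
        -- d′(u) add up to s e′ by uniformity.
        singles≤ : ⟦ 16 ⟧ * singles ≤ e′
        singles≤ = *-cancelˡ-≤ s̄ 0<s̄ (≤-resp₂
            (trans (∑-*ˡ (allFin M) (⟦ 16 ⟧ * s̄) _) (trans (*-congˡ (sym (∑ˢ-singletons G))) (solve 3 (λ a s g → a :* s :* g := s :* (a :* g)) refl ⟦ 16 ⟧ s̄ singles)))
            ∑d′
            (∑-mono (allFin M) λ u → term u (u ∈? X) (u ∈? S)))
          where
          term : ∀ u → Dec (u ∈ X) → Dec (u ∈ S) → ⟦ 16 ⟧ * s̄ * G ⁅ u ⁆ ≤ d′ ⁅ u ⁆
          term u (no u∉X) _ = ≤-resp₂ (sym (trans (*-congˡ (*-congˡ (*-congˡ d′≈0))) (solve 3 (λ a c d → a :* (c :* (d :* κ 0)) := κ 0) refl (⟦ 16 ⟧ * s̄) (coeff S ⁅ u ⁆) (d ⁅ u ⁆)))) (sym d′≈0) ≤-refl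
            where
            d′≈0 : d′ ⁅ u ⁆ ≈ 0#
            d′≈0 = deg-off {ν′} {X} supp ⁅ u ⁆ (u∉X ∘ ⁅⁆⊆⁻)
          term u (yes _) (yes u∈S) = ≤-respˡ (sym (trans (*-congˡ (*-congʳ (*-congˡ (*-congʳ (𝟙-no (em {Disjoint ⁅ u ⁆ S}) λ h → h u (x∈⁅x⁆ u) u∈S)))))
                (solve 4 (λ a b c d → a :* (b :* (κ 0 :* c) :* d) := κ 0) refl (⟦ 16 ⟧ * s̄) (𝟙 (1 ℕ.≤? ∣ ⁅ u ⁆ ∣)) (ρ ^ ∣ ⁅ u ⁆ ∣) (d ⁅ u ⁆ * d′ ⁅ u ⁆)))) (0≤d′ ⁅ u ⁆)
          term u (yes u∈X) (no u∉S) = ≤-resp₂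
                (trans (solve 5 (λ a s r D D′ → a :* s :* D :* (r :* D′) := a :* s :* (r :* (D :* D′))) refl ⟦ 16 ⟧ s̄ ρ (d ⁅ u ⁆) (d′ ⁅ u ⁆)) (*-congˡ (*-congʳ (sym (coeff-⁅⁆ u∉S)))))
                (trans (sym (*-assoc _ _ _)) (trans (*-congʳ pρ≈1) (*-identityˡ _)))
                (*-monoʳ-≤ (ρ * d′ ⁅ u ⁆) (*-nonneg 0≤ρ (0≤d′ ⁅ u ⁆)) (16sd≤p u u∈X u∉S))

        m : Fin M → Carrier
        m u = 𝟙 (u ∈? X) * 𝟙 (¬? (u ∈? S))
        0≤m : ∀ u → 0# ≤ m u
        0≤m u = *-nonneg (0≤𝟙 (u ∈? X)) (0≤𝟙 (¬? (u ∈? S)))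

        ∑T : Carrier
        ∑T = ∑ᶠ (λ u → m u * T S ν u)

        ∑T≤ : ∑T ≤ ⟦ 5 ⟧ * (x * N)
        ∑T≤ = ≤-trans (∑-mono (allFin M) λ u → term u (u ∈? X) (u ∈? S))
          (≤-resp₂ (sym (∑-*ˡ (allFin M) (⟦ 5 ⟧ * (p * x)) _)) (solve 3 (λ p x n → κ 5 :* (p :* x) :* n := κ 5 :* (x :* (p :* n))) refl p x ⟦ ∣ V ∣ ⟧)
            (*-monoˡ-≤ _ (*-nonneg (0≤⟦⟧ 5) (<⇒≤ 0<px)) (≤-respʳ (∑ᶠ-∈ V) (∑-mono (allFin M) λ u → 𝟙-mono X⊆V (u ∈? X) (u ∈? V)))))
          where
          term : ∀ u (a : Dec (u ∈ X)) (b : Dec (u ∈ S)) → 𝟙 a * 𝟙 (¬? b) * T S ν u ≤ ⟦ 5 ⟧ * (p * x) * 𝟙 a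
          term u (no _) _ = ≤-resp₂ (sym (trans (*-congʳ (zeroˡ _)) (zeroˡ _))) (sym (zeroʳ _)) ≤-refl
          term u (yes _) (yes _) = ≤-resp₂ (sym (trans (*-congʳ (zeroʳ _)) (zeroˡ _))) (sym (*-identityʳ _)) (*-nonneg (0≤⟦⟧ 5) (<⇒≤ 0<px))
          term u (yes u∈X) (no u∉S) = ≤-resp₂ (sym (trans (*-congʳ (*-identityˡ 1#)) (*-identityˡ _))) (sym (*-identityʳ _)) (T≤ u u∈X u∉S)

        K : Carrier
        K = ⟦ 16 ⟧ * ⟦ 16 ⟧ * (⟦ 16 ⟧ * ⟦ 16 ⟧)
        0≤K : 0# ≤ K
        0≤K = *-nonneg (*-nonneg (0≤⟦⟧ 16) (0≤⟦⟧ 16)) (*-nonneg (0≤⟦⟧ 16) (0≤⟦⟧ 16))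

        -- This is `coeff S L` with the decision of disjointness as an argument, so that `pair-term`
        -- can split on it; `spread` and `rhs` take it for the same reason.
        coeff′ : (L : Subset M) → Dec (Disjoint L S) → Carrier
        coeff′ L b = 𝟙 (1 ℕ.≤? ∣ L ∣) * (𝟙 b * ρ ^ ∣ L ∣)
        spread : (L : Subset M) → Dec (Disjoint L S) → Carrier
        spread L b = ∑ᶠ (λ u → m u * (𝟙 (u ∈? L) * (coeff′ L b * (d L * d L))))
        0≤spread-term : ∀ L b u → 0# ≤ m u * (𝟙 (u ∈? L) * (coeff′ L b * (d L * d L)))
        0≤spread-term L b u = *-nonneg (0≤m u) (*-nonneg (0≤𝟙 (u ∈? L))
          (*-nonneg (*-nonneg (0≤𝟙 (1 ℕ.≤? ∣ L ∣)) (*-nonneg (0≤𝟙 b) (0≤^ ∣ L ∣ 0≤ρ))) (0≤sq (d L))))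

        rhs : (L : Subset M) → Dec (2 ℕ.≤ ∣ L ∣) → Dec (Disjoint L S) → Carrier
        rhs L a b = K * spread L b + N * N * (𝟙 a * ρ ^ ∣ L ∣ * (d′ L * d′ L))
        0≤rhs : ∀ L a b → 0# ≤ rhs L a b
        0≤rhs L a b = 0≤+ (*-nonneg 0≤K (∑-0≤ (allFin M) (0≤spread-term L b)))
          (*-nonneg (*-nonneg (<⇒≤ 0<N) (<⇒≤ 0<N)) (*-nonneg (*-nonneg (0≤𝟙 a) (0≤^ ∣ L ∣ 0≤ρ)) (0≤sq (d′ L))))

        -- Weighted AM-GM: 512 N d d′ ≤ 256² d² + N² d′². If d′(L) is not zero then L lies in X, and
        -- if L is also disjoint from S it has a vertex of X outside S, whose `T` already contains
        -- the d² term.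
        pair-term : ∀ L (a : Dec (2 ℕ.≤ ∣ L ∣)) (b : Dec (Disjoint L S)) → Dec (L ⊆ X) →
                    ⟦ 2 ⟧ * ⟦ 16 ⟧ * ⟦ 16 ⟧ * N * (𝟙 a * (coeff′ L b * (d L * d′ L))) ≤ rhs L a b
        pair-term L (no a) b _ = ≤-respˡ
          (solve 3 (λ c n g → κ 0 := c :* n :* (κ 0 :* g)) refl (⟦ 2 ⟧ * ⟦ 16 ⟧ * ⟦ 16 ⟧) N _) (0≤rhs L (no a) b)
        pair-term L (yes a) b (no L⊈X) = ≤-respˡ
          (sym (trans (*-congˡ (*-congˡ (*-congˡ (*-congˡ (deg-off {ν′} {X} supp L L⊈X)))))
             (solve 4 (λ a n c x → a :* n :* (κ 1 :* (c :* (x :* κ 0))) := κ 0) refl (⟦ 2 ⟧ * ⟦ 16 ⟧ * ⟦ 16 ⟧) N (coeff′ L b) (d L))))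
          (0≤rhs L (yes a) b)
        pair-term L (yes a) (no b) (yes _) = ≤-respˡ
          (solve 5 (λ a n b c x → κ 0 := a :* n :* (κ 1 :* (b :* (κ 0 :* c) :* x))) refl (⟦ 2 ⟧ * ⟦ 16 ⟧ * ⟦ 16 ⟧) N (𝟙 (1 ℕ.≤? ∣ L ∣)) (ρ ^ ∣ L ∣) (d L * d′ L))
          (0≤rhs L (yes a) (no b))
        pair-term L (yes 2≤L) (yes dis) (yes L⊆X) = ≤-trans amgm (+-mono-≤ (*-monoˡ-≤ K 0≤K hit) ≤-refl)
          where
          r : Carrier
          r = ρ ^ ∣ L ∣
          1≤L : 1 ℕ.≤ ∣ L ∣
          1≤L = ℕ.≤-trans (ℕ.s≤s ℕ.z≤n) 2≤L
          c≈r : 𝟙 (1 ℕ.≤? ∣ L ∣) * (1# * r) ≈ r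
          c≈r = trans (*-cong (𝟙-yes (1 ℕ.≤? ∣ L ∣) 1≤L) (*-identityˡ r)) (*-identityˡ r)
          u₀ : Fin M
          u₀ = proj₁ (nonempty 1≤L)
          u₀∈L : u₀ ∈ L
          u₀∈L = proj₂ (nonempty 1≤L)
          hit : r * (d L * d L) ≤ ∑ᶠ (λ u → m u * (𝟙 (u ∈? L) * (𝟙 (1 ℕ.≤? ∣ L ∣) * (1# * r) * (d L * d L))))
          hit = ≤-respˡ (trans (*-cong (*-cong (𝟙-yes (u₀ ∈? X) (L⊆X u₀∈L)) (𝟙-yes (¬? (u₀ ∈? S)) (dis u₀ u₀∈L))) (*-cong (𝟙-yes (u₀ ∈? L) u₀∈L) (*-congʳ c≈r)))
              (solve 1 (λ y → κ 1 :* κ 1 :* (κ 1 :* y) := y) refl (r * (d L * d L))))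
            (∑-∈ (λ u → m u * (𝟙 (u ∈? L) * (coeff′ L (yes dis) * (d L * d L)))) (0≤spread-term L (yes dis)) (∈-allFin u₀))
          amgm : ⟦ 2 ⟧ * ⟦ 16 ⟧ * ⟦ 16 ⟧ * N * (1# * (𝟙 (1 ℕ.≤? ∣ L ∣) * (1# * r) * (d L * d′ L))) ≤ K * (r * (d L * d L)) + N * N * (1# * r * (d′ L * d′ L))
          amgm = ≤-respˡ (*-congˡ (*-congˡ (*-congʳ (sym c≈r)))) (by-cert
            (solve 4 (λ r n x y → (κ 16 :* κ 16 :* (κ 16 :* κ 16) :* (r :* (x :* x)) :+ n :* n :* (κ 1 :* r :* (y :* y))) :- κ 2 :* κ 16 :* κ 16 :* n :* (κ 1 :* (r :* (x :* y)))
               := r :* ((κ 16 :* κ 16 :* x :- n :* y) :* (κ 16 :* κ 16 :* x :- n :* y))) refl r N (d L) (d′ L))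
            (*-nonneg (0≤^ ∣ L ∣ 0≤ρ) (0≤sq _)))

        -- 144 = 80 + 64: the `T` add up to at most 5xN with 256² · 5x ≤ 80, and N Λ₂(ν′) ≤ 64.
        pairs≤ : ⟦ 2 ⟧ * ⟦ 16 ⟧ * ⟦ 16 ⟧ * pairs ≤ ⟦ 144 ⟧
        pairs≤ = *-cancelˡ-≤ N 0<N (≤-trans (≤-resp₂
            (trans (∑-*ˡ (𝒫 M) _ _) (solve 3 (λ a n y → a :* n :* y := n :* (a :* y)) refl (⟦ 2 ⟧ * ⟦ 16 ⟧ * ⟦ 16 ⟧) N pairs))
            (trans (∑-+ (𝒫 M) _ _) (+-cong (trans (∑-*ˡ (𝒫 M) K _) (*-congˡ swap)) (∑-*ˡ (𝒫 M) (N * N) _)))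
            (∑-mono (𝒫 M) λ L → pair-term L (2 ℕ.≤? ∣ L ∣) em (L ⊆? X)))
          (by-cert (solve 4 (λ n x t l → n :* κ 144 :- (κ 16 :* κ 16 :* (κ 16 :* κ 16) :* t :+ n :* n :* l)
               := κ 16 :* κ 16 :* (κ 16 :* κ 16) :* (κ 5 :* (x :* n) :- t) :+ n :* (κ 64 :- n :* l) :+ κ 80 :* n :* (κ 1 :- κ 16 :* κ 16 :* κ 16 :* x)) refl N x ∑T (Λ₂ ν′))
            (0≤+ (0≤+ (*-nonneg 0≤K (≤⇒0≤ ∑T≤)) (*-nonneg (<⇒≤ 0<N) (≤⇒0≤ Λ-small))) (*-nonneg (*-nonneg (0≤⟦⟧ 80) (<⇒≤ 0<N)) (≤⇒0≤ 4096x≤1)))))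
          where
          swap : ∑ˢ (λ L → spread L em) ≈ ∑T
          swap = trans (∑-swap (𝒫 M) (allFin M) _) (∑-cong (allFin M) λ u → ∑-*ˡ (𝒫 M) (m u) _)

      impossible : ⊥
      -- The test weight is ν + tν′. In units of t/256 the first-order gain is 512 (e′ - singles -
      -- pairs) ≥ 480 e′ - 144 ≥ 180 - 144 = 36. The second-order term costs at most 16 and the
      -- defect `τ` at most 8, so 12 units are gained over the supremum.
      impossible = <⇒≱ 0<t (*-cancelˡ-≤ ⟦ 12 ⟧ (0<⟦suc⟧ 11) (≤-respʳ (sym (zeroʳ ⟦ 12 ⟧)) (by-cert
        (solve 9 (λ j e q τ t e′ a b q′ →
            κ 0 :- κ 12 :* t
            := κ 256 :* ((κ 2 :* e :- q) :- (j :- τ)) :+ κ 256 :* (j :- (κ 2 :* (e :+ t :* e′) :- (q :+ (κ 2 :* t :* (a :+ b) :+ t :* t :* q′))))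
               :+ κ 8 :* (t :- κ 32 :* τ)
               :+ t :* (κ 32 :* (e′ :- κ 16 :* a) :+ (κ 144 :- κ 2 :* κ 16 :* κ 16 :* b) :+ κ 60 :* (κ 8 :* e′ :- κ 3))
               :+ κ 16 :* t :* (κ 1 :- κ 16 :* (q′ :* t))) refl (J S) (∑ˢ ν) (Q S ν) τ t e′ singles pairs Q′)
        (0≤+ (0≤+ (0≤+ (0≤+ (*-nonneg (0≤⟦⟧ 256) (≤⇒0≤ near)) (*-nonneg (0≤⟦⟧ 256) (≤⇒0≤ test)))
          (*-nonneg (0≤⟦⟧ 8) (≤⇒0≤ 32τ≤t)))
          (*-nonneg (<⇒≤ 0<t) (0≤+ (0≤+ (*-nonneg (0≤⟦⟧ 32) (≤⇒0≤ singles≤)) (≤⇒0≤ pairs≤)) (*-nonneg (0≤⟦⟧ 60) (≤⇒0≤ 3≤8e)))))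
          (*-nonneg (*-nonneg (0≤⟦⟧ 16) (<⇒≤ 0<t)) (≤⇒0≤ 16Qt≤1))))))
        where
        16Qt≤1 : ⟦ 16 ⟧ * (Q′ * t) ≤ 1#
        16Qt≤1 = ≤-respʳ t-eq (by-cert (solve 2 (λ q t → κ 16 :* (κ 1 :+ q) :* t :- κ 16 :* (q :* t) := κ 16 :* t) refl Q′ t) (*-nonneg (0≤⟦⟧ 16) (<⇒≤ 0<t)))
        test : ⟦ 2 ⟧ * (∑ˢ ν + t * e′) - (Q S ν + (⟦ 2 ⟧ * t * (singles + pairs) + t * t * Q′)) ≤ J S
        test = ≤-respˡ (+-cong (*-congˡ (trans (∑-+ (𝒫 M) _ _) (+-congˡ (∑-*ˡ (𝒫 M) t _))))
            (-‿cong (trans (form-+* (coeff S) ν ν′ t) (+-congˡ (+-congʳ (*-congˡ inner-split))))))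
          (Φ≤J free ((λ E → 0≤+ (proj₁ adm E) (*-nonneg (<⇒≤ 0<t) (proj₁ adm′ E))) ,
            λ E ¬E → trans (+-cong (proj₂ adm E ¬E) (trans (*-congˡ (proj₂ adm′ E ¬E)) (zeroʳ t))) (+-identityˡ 0#)))

  -- The random set A and the first fingerprint

  ∣∪∣≤ : (K L : Subset n) → ∣ K ∪ L ∣ ℕ.≤ ∣ K ∣ ℕ.+ ∣ L ∣
  ∣∪∣≤ []            []            = ℕ.z≤n
  ∣∪∣≤ (outside ∷ K) (outside ∷ L) = ∣∪∣≤ K L
  ∣∪∣≤ (outside ∷ K) (inside ∷ L)  = ℕ.≤-trans (ℕ.s≤s (∣∪∣≤ K L)) (ℕ.≤-reflexive (≡.sym (ℕ.+-suc ∣ K ∣ ∣ L ∣)))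
  ∣∪∣≤ (inside ∷ K)  (outside ∷ L) = ℕ.s≤s (∣∪∣≤ K L)
  ∣∪∣≤ (inside ∷ K)  (inside ∷ L)  = ℕ.s≤s (ℕ.≤-trans (∣∪∣≤ K L) (ℕ.+-monoʳ-≤ ∣ K ∣ (ℕ.n≤1+n ∣ L ∣)))

  argmin : (I : Subset n) (g : Subset n → Carrier) → ∃[ S ] S ⊆ I × (∀ S′ → S′ ⊆ I → g S ≤ g S′)
  argmin {n} I g with search (𝒫 n)
    where
    search : ∀ xs → ∃[ S ] S ⊆ I × (∀ S′ → S′ ∈ˡ xs → S′ ⊆ I → g S ≤ g S′)
    step : ∀ x xs → Dec (x ⊆ I) → (∃[ S ] S ⊆ I × (∀ S′ → S′ ∈ˡ xs → S′ ⊆ I → g S ≤ g S′)) →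
           ∃[ S ] S ⊆ I × (∀ S′ → S′ ∈ˡ (x ∷ xs) → S′ ⊆ I → g S ≤ g S′)
    search []       = ∅ , ⊥⊆ , λ _ ()
    search (x ∷ xs) = step x xs (x ⊆? I) (search xs)
    step x xs (no x⊈I) (S , S⊆I , h) = S , S⊆I , λ
      { S′ (hereˡ ≡.refl) S′⊆I → ⊥-elim (x⊈I S′⊆I)
      ; S′ (thereˡ S′∈) S′⊆I → h S′ S′∈ S′⊆I }
    step x xs (yes x⊆I) (S , S⊆I , h) with total (g S) (g x)
    ... | inj₁ S≤x = S , S⊆I , λ
      { S′ (hereˡ ≡.refl) _ → S≤x
      ; S′ (thereˡ S′∈) S′⊆I → h S′ S′∈ S′⊆I }
    ... | inj₂ x≤S = x , x⊆I , λ
      { S′ (hereˡ ≡.refl) _ → ≤-refl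
      ; S′ (thereˡ S′∈) S′⊆I → ≤-trans x≤S (h S′ S′∈ S′⊆I) }
  ... | S , S⊆I , h = S , S⊆I , λ S′ → h S′ (∈-allSubsets S′)

  module Random (q : Carrier) (0<q : 0# < q) (q<1 : q < 1#) where

    private
      0≤q : 0# ≤ q
      0≤q = <⇒≤ 0<q
      0<1-q : 0# < 1# - q
      0<1-q = 0<- q<1
      0≤1-q : 0# ≤ 1# - q
      0≤1-q = <⇒≤ 0<1-q

    -- Expectation of f A, where A contains each element of V independently with probability q.
    𝔼 : Subset n → (Subset n → Carrier) → Carrier
    𝔼 []            f = f []
    𝔼 (outside ∷ V) f = 𝔼 V (f ∘ (outside ∷_))
    𝔼 (inside ∷ V)  f = q * 𝔼 V (f ∘ (inside ∷_)) + (1# - q) * 𝔼 V (f ∘ (outside ∷_))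

    𝔼-mono : (V : Subset n) {f g : Subset n → Carrier} → (∀ A → A ⊆ V → f A ≤ g A) → 𝔼 V f ≤ 𝔼 V g
    𝔼-mono []            f≤g = f≤g [] id
    𝔼-mono (outside ∷ V) f≤g = 𝔼-mono V λ A A⊆V → f≤g _ (s⊆s A⊆V)
    𝔼-mono (inside ∷ V)  f≤g = +-mono-≤
      (*-monoˡ-≤ q 0≤q (𝔼-mono V λ A A⊆V → f≤g _ (s⊆s A⊆V)))
      (*-monoˡ-≤ (1# - q) 0≤1-q (𝔼-mono V λ A A⊆V → f≤g _ (out⊆ A⊆V)))

    𝔼-cong : (V : Subset n) {f g : Subset n → Carrier} → (∀ A → f A ≈ g A) → 𝔼 V f ≈ 𝔼 V g
    𝔼-cong V f≈g = ≤-antisym (𝔼-mono V λ A _ → ≤-reflexive (f≈g A)) (𝔼-mono V λ A _ → ≤-reflexive (sym (f≈g A)))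

    𝔼-const : (V : Subset n) (c : Carrier) → 𝔼 V (λ _ → c) ≈ c
    𝔼-const []            c = refl
    𝔼-const (outside ∷ V) c = 𝔼-const V c
    𝔼-const (inside ∷ V)  c = trans (+-cong (*-congˡ (𝔼-const V c)) (*-congˡ (𝔼-const V c)))
      (solve 2 (λ q c → q :* c :+ (κ 1 :- q) :* c := c) refl q c)

    𝔼-+ : (V : Subset n) (f g : Subset n → Carrier) → 𝔼 V (λ A → f A + g A) ≈ 𝔼 V f + 𝔼 V g
    𝔼-+ []            f g = refl
    𝔼-+ (outside ∷ V) f g = 𝔼-+ V _ _
    𝔼-+ (inside ∷ V)  f g = trans (+-cong (*-congˡ (𝔼-+ V _ _)) (*-congˡ (𝔼-+ V _ _)))
      (solve 6 (λ q r a b c d → q :* (a :+ b) :+ r :* (c :+ d) := (q :* a :+ r :* c) :+ (q :* b :+ r :* d)) refl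
         q (1# - q) (𝔼 V (f ∘ (inside ∷_))) (𝔼 V (g ∘ (inside ∷_))) (𝔼 V (f ∘ (outside ∷_))) (𝔼 V (g ∘ (outside ∷_))))

    𝔼-*ˡ : (V : Subset n) (c : Carrier) (f : Subset n → Carrier) → 𝔼 V (λ A → c * f A) ≈ c * 𝔼 V f
    𝔼-*ˡ []            c f = refl
    𝔼-*ˡ (outside ∷ V) c f = 𝔼-*ˡ V c _
    𝔼-*ˡ (inside ∷ V)  c f = trans (+-cong (*-congˡ (𝔼-*ˡ V c _)) (*-congˡ (𝔼-*ˡ V c _)))
      (solve 5 (λ q r c a b → q :* (c :* a) :+ r :* (c :* b) := c :* (q :* a :+ r :* b)) refl
         q (1# - q) c (𝔼 V (f ∘ (inside ∷_))) (𝔼 V (f ∘ (outside ∷_))))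

    𝔼-∑ : {X : Set} (V : Subset n) (xs : List X) (f : X → Subset n → Carrier) →
          𝔼 V (λ A → ∑ xs (λ x → f x A)) ≈ ∑ xs (λ x → 𝔼 V (f x))
    𝔼-∑ V []       f = 𝔼-const V 0#
    𝔼-∑ V (x ∷ xs) f = trans (𝔼-+ V (f x) _) (+-congˡ (𝔼-∑ V xs f))

    -- Only the outcome A = ∅ is kept.
    𝔼-empty : (V : Subset n) {f : Subset n → Carrier} → (∀ A → 0# ≤ f A) → (1# - q) ^ ∣ V ∣ * f ∅ ≤ 𝔼 V f
    𝔼-empty []            {f} 0≤f = ≤-reflexive (*-identityˡ (f []))
    𝔼-empty (outside ∷ V) {f} 0≤f = 𝔼-empty V λ A → 0≤f _
    𝔼-empty (inside ∷ V)  {f} 0≤f = ≤-respˡ (+-identityˡ _) (+-mono-≤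
      (*-nonneg 0≤q (≤-respˡ (𝔼-const V 0#) (𝔼-mono V λ A _ → 0≤f _)))
      (≤-respˡ (sym (*-assoc _ _ _)) (*-monoˡ-≤ _ 0≤1-q (𝔼-empty V λ A → 0≤f _))))

    -- By independence, A conditioned on containing L is distributed as A ∪ L.
    𝔼-shift : (V L : Subset n) {f : Subset n → Carrier} → L ⊆ V →
              q ^ ∣ L ∣ * 𝔼 V (λ A → f (A ∪ L)) ≈ 𝔼 V (λ A → 𝟙 (L ⊆? A) * f A)
    𝔼-shift []            []            L⊆V = refl
    𝔼-shift (outside ∷ V) (outside ∷ L) L⊆V = trans (𝔼-shift V L (drop-∷-⊆ L⊆V))
      (𝔼-cong V λ A → *-congʳ (𝟙-iff s⊆s drop-∷-⊆ (L ⊆? A) ((outside ∷ L) ⊆? (outside ∷ A))))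
    𝔼-shift (outside ∷ V) (inside ∷ L)  L⊆V with () ← L⊆V here
    𝔼-shift (inside ∷ V)  (outside ∷ L) {f} L⊆V = trans
      (solve 5 (λ y q r a b → y :* (q :* a :+ r :* b) := q :* (y :* a) :+ r :* (y :* b)) refl
        (q ^ ∣ L ∣) q (1# - q) (𝔼 V (λ A → f (inside ∷ (A ∪ L)))) (𝔼 V (λ A → f (outside ∷ (A ∪ L)))))
      (+-cong
        (*-congˡ (trans (𝔼-shift V L (drop-∷-⊆ L⊆V)) (𝔼-cong V λ A → *-congʳ (𝟙-iff out⊆ drop-∷-⊆ (L ⊆? A) ((outside ∷ L) ⊆? (inside ∷ A))))))
        (*-congˡ (trans (𝔼-shift V L (drop-∷-⊆ L⊆V)) (𝔼-cong V λ A → *-congʳ (𝟙-iff out⊆ drop-∷-⊆ (L ⊆? A) ((outside ∷ L) ⊆? (outside ∷ A)))))))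
    𝔼-shift (inside ∷ V)  (inside ∷ L)  {f} L⊆V = trans
      (solve 3 (λ y q a → q :* y :* (q :* a :+ (κ 1 :- q) :* a) := q :* (y :* a) :+ (κ 1 :- q) :* κ 0) refl
        (q ^ ∣ L ∣) q (𝔼 V (λ A → f (inside ∷ (A ∪ L)))))
      (+-cong
        (*-congˡ (trans (𝔼-shift V L (drop-∷-⊆ L⊆V)) (𝔼-cong V λ A → *-congʳ (𝟙-iff in⊆in drop-∷-⊆ (L ⊆? A) ((inside ∷ L) ⊆? (inside ∷ A))))))
        (*-congˡ (sym (trans (𝔼-cong V λ A → trans (*-congʳ (𝟙-no ((inside ∷ L) ⊆? (outside ∷ A)) λ h → absurd (h here))) (zeroˡ _)) (𝔼-const V 0#)))))
      where
      absurd : ∀ {A : Subset n} → ¬ (zero ∈ (outside ∷ A))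
      absurd ()

    -- Random sets inside a down-closed family

    module Sampling {M : ℕ} (V : Subset M) (𝓘 : Subset M → Set) (down : ∀ {A B} → A ⊆ B → 𝓘 B → 𝓘 A) where

      μ : Subset M → Carrier
      μ S = 𝔼 V (λ A → 𝟙 (em {𝓘 (A ∪ S)}))

      μ≤1 : ∀ S → μ S ≤ 1#
      μ≤1 S = ≤-respʳ (𝔼-const V 1#) (𝔼-mono V λ A _ → 𝟙≤1 (em {𝓘 (A ∪ S)}))

      μ≥ : ∀ {S} → 𝓘 S → (1# - q) ^ ∣ V ∣ ≤ μ S
      μ≥ {S} S∈ = ≤-respˡ (trans (*-congˡ (𝟙-yes (em {𝓘 (∅ ∪ S)}) (≡.subst 𝓘 (≡.sym (∪-identityˡ S)) S∈))) (*-identityʳ _))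
        (𝔼-empty V λ A → 0≤𝟙 (em {𝓘 (A ∪ S)}))


      fingerprint : ∀ I → 𝓘 I → ∃[ S ] S ⊆ I × (∀ L → L ⊆ I → μ S ≤ ⟦ 2 ⟧ ^ ∣ L ∣ * μ (S ∪ L)) ×
                    ⟦ 2 ⟧ ^ ∣ S ∣ * (1# - q) ^ ∣ V ∣ ≤ 1# × 0# < μ S
      fingerprint I I∈ with argmin I (λ S → ⟦ 2 ⟧ ^ ∣ S ∣ * μ S)
      ... | S , S⊆I , least = S , S⊆I , grow ,
          -- The minimum is at most the value μ(∅) ≤ 1 at the empty set, while μ(S) is at least the
          -- probability of A = ∅.
          ≤-trans (*-monoˡ-≤ _ (<⇒≤ (0<^ ∣ S ∣ 0<2)) (μ≥ (down S⊆I I∈)))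
            (≤-trans (least ∅ ⊥⊆) (≤-respˡ (sym (*-congʳ (≈-reflexive (≡.cong (⟦ 2 ⟧ ^_) (∣⊥∣≡0 M))))) (≤-respˡ (sym (*-identityˡ _)) (μ≤1 ∅)))) ,
          <-≤-trans (0<^ ∣ V ∣ 0<1-q) (μ≥ (down S⊆I I∈))
        where
        0≤μ : ∀ S → 0# ≤ μ S
        0≤μ S = ≤-respˡ (𝔼-const V 0#) (𝔼-mono V λ A _ → 0≤𝟙 (em {𝓘 (A ∪ S)}))
        grow : ∀ L → L ⊆ I → μ S ≤ ⟦ 2 ⟧ ^ ∣ L ∣ * μ (S ∪ L)
        grow L L⊆I = *-cancelˡ-≤ (⟦ 2 ⟧ ^ ∣ S ∣) (0<^ ∣ S ∣ 0<2)
          (≤-trans (least (S ∪ L) (λ x∈ → [ S⊆I , L⊆I ]′ (x∈p∪q⁻ S L x∈)))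
            (≤-respʳ (trans (*-congʳ (^-+ ⟦ 2 ⟧ ∣ S ∣ ∣ L ∣)) (*-assoc _ _ _))
              (*-monoʳ-≤ (μ (S ∪ L)) (0≤μ (S ∪ L)) (^-monoʳ 1≤2 (∣∪∣≤ S L)))))

      -- A first-moment argument. The weight inside A, restricted to the event that A ∪ S lies in
      -- the family, has expectation Σ ν(E) q^s μ(S ∪ E) ≥ (q/2)^s e(ν) μ(S): q^s is the probability
      -- of E ⊆ A, and 2^-s the loss allowed in passing from μ(S) to μ(S ∪ E). Since the event has
      -- probability μ(S), some A in it attains half of the resulting average.
      dense-member : ∀ S s (ν : Weights M) → (∀ E → 0# ≤ ν E) →
        (∀ E → ν E ≈ 0# ⊎ (E ⊆ V × ∣ E ∣ ≡ s × μ S ≤ ⟦ 2 ⟧ ^ s * μ (S ∪ E))) →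
        0# < μ S → 0# < ∑ˢ ν →
        ∃[ A ] A ⊆ V × 𝓘 (A ∪ S) × (q / ⟦ 2 ⟧) ^ s * ∑ˢ ν ≤ ⟦ 2 ⟧ * ∑ˢ (λ E → 𝟙 (E ⊆? A) * ν E)
      dense-member S s ν 0≤ν good 0<μ 0<e with em {∃[ A ] A ⊆ V × 𝓘 (A ∪ S) × (q / ⟦ 2 ⟧) ^ s * ∑ˢ ν ≤ ⟦ 2 ⟧ * ∑ˢ (λ E → 𝟙 (E ⊆? A) * ν E)}
      ... | yes h = h
      ... | no ¬h = ⊥-elim (<⇒≱ (0<* 0<ce 0<μ) (by-cert
            (solve 2 (λ b c → κ 0 :- c := (c :- κ 2 :* b) :+ κ 2 :* (b :- c)) refl B (c * e * μ S))
            (0≤+ (≤⇒0≤ upper) (*-nonneg (0≤⟦⟧ 2) (≤⇒0≤ lower)))))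
        where
        c e B : Carrier
        c = (q / ⟦ 2 ⟧) ^ s
        e = ∑ˢ ν
        ind : Subset M → Carrier
        ind A = 𝟙 (em {𝓘 (A ∪ S)})
        inner : Subset M → Carrier
        inner A = ∑ˢ (λ E → 𝟙 (E ⊆? A) * ν E)
        B = 𝔼 V (λ A → ind A * inner A)
        0<c : 0# < c
        0<c = 0<^ s (0<* 0<q (0<⁻¹ 0<2))
        0<ce : 0# < c * e
        0<ce = 0<* 0<c 0<e
        c2^s : c * ⟦ 2 ⟧ ^ s ≈ q ^ s
        c2^s = trans (sym (^-* (q / ⟦ 2 ⟧) ⟦ 2 ⟧ s)) (^-congˡ s (trans (*-assoc _ _ _) (trans (*-congˡ (inverseˡ 0<2)) (*-identityʳ q))))
        upper : ⟦ 2 ⟧ * B ≤ c * e * μ S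
        upper = ≤-resp₂ (𝔼-*ˡ V ⟦ 2 ⟧ _) (𝔼-*ˡ V (c * e) _) (𝔼-mono V λ A A⊆V →
          ≤-resp₂ (solve 3 (λ a t b → a :* (t :* b) := t :* (a :* b)) refl (ind A) ⟦ 2 ⟧ (inner A)) (*-comm _ _)
            (𝟙*-mono (em {𝓘 (A ∪ S)}) λ A∈ → <⇒≤ (≰⇒> λ le → ¬h (A , A⊆V , A∈ , le))))
        B≈ : B ≈ ∑ˢ (λ E → ν E * 𝔼 V (λ A → 𝟙 (E ⊆? A) * ind A))
        B≈ = trans (𝔼-cong V λ A → trans (sym (∑-*ˡ (𝒫 M) (ind A) _))
                (∑-cong (𝒫 M) λ E → solve 3 (λ a b c → a :* (b :* c) := c :* (b :* a)) refl (ind A) (𝟙 (E ⊆? A)) (ν E)))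
              (trans (𝔼-∑ V (𝒫 M) _) (∑-cong (𝒫 M) λ E → 𝔼-*ˡ V (ν E) _))
        term : ∀ E → c * μ S * ν E ≤ ν E * 𝔼 V (λ A → 𝟙 (E ⊆? A) * ind A)
        term E with good E
        ... | inj₁ ν≈0 = ≤-reflexive (trans (*-congˡ ν≈0) (trans (zeroʳ _) (sym (trans (*-congʳ ν≈0) (zeroˡ _)))))
        ... | inj₂ (E⊆V , ∣E∣≡s , heavy) = ≤-respˡ (*-comm (ν E) _) (*-monoˡ-≤ (ν E) (0≤ν E)
              (≤-trans (*-monoˡ-≤ c (<⇒≤ 0<c) heavy) (≤-reflexive (begin
                c * (⟦ 2 ⟧ ^ s * μ (S ∪ E))                        ≈⟨ *-assoc _ _ _ ⟨
                c * ⟦ 2 ⟧ ^ s * μ (S ∪ E)                          ≈⟨ *-cong c2^s (𝔼-cong V λ A → ≈-reflexive (≡.cong (λ K → 𝟙 (em {𝓘 K})) (shuffle A))) ⟩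
                q ^ s * 𝔼 V (λ A → ind (A ∪ E))                    ≈⟨ *-congʳ (≈-reflexive (≡.cong (q ^_) (≡.sym ∣E∣≡s))) ⟩
                q ^ ∣ E ∣ * 𝔼 V (λ A → ind (A ∪ E))                ≈⟨ 𝔼-shift V E E⊆V ⟩
                𝔼 V (λ A → 𝟙 (E ⊆? A) * ind A) ∎))))
          where
          shuffle : ∀ A → A ∪ (S ∪ E) ≡ (A ∪ E) ∪ S
          shuffle A = ≡.trans (≡.cong (A ∪_) (∪-comm S E)) (≡.sym (∪-assoc A E S))
        lower : c * e * μ S ≤ B
        lower = ≤-resp₂ (trans (∑-*ˡ (𝒫 M) (c * μ S) ν) (solve 3 (λ c m e → c :* m :* e := c :* e :* m) refl c (μ S) e)) (sym B≈)
          (∑-mono (𝒫 M) term)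

  -- Counting the fingerprints

  bernoulli : ∀ {y} → 0# ≤ y → ∀ m → 1# + ⟦ m ⟧ * y ≤ (1# + y) ^ m
  bernoulli {y} 0≤y zero    = ≤-reflexive (solve 1 (λ y → κ 1 :+ κ 0 :* y := κ 1) refl y)
  bernoulli {y} 0≤y (suc m) = ≤-trans
    (by-cert (solve 2 (λ m y → (κ 1 :+ y) :* (κ 1 :+ m :* y) :- (κ 1 :+ (κ 1 :+ m) :* y) := m :* (y :* y)) refl ⟦ m ⟧ y)
      (*-nonneg (0≤⟦⟧ m) (0≤sq y)))
    (*-monoˡ-≤ (1# + y) (0≤+ 0≤1 0≤y) (bernoulli 0≤y m))

  bernoulli⁻ : ∀ {y} → 0# ≤ y → y ≤ 1# → ∀ m → 1# - ⟦ m ⟧ * y ≤ (1# - y) ^ m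
  bernoulli⁻ {y} 0≤y y≤1 zero    = ≤-reflexive (solve 1 (λ y → κ 1 :- κ 0 :* y := κ 1) refl y)
  bernoulli⁻ {y} 0≤y y≤1 (suc m) = ≤-trans
    (by-cert (solve 2 (λ m y → (κ 1 :- y) :* (κ 1 :- m :* y) :- (κ 1 :- (κ 1 :+ m) :* y) := m :* (y :* y)) refl ⟦ m ⟧ y)
      (*-nonneg (0≤⟦⟧ m) (0≤sq y)))
    (*-monoˡ-≤ (1# - y) (≤⇒0≤ y≤1) (bernoulli⁻ 0≤y y≤1 m))

  ^-mono-< : ∀ {x y} n → 0# ≤ x → x < y → x ^ suc n < y ^ suc n
  ^-mono-< {x} {y} n 0≤x x<y = ≤-<-trans (*-monoˡ-≤ x 0≤x (^-mono-≤ n 0≤x (<⇒≤ x<y)))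
    (≰⇒> λ h → <⇒≱ x<y (*-cancelˡ-≤ (y ^ n) (0<^ n (≤-<-trans 0≤x x<y)) (≤-resp₂ (*-comm _ _) (*-comm _ _) h)))

  -- (1 + y)^N (1 - Ny) ≤ (1 - y²)^N ≤ 1
  ^≤2 : ∀ {y} N → 0# ≤ y → y ≤ 1# → ⟦ 2 ⟧ * (⟦ N ⟧ * y) ≤ 1# → (1# + y) ^ N ≤ ⟦ 2 ⟧
  ^≤2 {y} N 0≤y y≤1 small = by-cert
    (solve 2 (λ z w → κ 2 :- z := κ 2 :* (κ 1 :- z :* (κ 1 :- w)) :+ z :* (κ 1 :- κ 2 :* w)) refl ((1# + y) ^ N) (⟦ N ⟧ * y))
    (0≤+ (*-nonneg (0≤⟦⟧ 2) (≤⇒0≤ prod)) (*-nonneg 0≤z (≤⇒0≤ small)))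
    where
    0≤z : 0# ≤ (1# + y) ^ N
    0≤z = 0≤^ N (0≤+ 0≤1 0≤y)
    prod : (1# + y) ^ N * (1# - ⟦ N ⟧ * y) ≤ 1#
    prod = ≤-trans (*-monoˡ-≤ _ 0≤z (bernoulli⁻ 0≤y y≤1 N))
      (≤-respˡ (^-* (1# + y) (1# - y) N) (^≤1 N (*-nonneg (0≤+ 0≤1 0≤y) (≤⇒0≤ y≤1))
        (by-cert (solve 1 (λ y → κ 1 :- (κ 1 :+ y) :* (κ 1 :- y) := y :* y) refl y) (0≤sq y))))

  -- Bernoulli gives 1 + my ≤ (1 + y)^m, and then the exponents N and m are exchanged. This replaces
  -- the exponential function in both estimates below, each with y = 1/(2N).
  [1+my]^≤2^ : ∀ {y} N m → 0# ≤ y → y ≤ 1# → ⟦ 2 ⟧ * (⟦ N ⟧ * y) ≤ 1# → (1# + ⟦ m ⟧ * y) ^ N ≤ ⟦ 2 ⟧ ^ m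
  [1+my]^≤2^ {y} N m 0≤y y≤1 small = ≤-trans
    (^-mono-≤ N (0≤+ 0≤1 (*-nonneg (0≤⟦⟧ m) 0≤y)) (bernoulli 0≤y m))
    (≤-respˡ (trans (^-^ (1# + y) N m) (trans (≈-reflexive (≡.cong ((1# + y) ^_) (ℕ.*-comm N m))) (sym (^-^ (1# + y) m N))))
      (^-mono-≤ m (0≤^ N (0≤+ 0≤1 0≤y)) (^≤2 N 0≤y y≤1 small)))

  floor : ∀ {z} n → 0# ≤ z → z < ⟦ n ⟧ → ∃[ k ] ⟦ k ⟧ ≤ z × z < ⟦ suc k ⟧
  floor zero    0≤z z<0 = ⊥-elim (<⇒≱ z<0 0≤z)
  floor {z} (suc n) 0≤z z<n with total ⟦ n ⟧ z
  ... | inj₁ n≤z = n , n≤z , z<n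
  ... | inj₂ z≤n with em {z ≈ ⟦ n ⟧}
  ...   | yes z≈n = n , ≤-reflexive (sym z≈n) , z<n
  ...   | no  z≉n = floor n 0≤z (z≤n , z≉n)

  -- The fraction k/1 is one of those in the supremum. As `⋁` is only constrained on bounded sets, a
  -- bound is needed too: w^j = x^m with m ≤ nj forces w ≤ x^n.
  ^≤^ᴿ : ∀ {x y} k n → 1# ≤ x → ⟦ k ⟧ ≤ y → y ≤ ⟦ n ⟧ → x ^ k ≤ x ^ᴿ y
  ^≤^ᴿ {x} {y} k n 1≤x k≤y y≤n = ⋁-upper _ (x ^ n , bound) (x ^ k)
    (k , 1 , ℕ.≤-refl , ≤-respˡ (sym k/1) k≤y , 0≤^ k 0≤x , *-identityʳ _)
    where
    0≤x : 0# ≤ x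
    0≤x = ≤-trans 0≤1 1≤x
    k/1 : ⟦ k ⟧ / ⟦ 1 ⟧ ≈ ⟦ k ⟧
    k/1 = begin
      ⟦ k ⟧ * ⟦ 1 ⟧ ⁻¹            ≈⟨ *-congʳ (trans (*-congˡ ⟦1⟧≈1) (*-identityʳ _)) ⟨
      ⟦ k ⟧ * ⟦ 1 ⟧ * ⟦ 1 ⟧ ⁻¹    ≈⟨ *-assoc _ _ _ ⟩
      ⟦ k ⟧ * (⟦ 1 ⟧ * ⟦ 1 ⟧ ⁻¹)  ≈⟨ *-congˡ (inverseʳ (0<⟦suc⟧ 0)) ⟩
      ⟦ k ⟧ * 1#                  ≈⟨ *-identityʳ _ ⟩
      ⟦ k ⟧ ∎
    ⟦⟧-cancel : ∀ {a b} → ⟦ a ⟧ ≤ ⟦ b ⟧ → a ℕ.≤ b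
    ⟦⟧-cancel {a} {b} h with a ℕ.≤? b
    ... | yes a≤b = a≤b
    ... | no  a≰b = ⊥-elim (<⇒≱ 0<1 (by-cert (solve 2 (λ a b → κ 0 :- κ 1 := (b :- a) :+ (a :- (κ 1 :+ b))) refl ⟦ a ⟧ ⟦ b ⟧)
                      (0≤+ (≤⇒0≤ h) (≤⇒0≤ (⟦⟧-mono (ℕ.≰⇒> a≰b))))))
    bound : ∀ w → (∃[ m ] ∃[ j ] (1 ℕ.≤ j) × (⟦ m ⟧ / ⟦ j ⟧ ≤ y) × (0# ≤ w) × (w ^ j ≈ x ^ m)) → w ≤ x ^ n
    bound w (m , suc j , _ , m/j≤y , 0≤w , w^j≈x^m) = ≮⇒≥ λ x^n<w → <⇒≱ (^-mono-< j (0≤^ n 0≤x) x^n<w)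
      (≤-resp₂ (sym w^j≈x^m) (sym (^-^ x n (suc j))) (^-monoʳ 1≤x (⟦⟧-cancel {m} {n ℕ.* suc j} (≤-resp₂
        (trans (*-assoc _ _ _) (trans (*-congˡ (inverseˡ (0<⟦suc⟧ j))) (*-identityʳ _))) (sym (⟦⟧-* n (suc j)))
        (*-monoʳ-≤ ⟦ suc j ⟧ (0≤⟦⟧ (suc j)) (≤-trans m/j≤y y≤n))))))

  length-filter≈ : {A : Set} {P : A → Set} (P? : ∀ x → Dec (P x)) (xs : List A) →
                   ⟦ length (filter P? xs) ⟧ ≈ ∑ xs (λ x → 𝟙 (P? x))
  length-filter≈ P? []       = refl
  length-filter≈ P? (x ∷ xs) with P? x
  ... | yes _ = +-congˡ (length-filter≈ P? xs)
  ... | no  _ = trans (length-filter≈ P? xs) (sym (+-identityˡ _))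

  ∑-cartesianProduct : {A B : Set} (xs : List A) (ys : List B) (f : A × B → Carrier) →
                       ∑ (cartesianProduct xs ys) f ≈ ∑ xs (λ x → ∑ ys (λ y → f (x , y)))
  ∑-cartesianProduct []       ys f = refl
  ∑-cartesianProduct (x ∷ xs) ys f = trans (∑-++ (map (x ,_) ys) _ f) (+-cong (∑-map (x ,_) ys f) (∑-cartesianProduct xs ys f))

  -- Counting pairs of small sets

  module Pairs {M : ℕ} (V : Subset M) (k : ℕ) where

    Small : Subset M × Subset M → Set
    Small (S , S′) = S ⊆ V × S′ ⊆ V × ∣ S ∣ ℕ.+ ∣ S′ ∣ ℕ.≤ k

    Small? : ∀ SS → Dec (Small SS)
    Small? (S , S′) = (S ⊆? V) ×-dec ((S′ ⊆? V) ×-dec (∣ S ∣ ℕ.+ ∣ S′ ∣ ℕ.≤? k))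

    smallPairs : List (Subset M × Subset M)
    smallPairs = filter Small? (cartesianProduct (𝒫 M) (𝒫 M))

    module _ (q : Carrier) (0<q : 0# < q) (q≤1 : q ≤ 1#) where
      private
        0≤q = <⇒≤ 0<q
        0≤q⁻¹ : 0# ≤ q ⁻¹
        0≤q⁻¹ = <⇒≤ (0<⁻¹ 0<q)

      1≤ : ∀ j → j ℕ.≤ k → 1# ≤ q ⁻¹ ^ k * q ^ j
      1≤ j j≤k = ≤-respˡ (trans (sym (^-* _ q k)) (trans (^-congˡ k (inverseˡ 0<q)) (1^ k)))
        (*-monoˡ-≤ _ (0≤^ k 0≤q⁻¹) (q^-anti j≤k))
        where
        q^-anti : ∀ {i j} → i ℕ.≤ j → q ^ j ≤ q ^ i
        q^-anti {j = j} ℕ.z≤n = ^≤1 j 0≤q q≤1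
        q^-anti (ℕ.s≤s i≤j)   = *-monoˡ-≤ q 0≤q (q^-anti i≤j)

      -- Every pair counted has q^(|S| + |S′|) ≥ q^k, and the sum of these weights over all pairs
      -- factorises by `∑ˢ-⊆-^`.
      length-smallPairs : ⟦ length smallPairs ⟧ ≤ q ⁻¹ ^ k * ((1# + q) ^ ∣ V ∣ * (1# + q) ^ ∣ V ∣)
      length-smallPairs = ≤-resp₂ (sym (trans (length-filter≈ Small? (cartesianProduct (𝒫 M) (𝒫 M))) (∑-cartesianProduct (𝒫 M) (𝒫 M) _))) total≈
        (∑-mono (𝒫 M) λ S → ∑-mono (𝒫 M) λ S′ → bound S S′)
        where
        summand : Subset M → Subset M → Carrier
        summand S S′ = q ⁻¹ ^ k * ((𝟙 (S ⊆? V) * q ^ ∣ S ∣) * (𝟙 (S′ ⊆? V) * q ^ ∣ S′ ∣))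
        0≤summand : ∀ S S′ → 0# ≤ summand S S′
        0≤summand S S′ = *-nonneg (0≤^ k 0≤q⁻¹) (*-nonneg (*-nonneg (0≤𝟙 (S ⊆? V)) (0≤^ ∣ S ∣ 0≤q)) (*-nonneg (0≤𝟙 (S′ ⊆? V)) (0≤^ ∣ S′ ∣ 0≤q)))
        bound′ : ∀ S S′ (d : Dec (Small (S , S′))) → 𝟙 d ≤ summand S S′
        bound′ S S′ (no _) = 0≤summand S S′
        bound′ S S′ (yes (S⊆V , S′⊆V , small)) = ≤-respʳ
          (*-congˡ (trans (^-+ q ∣ S ∣ ∣ S′ ∣) (sym (*-cong (trans (*-congʳ (𝟙-yes (S ⊆? V) S⊆V)) (*-identityˡ _)) (trans (*-congʳ (𝟙-yes (S′ ⊆? V) S′⊆V)) (*-identityˡ _))))))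
          (1≤ _ small)
        bound : ∀ S S′ → 𝟙 (Small? (S , S′)) ≤ summand S S′
        bound S S′ = bound′ S S′ (Small? (S , S′))
        total≈ : ∑ˢ (λ S → ∑ˢ (λ S′ → summand S S′)) ≈ q ⁻¹ ^ k * ((1# + q) ^ ∣ V ∣ * (1# + q) ^ ∣ V ∣)
        total≈ = trans (∑-cong (𝒫 M) λ S → trans (∑-*ˡ (𝒫 M) (q ⁻¹ ^ k) _)
              (*-congˡ (trans (∑-*ˡ (𝒫 M) (𝟙 (S ⊆? V) * q ^ ∣ S ∣) _) (*-congˡ (∑ˢ-⊆-^ V q)))))
            (trans (∑-*ˡ (𝒫 M) (q ⁻¹ ^ k) _) (*-congˡ (trans (∑-*ʳ (𝒫 M) ((1# + q) ^ ∣ V ∣) _) (*-congʳ (∑ˢ-⊆-^ V q)))))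

      module _ (1≤n : 1 ℕ.≤ ∣ V ∣) (8q<1 : ⟦ 8 ⟧ * q < 1#) (k≤ : ⟦ k ⟧ ≤ ⟦ 4 ⟧ * q * ⟦ ∣ V ∣ ⟧) (k> : ⟦ 4 ⟧ * q * ⟦ ∣ V ∣ ⟧ < ⟦ suc k ⟧) where
        private
          n̄ = ⟦ ∣ V ∣ ⟧
          0<n̄ : 0# < n̄
          0<n̄ = <-≤-trans (0<⟦suc⟧ 0) (⟦⟧-mono 1≤n)
          1≤n̄ : 1# ≤ n̄
          1≤n̄ = ≤-respˡ ⟦1⟧≈1 (⟦⟧-mono 1≤n)
          0<4n : 0# < ⟦ 4 ⟧ * n̄
          0<4n = 0<* (0<⟦suc⟧ 3) 0<n̄
          -- The exponent of 1 + q is 2n, so `[1+my]^≤2^` asks for y = 1/(4n); then 4qn < k + 1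
          -- reads q < (k + 1)y and the power is at most 2^(k+1).
          y = (⟦ 4 ⟧ * n̄) ⁻¹
          0<y : 0# < y
          0<y = 0<⁻¹ 0<4n
          4ny : ⟦ 4 ⟧ * n̄ * y ≈ 1#
          4ny = inverseʳ 0<4n
          y≤1 : y ≤ 1#
          y≤1 = ≤-respʳ 4ny (by-cert (solve 2 (λ n y → κ 4 :* n :* y :- y := κ 3 :* (n :* y) :+ (n :- κ 1) :* y) refl n̄ y)
            (0≤+ (*-nonneg (0≤⟦⟧ 3) (*-nonneg (0≤⟦⟧ ∣ V ∣) (<⇒≤ 0<y))) (*-nonneg (≤⇒0≤ 1≤n̄) (<⇒≤ 0<y))))
          q≤ky : q ≤ ⟦ suc k ⟧ * y
          q≤ky = ≤-respˡ (trans (solve 3 (λ q n y → κ 4 :* q :* n :* y := q :* (κ 4 :* n :* y)) refl q n̄ y) (trans (*-congˡ 4ny) (*-identityʳ q)))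
            (*-monoʳ-≤ y (<⇒≤ 0<y) (<⇒≤ k>))
          power : (1# + q) ^ ∣ V ∣ * (1# + q) ^ ∣ V ∣ ≤ ⟦ 2 ⟧ ^ suc k
          power = ≤-trans (≤-respˡ (^-+ (1# + q) ∣ V ∣ ∣ V ∣) (^-mono-≤ (∣ V ∣ ℕ.+ ∣ V ∣) (0≤+ 0≤1 0≤q) (+-mono-≤ ≤-refl q≤ky)))
            ([1+my]^≤2^ (∣ V ∣ ℕ.+ ∣ V ∣) (suc k) (<⇒≤ 0<y) y≤1 (≤-reflexive (trans (*-congˡ (*-congʳ (⟦⟧-+ ∣ V ∣ ∣ V ∣)))
              (trans (solve 2 (λ n y → κ 2 :* ((n :+ n) :* y) := κ 4 :* n :* y) refl n̄ y) 4ny))))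
          1≤2/q : 1# ≤ ⟦ 2 ⟧ / q
          1≤2/q = *-cancelˡ-≤ q 0<q (≤-respʳ (sym (trans (solve 2 (λ q i → q :* (κ 2 :* i) := κ 2 :* (q :* i)) refl q (q ⁻¹)) (trans (*-congˡ (inverseʳ 0<q)) (*-identityʳ _))))
            (≤-respˡ (sym (*-identityʳ q)) (≤-trans q≤1 1≤2)))
          y≤n : ⟦ 4 ⟧ * q * n̄ ≤ n̄
          y≤n = by-cert (solve 2 (λ q n → n :- κ 4 :* q :* n := n :* (κ 1 :- κ 8 :* q) :+ κ 4 :* (q :* n)) refl q n̄)
            (0≤+ (*-nonneg (0≤⟦⟧ ∣ V ∣) (≤⇒0≤ (<⇒≤ 8q<1))) (*-nonneg (0≤⟦⟧ 4) (*-nonneg 0≤q (0≤⟦⟧ ∣ V ∣))))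

        -- The count is at most q^-k 2^(k+1) = 2 (2/q)^k, where the extra 2 comes from replacing 4qn
        -- by k + 1.
        smallPairs-bound : ⟦ length smallPairs ⟧ ≤ ⟦ 4 ⟧ * (⟦ 2 ⟧ / q) ^ᴿ (⟦ 4 ⟧ * q * ⟦ ∣ V ∣ ⟧)
        smallPairs-bound = ≤-trans length-smallPairs (≤-trans (*-monoˡ-≤ _ (0≤^ k 0≤q⁻¹) power) (≤-trans
          (by-cert (trans (+-congʳ (*-congˡ (^-* ⟦ 2 ⟧ (q ⁻¹) k)))
              (solve 2 (λ a b → κ 4 :* (b :* a) :- a :* (κ 2 :* b) := κ 2 :* (a :* b)) refl (q ⁻¹ ^ k) (⟦ 2 ⟧ ^ k)))
            (*-nonneg (0≤⟦⟧ 2) (*-nonneg (0≤^ k 0≤q⁻¹) (0≤^ k (0≤⟦⟧ 2)))))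
          (*-monoˡ-≤ ⟦ 4 ⟧ (0≤⟦⟧ 4) (^≤^ᴿ k ∣ V ∣ 1≤2/q k≤ y≤n))))

  -- If a > 3qn, then 2^a ≥ (1 + a/(2n))^n > (1 + 3q/2)^n. This beats (1 - q)^-n because (1 +
  -- 3q/2)(1 - q) > 1 for 0 < q < 1/8.
  size-bound : ∀ {q} a n → 1 ℕ.≤ n → 0# < q → ⟦ 8 ⟧ * q < 1# → ⟦ 2 ⟧ ^ a * (1# - q) ^ n ≤ 1# → ⟦ a ⟧ ≤ ⟦ 3 ⟧ * q * ⟦ n ⟧
  size-bound {q} a (suc n′) 1≤n 0<q 8q<1 h = ≮⇒≥ λ a> → <⇒≱ (strict a>) (≤-trans (*-monoʳ-≤ _ (0≤^ n₊ 0≤1-q)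
      ([1+my]^≤2^ n₊ a (<⇒≤ 0<y) y≤1 (≤-reflexive (trans (sym (*-assoc _ _ _)) 2ny)))) h)
    where
    n₊ = suc n′
    n̄ = ⟦ n₊ ⟧
    0≤q = <⇒≤ 0<q
    0<n̄ : 0# < n̄
    0<n̄ = 0<⟦suc⟧ n′
    1≤n̄ : 1# ≤ n̄
    1≤n̄ = ≤-respˡ ⟦1⟧≈1 (⟦⟧-mono {1} {n₊} (ℕ.s≤s ℕ.z≤n))
    0≤1-q : 0# ≤ 1# - q
    0≤1-q = ≤-respʳ (solve 1 (λ q → (κ 1 :- κ 8 :* q) :+ κ 7 :* q := κ 1 :- q) refl q) (0≤+ (≤⇒0≤ (<⇒≤ 8q<1)) (*-nonneg (0≤⟦⟧ 7) 0≤q))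
    0<2n : 0# < ⟦ 2 ⟧ * n̄
    0<2n = 0<* (0<⟦suc⟧ 1) 0<n̄
    y = (⟦ 2 ⟧ * n̄) ⁻¹
    0<y : 0# < y
    0<y = 0<⁻¹ 0<2n
    2ny : ⟦ 2 ⟧ * n̄ * y ≈ 1#
    2ny = inverseʳ 0<2n
    y≤1 : y ≤ 1#
    y≤1 = ≤-respʳ 2ny (by-cert (solve 2 (λ n y → κ 2 :* n :* y :- y := n :* y :+ (n :- κ 1) :* y) refl n̄ y)
      (0≤+ (*-nonneg (0≤⟦⟧ n₊) (<⇒≤ 0<y)) (*-nonneg (≤⇒0≤ 1≤n̄) (<⇒≤ 0<y))))
    strict : ⟦ 3 ⟧ * q * n̄ < ⟦ a ⟧ → 1# < (1# + ⟦ a ⟧ * y) ^ n₊ * (1# - q) ^ n₊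
    strict a> = ≤-<-trans (≤-reflexive (sym (1^ n₊))) (<-respʳ (^-* (1# + ⟦ a ⟧ * y) (1# - q) n₊) (^-mono-< n′ 0≤1 base))
      where
      3q≤ : ⟦ 3 ⟧ * q ≤ ⟦ 2 ⟧ * (⟦ a ⟧ * y)
      3q≤ = ≤-resp₂ (trans (solve 3 (λ q n y → κ 2 :* (κ 3 :* q :* n :* y) := κ 3 :* q :* (κ 2 :* n :* y)) refl q n̄ y) (trans (*-congˡ 2ny) (*-identityʳ _))) refl
        (*-monoˡ-≤ ⟦ 2 ⟧ (0≤⟦⟧ 2) (*-monoʳ-≤ y (<⇒≤ 0<y) (<⇒≤ a>)))
      base : 1# < (1# + ⟦ a ⟧ * y) * (1# - q)
      base = ≰⇒> λ le → <⇒≱ (0<* 0<q (0<- 8q<1)) (by-cert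
        (solve 2 (λ q w → κ 0 :- q :* (κ 1 :- κ 8 :* q) := κ 2 :* (κ 1 :- (κ 1 :+ w) :* (κ 1 :- q)) :+ (κ 2 :* w :- κ 3 :* q) :* (κ 1 :- q) :+ κ 5 :* (q :* q)) refl q (⟦ a ⟧ * y))
        (0≤+ (0≤+ (*-nonneg (0≤⟦⟧ 2) (≤⇒0≤ le)) (*-nonneg (≤⇒0≤ 3q≤) 0≤1-q)) (*-nonneg (0≤⟦⟧ 5) (0≤sq q))))

  -- Hypergraphs and their images

  subsetOf : {P : Fin n → Set} → (∀ x → Dec (P x)) → Subset n
  subsetOf P? = tabulate (does ∘ P?)

  ∈-subsetOf⁺ : {P : Fin n → Set} (P? : ∀ x → Dec (P x)) → ∀ {x} → P x → x ∈ subsetOf P?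
  ∈-subsetOf⁺ P? {x} px = lookup⇒[]= x _ (≡.trans (lookup∘tabulate _ x) (dec-true (P? x) px))

  ∈-subsetOf⁻ : {P : Fin n → Set} (P? : ∀ x → Dec (P x)) → ∀ {x} → x ∈ subsetOf P? → P x
  ∈-subsetOf⁻ P? {x} x∈ = decide (P? x) (≡.trans (≡.sym (lookup∘tabulate (does ∘ P?) x)) ([]=⇒lookup x∈))
    where
    decide : ∀ {P} (d : Dec P) → does d ≡ inside → P
    decide (yes p) _ = p

  ∑ᶠ-point : (x : Fin n) (f : Fin n → Carrier) → ∑ᶠ (λ u → 𝟙 (u ≟ᶠ x) * f u) ≈ f x
  ∑ᶠ-point {suc n} zero f = trans (∑ᶠ-suc (λ u → 𝟙 (u ≟ᶠ zero) * f u))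
    (trans (+-cong (*-identityˡ _) (∑-≈0 (allFin n) λ u → zeroˡ _)) (+-identityʳ _))
  ∑ᶠ-point {suc n} (suc x) f = trans (∑ᶠ-suc (λ u → 𝟙 (u ≟ᶠ suc x) * f u)) (trans (+-congʳ (zeroˡ _)) (trans (+-identityˡ _)
    (trans (∑-cong (allFin n) λ u → *-congʳ (𝟙-iff suc-injective (≡.cong suc) (suc u ≟ᶠ suc x) (u ≟ᶠ x))) (∑ᶠ-point x (f ∘ suc)))))

  ⟦⟧-injective : ∀ {a b} → ⟦ a ⟧ ≈ ⟦ b ⟧ → a ≡ b
  ⟦⟧-injective {zero}  {zero}  h = ≡.refl
  ⟦⟧-injective {zero}  {suc b} h = ⊥-elim (0<⇒≉ (0<⟦suc⟧ b) (sym h))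
  ⟦⟧-injective {suc a} {zero}  h = ⊥-elim (0<⇒≉ (0<⟦suc⟧ a) h)
  ⟦⟧-injective {suc a} {suc b} h = ≡.cong suc (⟦⟧-injective (trans (minus a) (trans (+-congˡ h) (sym (minus b)))))
    where
    minus : ∀ a → ⟦ a ⟧ ≈ - 1# + ⟦ suc a ⟧
    minus a = solve 1 (λ a → a := :- κ 1 :+ (κ 1 :+ a)) refl ⟦ a ⟧

  -- The condition L ⊆ vertices G in Λ is redundant, because all other L have degree 0.
  module _ {N : ℕ} (G : Hypergraph N) (ν : Subset N → Carrier) where

    edgeWeight : Subset N → Carrier
    edgeWeight D = 𝟙 (Edge? G D) * ν D

    totalWeight≈ : totalWeight G ν ≈ ∑ˢ edgeWeight
    totalWeight≈ = ∑-filter (Edge? G) (𝒫 N) ν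

    degree≈ : ∀ K → degree G ν K ≈ ∑ˢ (λ D → 𝟙 (K ⊆? D) * edgeWeight D)
    degree≈ K = trans (∑-filter (K ⊆?_) (edges G) ν) (trans (∑-filter (Edge? G) (𝒫 N) _)
      (∑-cong (𝒫 N) λ D → solve 3 (λ a b c → a :* (b :* c) := b :* (a :* c)) refl (𝟙 (Edge? G D)) (𝟙 (K ⊆? D)) (ν D)))

    degree-outside : ∀ K → ¬ (K ⊆ vertices G) → degree G ν K ≈ 0#
    degree-outside K K⊈ = trans (degree≈ K) (∑-≈0 (𝒫 N) λ D → term D (K ⊆? D) (Edge? G D))
      where
      term : ∀ D (a : Dec (K ⊆ D)) (b : Dec (Edge G D)) → 𝟙 a * (𝟙 b * ν D) ≈ 0#
      term D (no _)    b       = zeroˡ _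
      term D (yes _)   (no _)  = trans (*-congˡ (zeroˡ _)) (zeroʳ _)
      term D (yes K⊆D) (yes e) = ⊥-elim (K⊈ λ x∈ → edge⊆ G e (K⊆D x∈))

    Λ≈ : ∀ p → Λ G ν p ≈ ∑ˢ (λ K → 𝟙 (2 ℕ.≤? ∣ K ∣) * p ⁻¹ ^ ∣ K ∣ * (degree G ν K * degree G ν K))
    Λ≈ p = trans (∑-filter (λ L → (L ⊆? vertices G) ×-dec (2 ℕ.≤? ∣ L ∣)) (𝒫 N) _) (∑-cong (𝒫 N) λ K →
        trans (*-congʳ (𝟙-× (K ⊆? vertices G) (2 ℕ.≤? ∣ K ∣))) (term K (K ⊆? vertices G)))
      where
      term : ∀ K (a : Dec (K ⊆ vertices G)) → 𝟙 a * 𝟙 (2 ℕ.≤? ∣ K ∣) * (degree G ν K ^ 2 * p ⁻¹ ^ ∣ K ∣)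
             ≈ 𝟙 (2 ℕ.≤? ∣ K ∣) * p ⁻¹ ^ ∣ K ∣ * (degree G ν K * degree G ν K)
      term K (yes _) = solve 3 (λ a d r → κ 1 :* a :* ((d :* (d :* κ 1)) :* r) := a :* r :* (d :* d)) refl (𝟙 (2 ℕ.≤? ∣ K ∣)) (degree G ν K) (p ⁻¹ ^ ∣ K ∣)
      term K (no K⊈) = sym (trans (*-congˡ (*-congˡ (degree-outside K K⊈)))
        (solve 3 (λ a d r → a :* r :* (d :* κ 0) := κ 0 :* a :* ((d :* (d :* κ 1)) :* r)) refl (𝟙 (2 ℕ.≤? ∣ K ∣)) (degree G ν K) (p ⁻¹ ^ ∣ K ∣)))

    0≤edgeWeight : (∀ D → Edge G D → 0# ≤ ν D) → ∀ D → 0# ≤ edgeWeight D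
    0≤edgeWeight 0≤ν D = go (Edge? G D)
      where
      go : (d : Dec (Edge G D)) → 0# ≤ 𝟙 d * ν D
      go (yes e) = *-nonneg 0≤1 (0≤ν D e)
      go (no _)  = ≤-reflexive (sym (zeroˡ _))

  module Normalised {N : ℕ} (G : Hypergraph N) (p R : Carrier) (0<p : 0# < p) (0<R : 0# < R)
    (ν : Subset N → Carrier) (0≤ν : ∀ D → Edge G D → 0# ≤ ν D) (lt : Λ G ν p < totalWeight G ν ^ 2 / R) where

    private
      e : Carrier
      e = totalWeight G ν
      0≤e : 0# ≤ e
      0≤e = ≤-respʳ (sym (totalWeight≈ G ν)) (∑-0≤ (𝒫 N) (0≤edgeWeight G ν 0≤ν))
      0≤Λ : 0# ≤ Λ G ν p
      0≤Λ = ≤-respʳ (sym (Λ≈ G ν p)) (∑-0≤ (𝒫 N) λ K →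
        *-nonneg (*-nonneg (0≤𝟙 (2 ℕ.≤? ∣ K ∣)) (0≤^ ∣ K ∣ (<⇒≤ (0<⁻¹ 0<p)))) (0≤sq _))
      -- If e were 0, the strict Janson inequality would say that a sum of squares is negative.
      0<e : 0# < e
      0<e = 0≤e , λ 0≈e → <⇒≱ lt (≤-respˡ (sym (trans (*-congʳ (*-congʳ (sym 0≈e))) (trans (*-congʳ (zeroˡ _)) (zeroˡ _)))) 0≤Λ)

    scale : Carrier
    scale = e ⁻¹

    0≤scale : 0# ≤ scale
    0≤scale = <⇒≤ (0<⁻¹ 0<e)

    scale-total : scale * totalWeight G ν ≈ 1#
    scale-total = inverseˡ 0<e

    scale-Λ : R * (scale * scale * Λ G ν p) ≤ 1#
    scale-Λ = ≤-respʳ (begin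
        R * (scale * scale * (e ^ 2 / R))               ≈⟨ solve 4 (λ R i e j → R :* (i :* i :* ((e :* (e :* κ 1)) :* j)) := (R :* j) :* ((i :* e) :* (i :* e))) refl R scale e (R ⁻¹) ⟩
        (R * R ⁻¹) * ((scale * e) * (scale * e))        ≈⟨ *-cong (inverseʳ 0<R) (*-cong scale-total scale-total) ⟩
        1# * (1# * 1#)                                  ≈⟨ trans (*-identityˡ _) (*-identityˡ _) ⟩
        1# ∎)
      (*-monoˡ-≤ R (<⇒≤ 0<R) (*-monoˡ-≤ _ (*-nonneg 0≤scale 0≤scale) (<⇒≤ lt)))

  -- Degrees in H compared with degrees in its image

  module _ {M N : ℕ} (π : Fin M → Fin N) where

    InjectiveOn : Subset M → Set
    InjectiveOn E = ∀ x y → x ∈ E → y ∈ E → π x ≡ π y → x ≡ y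

    private
      -- The number of elements of `L` above `y`, taken as a real number: a set and its image are
      -- compared in size by summing fibres.
      fibre : Subset M → Fin N → Carrier
      fibre L y = ∑ᶠ (λ x → 𝟙 (x ∈? L) * 𝟙 (y ≟ᶠ π x))

      ∑-fibre : ∀ L → ∑ᶠ (fibre L) ≈ ⟦ ∣ L ∣ ⟧
      ∑-fibre L = trans (∑-swap (allFin N) (allFin M) _) (trans (∑-cong (allFin M) λ x → trans (∑-*ˡ (allFin N) (𝟙 (x ∈? L)) _)
        (trans (*-congˡ (trans (∑-cong (allFin N) λ y → sym (*-identityʳ _)) (∑ᶠ-point (π x) (λ _ → 1#)))) (*-identityʳ _))) (∑ᶠ-∈ L))

      0≤fibre-term : ∀ L y x → 0# ≤ 𝟙 (x ∈? L) * 𝟙 (y ≟ᶠ π x)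
      0≤fibre-term L y x = *-nonneg (0≤𝟙 (x ∈? L)) (0≤𝟙 (y ≟ᶠ π x))

      fibre-term≈1 : ∀ {L y x} → x ∈ L → y ≡ π x → 𝟙 (x ∈? L) * 𝟙 (y ≟ᶠ π x) ≈ 1#
      fibre-term≈1 {L} {y} {x} x∈L eq = trans (*-cong (𝟙-yes (x ∈? L) x∈L) (𝟙-yes (y ≟ᶠ π x) eq)) (*-identityˡ 1#)

      fibre≥1 : ∀ L y → 𝟙 (y ∈? image π L) ≤ fibre L y
      fibre≥1 L y = go (y ∈? image π L)
        where
        go : (d : Dec (y ∈ image π L)) → 𝟙 d ≤ fibre L y
        go (no _)   = ∑-0≤ (allFin M) (0≤fibre-term L y)
        go (yes y∈) with ∈-image⁻ π {L} y∈
        ... | x , x∈L , πx≡y = ≤-respˡ (fibre-term≈1 x∈L (≡.sym πx≡y)) (∑-∈ (λ x → 𝟙 (x ∈? L) * 𝟙 (y ≟ᶠ π x)) (0≤fibre-term L y) (∈-allFin x))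

      fibre≥2 : ∀ L y x x′ → x ∈ L → x′ ∈ L → y ≡ π x → y ≡ π x′ → ¬ (x ≡ x′) → 1# + 1# ≤ fibre L y
      fibre≥2 L y x x′ x∈ x′∈ e e′ x≢x′ = ≤-respˡ
        (trans (∑-+ (allFin M) _ _) (+-cong (trans (∑ᶠ-point x _) (fibre-term≈1 x∈ e)) (trans (∑ᶠ-point x′ _) (fibre-term≈1 x′∈ e′))))
        (∑-mono (allFin M) λ u → ≤-resp₂ (distribʳ (𝟙 (u ∈? L) * 𝟙 (y ≟ᶠ π u)) (𝟙 (u ≟ᶠ x)) (𝟙 (u ≟ᶠ x′))) (*-identityˡ _)
          (*-monoʳ-≤ _ (0≤fibre-term L y u) (one u (u ≟ᶠ x) (u ≟ᶠ x′))))
        where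
        one : ∀ u (a : Dec (u ≡ x)) (b : Dec (u ≡ x′)) → 𝟙 a + 𝟙 b ≤ 1#
        one u (yes a) (yes b) = ⊥-elim (x≢x′ (≡.trans (≡.sym a) b))
        one u (yes a) (no _)  = ≤-reflexive (+-identityʳ 1#)
        one u (no _)  b       = ≤-respˡ (sym (+-identityˡ _)) (𝟙≤1 b)

    -- Every fibre over the image has at least one element and a collision gives some fibre two, so
    -- the fibres would add up to more than |E|.
    card-image⇒InjectiveOn : ∀ {E} → ∣ image π E ∣ ≡ ∣ E ∣ → InjectiveOn E
    card-image⇒InjectiveOn {E} eq x x′ x∈ x′∈ πx≡πx′ with x ≟ᶠ x′
    ... | yes h = h
    ... | no x≢x′ = ⊥-elim (<⇒≱ 0<1 (by-cert (solve 1 (λ a → κ 0 :- κ 1 := a :- (a :+ κ 1)) refl ⟦ ∣ E ∣ ⟧) (≤⇒0≤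
        (≤-resp₂ (trans (∑-+ (allFin N) _ _) (+-cong (trans (∑ᶠ-∈ (image π E)) (≈-reflexive (≡.cong ⟦_⟧ eq)))
              (trans (∑-cong (allFin N) λ y → sym (*-identityʳ _)) (∑ᶠ-point (π x) (λ _ → 1#)))))
          (∑-fibre E) (∑-mono (allFin N) λ y → bound y (y ≟ᶠ π x))))))
      where
      bound : ∀ y (d : Dec (y ≡ π x)) → 𝟙 (y ∈? image π E) + 𝟙 d ≤ fibre E y
      bound y (no _)  = ≤-respˡ (sym (+-identityʳ _)) (fibre≥1 E y)
      bound y (yes e) = ≤-trans (+-mono-≤ (𝟙≤1 (y ∈? image π E)) ≤-refl) (fibre≥2 E y x x′ x∈ x′∈ e (≡.trans e πx≡πx′) x≢x′)

    InjectiveOn⇒card-image : ∀ {E L} → InjectiveOn E → L ⊆ E → ∣ image π L ∣ ≡ ∣ L ∣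
    InjectiveOn⇒card-image {E} {L} inj L⊆E = ⟦⟧-injective (trans (sym (∑ᶠ-∈ (image π L)))
      (trans (∑-cong (allFin N) λ y → ≤-antisym (fibre≥1 L y) (fibre≤ y (y ∈? image π L))) (∑-fibre L)))
      where
      fibre≤ : ∀ y (d : Dec (y ∈ image π L)) → fibre L y ≤ 𝟙 d
      fibre≤ y (no y∉) = ≤-reflexive (∑-≈0 (allFin M) λ x → go x (x ∈? L) (y ≟ᶠ π x))
        where
        go : ∀ x (a : Dec (x ∈ L)) (b : Dec (y ≡ π x)) → 𝟙 a * 𝟙 b ≈ 0#
        go x (no _)    b       = zeroˡ _
        go x (yes _)   (no _)  = zeroʳ _
        go x (yes x∈L) (yes e) = ⊥-elim (y∉ (≡.subst (_∈ image π L) (≡.sym e) (∈-image⁺ π {L} x∈L)))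
      fibre≤ y (yes y∈) with ∈-image⁻ π {L} y∈
      ... | x₀ , x₀∈L , πx₀≡y = ≤-respʳ (∑ᶠ-point x₀ (λ _ → 1#)) (∑-mono (allFin M) λ x → ≤-respʳ (sym (*-identityʳ _)) (go x (x ∈? L) (y ≟ᶠ π x)))
        where
        go : ∀ x (a : Dec (x ∈ L)) (b : Dec (y ≡ π x)) → 𝟙 a * 𝟙 b ≤ 𝟙 (x ≟ᶠ x₀)
        go x (no _)    b       = ≤-respˡ (sym (zeroˡ _)) (0≤𝟙 (x ≟ᶠ x₀))
        go x (yes _)   (no _)  = ≤-respˡ (sym (zeroʳ _)) (0≤𝟙 (x ≟ᶠ x₀))
        go x (yes x∈L) (yes e) = ≤-reflexive (trans (*-identityˡ 1#) (sym (𝟙-yes (x ≟ᶠ x₀) (inj x x₀ (L⊆E x∈L) (L⊆E x₀∈L) (≡.trans (≡.sym e) (≡.sym πx₀≡y))))))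

    preimage : Subset M → Subset N → Subset M
    preimage E K = subsetOf (λ x → (x ∈? E) ×-dec (π x ∈? K))

    image-unique : ∀ {E L} → InjectiveOn E → L ⊆ E → L ≡ preimage E (image π L)
    image-unique {E} {L} inj L⊆E = ⊆-antisym
      (λ {x} x∈L → ∈-subsetOf⁺ (λ x → (x ∈? E) ×-dec (π x ∈? image π L)) (L⊆E x∈L , ∈-image⁺ π {L} x∈L))
      (λ {x} x∈ → back x (∈-subsetOf⁻ (λ x → (x ∈? E) ×-dec (π x ∈? image π L)) x∈))
      where
      back : ∀ x → x ∈ E × π x ∈ image π L → x ∈ L
      back x (x∈E , πx∈) with ∈-image⁻ π {L} πx∈
      ... | x′ , x′∈L , πx′≡πx = ≡.subst (_∈ L) (inj x′ x (L⊆E x′∈L) x∈E πx′≡πx) x′∈L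

    module U = Form (𝒫 M) (𝒫 N) (λ K E → 𝟙 (K ⊆? image π E))
    module Vᶠ = Form (𝒫 M) (𝒫 M) (λ L E → 𝟙 (L ⊆? E))

    pairCoeff : ∀ {n} → Carrier → Subset n → Carrier
    pairCoeff ρ K = 𝟙 (2 ℕ.≤? ∣ K ∣) * ρ ^ ∣ K ∣

    ΛU : Carrier → Weights M → Carrier
    ΛU ρ ν = U.form (pairCoeff ρ) ν ν

    0≤pairCoeff : ∀ {n ρ} → 0# ≤ ρ → (K : Subset n) → 0# ≤ pairCoeff ρ K
    0≤pairCoeff 0≤ρ K = *-nonneg (0≤𝟙 (2 ℕ.≤? ∣ K ∣)) (0≤^ ∣ K ∣ 0≤ρ)

    -- Inside an edge on which π is injective, a set L is determined by π(L) and has the same size.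
    -- Hence the degrees of all L with image K add up to at most the degree of K, and a sum of
    -- squares is at most the square of the sum.
    ΛV≤ΛU : ∀ {ρ} (ν : Weights M) → 0# ≤ ρ → (∀ E → 0# ≤ ν E) → (∀ E → ν E ≈ 0# ⊎ InjectiveOn E) →
            Vᶠ.form (pairCoeff ρ) ν ν ≤ ΛU ρ ν
    ΛV≤ΛU {ρ} ν 0≤ρ 0≤ν inj = ≤-respˡ (sym regroup) (∑-mono (𝒫 N) λ K → *-monoˡ-≤ _ (0≤pairCoeff 0≤ρ K)
        (≤-trans (∑-sq (𝒫 M) (λ L → *-nonneg (0≤𝟙 (K ≟ˢ image π L)) (0≤d L)))
          (*-mono-≤ (0≤b K) (0≤b K) (b≤ K) (b≤ K))))
      where
      d : Subset M → Carrier
      d = Vᶠ.deg ν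
      0≤d : ∀ L → 0# ≤ d L
      0≤d = Vᶠ.0≤deg (λ L E → 0≤𝟙 (L ⊆? E)) 0≤ν
      b : Subset N → Carrier
      b K = ∑ˢ (λ L → 𝟙 (K ≟ˢ image π L) * d L)
      0≤b : ∀ K → 0# ≤ b K
      0≤b K = ∑-0≤ (𝒫 M) λ L → *-nonneg (0≤𝟙 (K ≟ˢ image π L)) (0≤d L)
      sizes : ∀ L → pairCoeff ρ L * (d L * d L) ≈ pairCoeff ρ (image π L) * (d L * d L)
      sizes L = go (em {∃[ E ] L ⊆ E × InjectiveOn E})
        where
        go : Dec (∃[ E ] L ⊆ E × InjectiveOn E) → pairCoeff ρ L * (d L * d L) ≈ pairCoeff ρ (image π L) * (d L * d L)
        go (yes (E , L⊆E , i)) = *-congʳ (≈-reflexive (≡.cong (λ k → 𝟙 (2 ℕ.≤? k) * ρ ^ k) (≡.sym (InjectiveOn⇒card-image i L⊆E))))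
        go (no none) = trans (*-congˡ (*-congˡ d≈0)) (trans (solve 2 (λ c x → c :* (x :* κ 0) := κ 0) refl _ _)
            (sym (trans (*-congˡ (*-congˡ d≈0)) (solve 2 (λ c x → c :* (x :* κ 0) := κ 0) refl _ _))))
          where
          term : ∀ E (a : Dec (L ⊆ E)) → ν E ≈ 0# ⊎ InjectiveOn E → 𝟙 a * ν E ≈ 0#
          term E (no _)    _          = zeroˡ _
          term E (yes _)   (inj₁ ν≈0) = trans (*-congˡ ν≈0) (zeroʳ _)
          term E (yes L⊆E) (inj₂ i)   = ⊥-elim (none (E , L⊆E , i))
          d≈0 : d L ≈ 0#
          d≈0 = ∑-≈0 (𝒫 M) λ E → term E (L ⊆? E) (inj E)
      regroup : Vᶠ.form (pairCoeff ρ) ν ν ≈ ∑ˢ (λ K → pairCoeff ρ K * ∑ˢ (λ L → (𝟙 (K ≟ˢ image π L) * d L) * (𝟙 (K ≟ˢ image π L) * d L)))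
      regroup = trans (∑-cong (𝒫 M) λ L → trans (sizes L) (sym (∑ˢ-point (image π L) (λ K → pairCoeff ρ K * (d L * d L)))))
        (trans (∑-swap (𝒫 M) (𝒫 N) _) (∑-cong (𝒫 N) λ K → trans
          (∑-cong (𝒫 M) λ L → idem (K ≟ˢ image π L) (pairCoeff ρ K) (d L)) (∑-*ˡ (𝒫 M) (pairCoeff ρ K) _)))
        where
        idem : ∀ {P : Set} (a : Dec P) c x → 𝟙 a * (c * (x * x)) ≈ c * ((𝟙 a * x) * (𝟙 a * x))
        idem (yes _) = solve 2 (λ c x → κ 1 :* (c :* (x :* x)) := c :* ((κ 1 :* x) :* (κ 1 :* x))) refl
        idem (no _)  = solve 2 (λ c x → κ 0 :* (c :* (x :* x)) := c :* ((κ 0 :* x) :* (κ 0 :* x))) refl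
      b≤ : ∀ K → b K ≤ U.deg ν K
      b≤ K = ≤-respˡ (sym (trans (∑-cong (𝒫 M) λ L → sym (∑-*ˡ (𝒫 M) (𝟙 (K ≟ˢ image π L)) _))
          (trans (∑-swap (𝒫 M) (𝒫 M) _) (∑-cong (𝒫 M) λ E →
            trans (∑-cong (𝒫 M) λ L → sym (*-assoc _ _ _)) (∑-*ʳ (𝒫 M) (ν E) _)))))
        (∑-mono (𝒫 M) λ E → bound E (inj E))
        where
        bound : ∀ E → ν E ≈ 0# ⊎ InjectiveOn E → ∑ˢ (λ L → 𝟙 (K ≟ˢ image π L) * 𝟙 (L ⊆? E)) * ν E ≤ 𝟙 (K ⊆? image π E) * ν E
        bound E (inj₁ ν≈0) = ≤-reflexive (trans (*-congˡ ν≈0) (trans (zeroʳ _) (sym (trans (*-congˡ ν≈0) (zeroʳ _)))))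
        bound E (inj₂ i)   = *-monoʳ-≤ (ν E) (0≤ν E) (count (K ⊆? image π E))
          where
          count : (d : Dec (K ⊆ image π E)) → ∑ˢ (λ L → 𝟙 (K ≟ˢ image π L) * 𝟙 (L ⊆? E)) ≤ 𝟙 d
          count (no K⊈) = ≤-reflexive (∑-≈0 (𝒫 M) λ L → go L (K ≟ˢ image π L) (L ⊆? E))
            where
            go : ∀ L (a : Dec (K ≡ image π L)) (b : Dec (L ⊆ E)) → 𝟙 a * 𝟙 b ≈ 0#
            go L (no _)  b        = zeroˡ _
            go L (yes _) (no _)   = zeroʳ _
            go L (yes e) (yes L⊆E) = ⊥-elim (K⊈ (λ {y} y∈ → image-mono π {L} {E} L⊆E (≡.subst (y ∈_) e y∈)))
          count (yes _) = ≤-respʳ (∑ˢ-point (preimage E K) (λ _ → 1#)) (∑-mono (𝒫 M) λ L → ≤-respʳ (sym (*-identityʳ _)) (go L (K ≟ˢ image π L) (L ⊆? E)))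
            where
            go : ∀ L (a : Dec (K ≡ image π L)) (b : Dec (L ⊆ E)) → 𝟙 a * 𝟙 b ≤ 𝟙 (L ≟ˢ preimage E K)
            go L (no _)  b        = ≤-respˡ (sym (zeroˡ _)) (0≤𝟙 (L ≟ˢ preimage E K))
            go L (yes _) (no _)   = ≤-respˡ (sym (zeroʳ _)) (0≤𝟙 (L ≟ˢ preimage E K))
            go L (yes e) (yes L⊆E) = ≤-reflexive (trans (*-identityˡ 1#) (sym (𝟙-yes (L ≟ˢ preimage E K)
              (≡.trans (image-unique i L⊆E) (≡.cong (preimage E) (≡.sym e))))))

  -- Averaging Janson weights

  module Robust {M N : ℕ} (π : Fin M → Fin N) (H : Hypergraph M)
    (p R : Carrier) (0<p : 0# < p) (0<R : 0# < R) where

    ρ : Carrier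
    ρ = p ⁻¹

    0≤ρ : 0# ≤ ρ
    0≤ρ = <⇒≤ (0<⁻¹ 0<p)

    SupportedIn : Subset M → Weights M → Set
    SupportedIn Y ν = ∀ E → ν E ≈ 0# ⊎ (Edge H E × E ⊆ Y)

    open U π

    0≤kU : ∀ (K : Subset N) (E : Subset M) → 0# ≤ 𝟙 (K ⊆? image π E)
    0≤kU K E = 0≤𝟙 (K ⊆? image π E)

    -- Weights on π(H[Y]) are moved to H[Y] by choosing one preimage of every edge.
    lift : ∀ Y → IsJanson p R (imageᴴ π (H [ Y ])) →
           Σ[ ν ∈ Weights M ] (∀ E → 0# ≤ ν E) × SupportedIn Y ν × ∑ˢ ν ≈ 1# × R * ΛU π ρ ν ≤ 1#
    lift Y (inj₁ R≈0) = ⊥-elim (0<⇒≉ 0<R R≈0)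
    lift Y (inj₂ (_ , ν₀ , 0≤ν₀ , lt)) = ν , 0≤ν , supp , ∑ν≈1 , RΛ≤1
      where
      G : Hypergraph N
      G = imageᴴ π (H [ Y ])
      open Normalised G p R 0<p 0<R ν₀ 0≤ν₀ lt renaming (scale to i; 0≤scale to 0≤i; scale-total to ie)
      w : Subset N → Carrier
      w = edgeWeight G ν₀
      0≤w : ∀ D → 0# ≤ w D
      0≤w = 0≤edgeWeight G ν₀ 0≤ν₀
      pick : ∀ {D} → Dec (Edge G D) → Subset M
      pick (yes (E , _)) = E
      pick (no _)        = ∅
      rep : Subset N → Subset M
      rep D = pick (Edge? G D)
      ν̃ : Weights M
      ν̃ E = ∑ˢ (λ D → w D * 𝟙 (E ≟ˢ rep D))
      0≤ν̃ : ∀ E → 0# ≤ ν̃ E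
      0≤ν̃ E = ∑-0≤ (𝒫 N) λ D → *-nonneg (0≤w D) (0≤𝟙 (E ≟ˢ rep D))
      supp̃ : ∀ E → ν̃ E ≈ 0# ⊎ (Edge H E × E ⊆ Y)
      supp̃ E = go (em {Edge H E × E ⊆ Y})
        where
        go : Dec (Edge H E × E ⊆ Y) → ν̃ E ≈ 0# ⊎ (Edge H E × E ⊆ Y)
        go (yes h) = inj₂ h
        go (no ¬h) = inj₁ (∑-≈0 (𝒫 N) λ D → term D (Edge? G D))
          where
          term : ∀ D (d : Dec (Edge G D)) → 𝟙 d * ν₀ D * 𝟙 (E ≟ˢ pick d) ≈ 0#
          term D (no _) = trans (*-congʳ (zeroˡ _)) (zeroˡ _)
          term D (yes (E′ , e′ , _)) = trans (*-congˡ (𝟙-no (E ≟ˢ E′) λ { ≡.refl → ¬h e′ })) (zeroʳ _)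
      push : ∀ (f : Subset M → Carrier) → ∑ˢ (λ E → f E * ν̃ E) ≈ ∑ˢ (λ D → w D * f (rep D))
      push f = trans (∑-cong (𝒫 M) λ E → sym (∑-*ˡ (𝒫 N) (f E) _)) (trans (∑-swap (𝒫 M) (𝒫 N) _)
        (∑-cong (𝒫 N) λ D → trans (∑-cong (𝒫 M) λ E → solve 3 (λ f w a → f :* (w :* a) := w :* (a :* f)) refl (f E) (w D) (𝟙 (E ≟ˢ rep D)))
          (trans (∑-*ˡ (𝒫 M) (w D) _) (*-congˡ (∑ˢ-point (rep D) f)))))
      ∑ν̃≈e : ∑ˢ ν̃ ≈ totalWeight G ν₀
      ∑ν̃≈e = trans (∑-cong (𝒫 M) λ E → sym (*-identityˡ _)) (trans (push (λ _ → 1#))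
        (trans (∑-cong (𝒫 N) λ D → *-identityʳ _) (sym (totalWeight≈ G ν₀))))
      deg≈ : ∀ K → deg ν̃ K ≈ degree G ν₀ K
      deg≈ K = trans (push (λ E → 𝟙 (K ⊆? image π E))) (trans (∑-cong (𝒫 N) λ D → term D (Edge? G D)) (sym (degree≈ G ν₀ K)))
        where
        term : ∀ D (d : Dec (Edge G D)) → 𝟙 d * ν₀ D * 𝟙 (K ⊆? image π (pick d)) ≈ 𝟙 (K ⊆? D) * (𝟙 d * ν₀ D)
        term D (no _) = solve 3 (λ n a b → κ 0 :* n :* a := b :* (κ 0 :* n)) refl _ _ _
        term D (yes (E , _ , D≡πE)) = trans (*-comm _ _) (*-congʳ (≈-reflexive (≡.cong (λ K′ → 𝟙 (K ⊆? K′)) (≡.sym D≡πE))))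
      ΛU≈ : ΛU π ρ ν̃ ≈ Λ G ν₀ p
      ΛU≈ = trans (∑-cong (𝒫 N) λ K → *-congˡ (*-cong (deg≈ K) (deg≈ K))) (sym (Λ≈ G ν₀ p))
      ν : Weights M
      ν E = i * ν̃ E
      0≤ν : ∀ E → 0# ≤ ν E
      0≤ν E = *-nonneg 0≤i (0≤ν̃ E)
      supp : SupportedIn Y ν
      supp E = [ (λ z → inj₁ (trans (*-congˡ z) (zeroʳ i))) , inj₂ ]′ (supp̃ E)
      ∑ν≈1 : ∑ˢ ν ≈ 1#
      ∑ν≈1 = trans (∑-*ˡ (𝒫 M) i _) (trans (*-congˡ ∑ν̃≈e) ie)
      RΛ≤1 : R * ΛU π ρ ν ≤ 1#
      RΛ≤1 = ≤-respˡ (*-congˡ (sym (trans (form-* (pairCoeff π ρ) ν̃ i) (*-congˡ ΛU≈)))) scale-Λ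

    module Averaging (s r n : ℕ) (1≤s : 1 ℕ.≤ s) (1≤r : 1 ℕ.≤ r) (n′ : ℕ) (n≡ : n ≡ suc n′) (V : Subset M)
      (uniform : ∀ E → Edge H E → ∣ image π E ∣ ≡ s)
      (halving : ∀ L → L ⊆ V → ⟦ ∣ L ∣ ⟧ / ⟦ 2 ⟧ ≤ ⟦ ∣ image π L ∣ ⟧)
      (X : Subset M) (X⊆V : X ⊆ V)
      (robust : ∀ Y → Y ⊆ X → ⟦ ∣ X ∣ ⟧ - (⟦ 2 ⟧ ^ 8) ⁻¹ * ⟦ r ⟧ ⁻¹ * ⟦ n ⟧ ≤ ⟦ ∣ Y ∣ ⟧ → IsJanson p R (imageᴴ π (H [ Y ]))) where

      -- The threshold for a heavy vertex of U. The degrees add up to at most sn, so at most n/(2⁹r)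
      -- vertices are heavy, and by `halving` at most n/(2⁸r) vertices of X lie above them: exactly
      -- the loss that `robust` permits.
      θ : Carrier
      θ = ⟦ 2 ⟧ ^ 9 * ⟦ r ⟧ * ⟦ s ⟧

      private
        r̄ s̄ n̄ c : Carrier
        r̄ = ⟦ r ⟧
        s̄ = ⟦ s ⟧
        n̄ = ⟦ n ⟧
        c = (⟦ 2 ⟧ ^ 8) ⁻¹ * r̄ ⁻¹
        0<r̄ : 0# < r̄
        0<r̄ = <-≤-trans (0<⟦suc⟧ 0) (⟦⟧-mono 1≤r)
        0<s̄ : 0# < s̄
        0<s̄ = <-≤-trans (0<⟦suc⟧ 0) (⟦⟧-mono 1≤s)
        0<2⁸ : 0# < ⟦ 2 ⟧ ^ 8
        0<2⁸ = 0<^ 8 0<2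
        0≤c : 0# ≤ c
        0≤c = *-nonneg (<⇒≤ (0<⁻¹ 0<2⁸)) (<⇒≤ (0<⁻¹ 0<r̄))
        c-inv : ⟦ 2 ⟧ ^ 8 * r̄ * c ≈ 1#
        c-inv = trans (solve 4 (λ a b a′ b′ → a :* b :* (a′ :* b′) := (a :* a′) :* (b :* b′)) refl (⟦ 2 ⟧ ^ 8) r̄ _ _)
          (trans (*-cong (inverseʳ 0<2⁸) (inverseʳ 0<r̄)) (*-identityˡ 1#))
        0≤θ : 0# ≤ θ
        0≤θ = *-nonneg (*-nonneg (0≤^ 9 (0≤⟦⟧ 2)) (0≤⟦⟧ r)) (0≤⟦⟧ s)

        -- A sum of k normalised Janson weights. The bound k² is the triangle inequality for the
        -- seminorm √Λ, and `θ + 1#` allows for one overshoot by a weight of total 1.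
        Partial : ℕ → Set
        Partial k = Σ[ ν ∈ Weights M ] (∀ E → 0# ≤ ν E) × SupportedIn X ν × ∑ˢ ν ≈ ⟦ k ⟧ ×
                    R * ΛU π ρ ν ≤ ⟦ k ⟧ * ⟦ k ⟧ × (∀ y → deg ν ⁅ y ⁆ ≤ θ + 1#)

        deg≤∑ : ∀ {ν} → (∀ E → 0# ≤ ν E) → ∀ K → deg ν K ≤ ∑ˢ ν
        deg≤∑ 0≤ν K = ∑-mono (𝒫 M) λ E → 𝟙*≤ (K ⊆? image π E) (0≤ν E)

        1≤θ+1 : 1# ≤ θ + 1#
        1≤θ+1 = ≤-respˡ (+-identityˡ 1#) (+-mono-≤ 0≤θ ≤-refl)

        ∑deg : ∀ {ν} → SupportedIn X ν → ∑ᶠ (λ y → deg ν ⁅ y ⁆) ≈ s̄ * ∑ˢ ν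
        ∑deg {ν} supp = trans (∑-swap (allFin N) (𝒫 M) _) (trans (∑-cong (𝒫 M) λ E →
          trans (∑-*ʳ (allFin N) (ν E) _) (trans (*-congʳ (∑ᶠ-⁅⁆⊆ (image π E))) (size E (supp E)))) (∑-*ˡ (𝒫 M) s̄ _))
          where
          size : ∀ E → ν E ≈ 0# ⊎ (Edge H E × E ⊆ X) → ⟦ ∣ image π E ∣ ⟧ * ν E ≈ s̄ * ν E
          size E (inj₁ z) = trans (*-congˡ z) (trans (zeroʳ _) (sym (trans (*-congˡ z) (zeroʳ _))))
          size E (inj₂ (e , _)) = *-congʳ (≈-reflexive (≡.cong ⟦_⟧ (uniform E e)))

        base : Partial 1
        base = μ , 0≤μ , suppμ , trans ∑μ (sym ⟦1⟧≈1) , ≤-respʳ (sym (trans (*-cong ⟦1⟧≈1 ⟦1⟧≈1) (*-identityˡ 1#))) RΛ ,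
               λ y → ≤-trans (≤-respʳ ∑μ (deg≤∑ 0≤μ ⁅ y ⁆)) 1≤θ+1
          where
          whole : ⟦ ∣ X ∣ ⟧ - (⟦ 2 ⟧ ^ 8) ⁻¹ * r̄ ⁻¹ * n̄ ≤ ⟦ ∣ X ∣ ⟧
          whole = by-cert (solve 2 (λ x y → x :- (x :- y) := y) refl ⟦ ∣ X ∣ ⟧ (c * n̄)) (*-nonneg 0≤c (0≤⟦⟧ n))
          L = lift X (robust X id whole)
          μ = proj₁ L
          0≤μ = proj₁ (proj₂ L)
          suppμ = proj₁ (proj₂ (proj₂ L))
          ∑μ = proj₁ (proj₂ (proj₂ (proj₂ L)))
          RΛ = proj₂ (proj₂ (proj₂ (proj₂ L)))

        step : ∀ j → suc j ℕ.≤ n → Partial (suc j) → Partial (suc (suc j))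
        step j j<n (ν , 0≤ν , supp , ∑ν , RΛ , degs) = ν′ , 0≤ν′ , supp′ , ∑ν′ , RΛ′ , degs′
          where
          k̄ : Carrier
          k̄ = ⟦ suc j ⟧
          0<k̄ : 0# < k̄
          0<k̄ = 0<⟦suc⟧ j
          B : Subset N
          B = subsetOf (λ y → em {θ ≤ deg ν ⁅ y ⁆})
          Y Z : Subset M
          Y = subsetOf (λ x → (x ∈? X) ×-dec ¬? (π x ∈? B))
          Z = subsetOf (λ x → (x ∈? X) ×-dec (π x ∈? B))
          Y⁻ : ∀ {x} → x ∈ Y → x ∈ X × π x ∉ B
          Y⁻ = ∈-subsetOf⁻ (λ x → (x ∈? X) ×-dec ¬? (π x ∈? B))
          Z⁻ : ∀ {x} → x ∈ Z → x ∈ X × π x ∈ B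
          Z⁻ = ∈-subsetOf⁻ (λ x → (x ∈? X) ×-dec (π x ∈? B))
          Y⊆X : Y ⊆ X
          Y⊆X x∈ = proj₁ (Y⁻ x∈)
          X≤ : ⟦ ∣ X ∣ ⟧ ≤ ⟦ ∣ Y ∣ ⟧ + ⟦ ∣ Z ∣ ⟧
          X≤ = ≤-resp₂ (∑ᶠ-∈ X) (trans (∑-+ (allFin M) _ _) (+-cong (∑ᶠ-∈ Y) (∑ᶠ-∈ Z)))
            (∑-mono (allFin M) λ x → term x (x ∈? X) (π x ∈? B))
            where
            term : ∀ x (a : Dec (x ∈ X)) → Dec (π x ∈ B) → 𝟙 a ≤ 𝟙 (x ∈? Y) + 𝟙 (x ∈? Z)
            term x (no _)    _        = 0≤+ (0≤𝟙 (x ∈? Y)) (0≤𝟙 (x ∈? Z))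
            term x (yes x∈X) (no πx∉) = ≤-respˡ (+-identityʳ 1#) (+-mono-≤
              (≤-reflexive (sym (𝟙-yes (x ∈? Y) (∈-subsetOf⁺ (λ x → (x ∈? X) ×-dec ¬? (π x ∈? B)) (x∈X , πx∉))))) (0≤𝟙 (x ∈? Z)))
            term x (yes x∈X) (yes πx∈) = ≤-respˡ (+-identityˡ 1#) (+-mono-≤ (0≤𝟙 (x ∈? Y))
              (≤-reflexive (sym (𝟙-yes (x ∈? Z) (∈-subsetOf⁺ (λ x → (x ∈? X) ×-dec (π x ∈? B)) (x∈X , πx∈))))))
          Z≤ : ⟦ ∣ Z ∣ ⟧ ≤ ⟦ 2 ⟧ * ⟦ ∣ B ∣ ⟧
          Z≤ = ≤-trans (≤-respˡ (trans (solve 3 (λ t z i → t :* (z :* i) := z :* (t :* i)) refl ⟦ 2 ⟧ ⟦ ∣ Z ∣ ⟧ (⟦ 2 ⟧ ⁻¹)) (trans (*-congˡ (inverseʳ 0<2)) (*-identityʳ _)))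
              (*-monoˡ-≤ ⟦ 2 ⟧ (0≤⟦⟧ 2) (halving Z (λ x∈ → X⊆V (proj₁ (Z⁻ x∈))))))
            (*-monoˡ-≤ ⟦ 2 ⟧ (0≤⟦⟧ 2) (⟦⟧-mono (p⊆q⇒∣p∣≤∣q∣ image⊆B)))
            where
            image⊆B : image π Z ⊆ B
            image⊆B y∈ = hit (∈-image⁻ π {Z} y∈)
              where
              hit : ∀ {y} → ∃[ x ] x ∈ Z × π x ≡ y → y ∈ B
              hit (x , x∈Z , πx≡y) = ≡.subst (_∈ B) πx≡y (proj₂ (Z⁻ x∈Z))
          θB≤ : θ * ⟦ ∣ B ∣ ⟧ ≤ s̄ * n̄
          θB≤ = ≤-trans (≤-respˡ (trans (∑-*ˡ (allFin N) θ _) (*-congˡ (∑ᶠ-∈ B))) (∑-mono (allFin N) λ y → term y (y ∈? B)))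
            (≤-respˡ (sym (trans (∑deg supp) (*-congˡ ∑ν))) (*-monoˡ-≤ s̄ (0≤⟦⟧ s) (⟦⟧-mono j<n)))
            where
            term : ∀ y (a : Dec (y ∈ B)) → θ * 𝟙 a ≤ deg ν ⁅ y ⁆
            term y (no _)    = ≤-respˡ (sym (zeroʳ θ)) (0≤deg 0≤kU 0≤ν ⁅ y ⁆)
            term y (yes y∈B) = ≤-respˡ (sym (*-identityʳ θ)) (∈-subsetOf⁻ (λ y → em {θ ≤ deg ν ⁅ y ⁆}) y∈B)
          large : ⟦ ∣ X ∣ ⟧ - (⟦ 2 ⟧ ^ 8) ⁻¹ * r̄ ⁻¹ * n̄ ≤ ⟦ ∣ Y ∣ ⟧
          large = by-cert (solve 3 (λ x y z → y :- (x :- z) := (y :+ z) :- x) refl ⟦ ∣ X ∣ ⟧ ⟦ ∣ Y ∣ ⟧ (c * n̄))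
            (≤⇒0≤ (≤-trans X≤ (+-mono-≤ ≤-refl (≤-trans Z≤ 2B≤))))
            where
            2B≤ : ⟦ 2 ⟧ * ⟦ ∣ B ∣ ⟧ ≤ c * n̄
            2B≤ = *-cancelˡ-≤ s̄ 0<s̄ (≤-resp₂
              (trans (solve 5 (λ a b s r c → c :* ((κ 2 :* a) :* r :* s :* b) := s :* ((a :* r :* c) :* (κ 2 :* b))) refl (⟦ 2 ⟧ ^ 8) ⟦ ∣ B ∣ ⟧ s̄ r̄ c)
                (*-congˡ (trans (*-congʳ c-inv) (*-identityˡ _))))
              (solve 3 (λ c s n → c :* (s :* n) := s :* (c :* n)) refl c s̄ n̄)
              (*-monoˡ-≤ c 0≤c θB≤))
          L = lift Y (robust Y Y⊆X large)
          μ : Weights M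
          μ = proj₁ L
          0≤μ : ∀ E → 0# ≤ μ E
          0≤μ = proj₁ (proj₂ L)
          suppμ : SupportedIn Y μ
          suppμ = proj₁ (proj₂ (proj₂ L))
          ∑μ : ∑ˢ μ ≈ 1#
          ∑μ = proj₁ (proj₂ (proj₂ (proj₂ L)))
          RΛμ : R * ΛU π ρ μ ≤ 1#
          RΛμ = proj₂ (proj₂ (proj₂ (proj₂ L)))
          ν′ : Weights M
          ν′ E = ν E + 1# * μ E
          0≤ν′ : ∀ E → 0# ≤ ν′ E
          0≤ν′ E = 0≤+ (0≤ν E) (*-nonneg 0≤1 (0≤μ E))
          supp′ : SupportedIn X ν′
          supp′ E = join (supp E) (suppμ E)
            where
            join : ν E ≈ 0# ⊎ (Edge H E × E ⊆ X) → μ E ≈ 0# ⊎ (Edge H E × E ⊆ Y) → ν E + 1# * μ E ≈ 0# ⊎ (Edge H E × E ⊆ X)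
            join (inj₂ h) _ = inj₂ h
            join (inj₁ _) (inj₂ (e , E⊆Y)) = inj₂ (e , λ x∈ → Y⊆X (E⊆Y x∈))
            join (inj₁ a) (inj₁ b) = inj₁ (trans (+-cong a (*-congˡ b)) (solve 0 (κ 0 :+ κ 1 :* κ 0 := κ 0) refl))
          ∑ν′ : ∑ˢ ν′ ≈ ⟦ suc (suc j) ⟧
          ∑ν′ = trans (∑-+ (𝒫 M) _ _) (trans (+-cong ∑ν (trans (∑-*ˡ (𝒫 M) 1# _) (trans (*-identityˡ _) ∑μ))) (+-comm _ _))
          inner : Carrier
          inner = form (pairCoeff π ρ) ν μ
          -- Cauchy–Schwarz through 0 ≤ ΛU (ν - k μ)
          R-inner : R * inner ≤ k̄
          R-inner = *-cancelˡ-≤ (⟦ 2 ⟧ * k̄) (0<* 0<2 0<k̄) (by-cert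
            (solve 5 (λ k R i a b → κ 2 :* k :* k :- κ 2 :* k :* (R :* i) := R :* (a :+ (κ 2 :* :- k :* i :+ :- k :* :- k :* b)) :+ (k :* k :- R :* a) :+ k :* k :* (κ 1 :- R :* b)) refl
              k̄ R inner (ΛU π ρ ν) (ΛU π ρ μ))
            (0≤+ (0≤+ (*-nonneg (<⇒≤ 0<R) (≤-respʳ (form-+* (pairCoeff π ρ) ν μ (- k̄)) (0≤form (λ E → ν E + - k̄ * μ E) (0≤pairCoeff π 0≤ρ))))
              (≤⇒0≤ RΛ)) (*-nonneg (*-nonneg (<⇒≤ 0<k̄) (<⇒≤ 0<k̄)) (≤⇒0≤ RΛμ))))
          RΛ′ : R * ΛU π ρ ν′ ≤ ⟦ suc (suc j) ⟧ * ⟦ suc (suc j) ⟧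
          RΛ′ = ≤-respˡ (*-congˡ (sym (form-+* (pairCoeff π ρ) ν μ 1#))) (by-cert
            (solve 5 (λ k R i a b → (κ 1 :+ k) :* (κ 1 :+ k) :- R :* (a :+ (κ 2 :* κ 1 :* i :+ κ 1 :* κ 1 :* b)) := (k :* k :- R :* a) :+ κ 2 :* (k :- R :* i) :+ (κ 1 :- R :* b)) refl
              k̄ R inner (ΛU π ρ ν) (ΛU π ρ μ))
            (0≤+ (0≤+ (≤⇒0≤ RΛ) (*-nonneg (0≤⟦⟧ 2) (≤⇒0≤ R-inner))) (≤⇒0≤ RΛμ)))
          -- A light vertex gains at most the whole weight 1 of `μ`; a heavy one gains nothing, as
          -- no edge in Y has an image that meets B.
          degs′ : ∀ y → deg ν′ ⁅ y ⁆ ≤ θ + 1#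
          degs′ y = ≤-respˡ (sym (deg-+* ν μ 1# ⁅ y ⁆)) (≤-respˡ (+-congˡ (sym (*-identityˡ _))) (go (y ∈? B)))
            where
            go : Dec (y ∈ B) → deg ν ⁅ y ⁆ + deg μ ⁅ y ⁆ ≤ θ + 1#
            go (no y∉B) = +-mono-≤ (≮⇒≥ λ θ<d → y∉B (∈-subsetOf⁺ (λ y → em {θ ≤ deg ν ⁅ y ⁆}) (<⇒≤ θ<d))) (≤-respʳ ∑μ (deg≤∑ 0≤μ ⁅ y ⁆))
            go (yes y∈B) = ≤-respˡ (trans (sym (+-identityʳ _)) (+-congˡ (sym deg≈0))) (degs y)
              where
              term : ∀ E (a : Dec (⁅ y ⁆ ⊆ image π E)) → μ E ≈ 0# ⊎ (Edge H E × E ⊆ Y) → 𝟙 a * μ E ≈ 0#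
              term E (no _)  _        = zeroˡ _
              term E (yes _) (inj₁ z) = trans (*-congˡ z) (zeroʳ _)
              term E (yes h) (inj₂ (_ , E⊆Y)) = ⊥-elim (avoid (∈-image⁻ π {E} (⁅⁆⊆⁻ h)))
                where
                avoid : ¬ (∃[ x ] x ∈ E × π x ≡ y)
                avoid (x , x∈E , πx≡y) = proj₂ (Y⁻ (E⊆Y x∈E)) (≡.subst (_∈ B) (≡.sym πx≡y) y∈B)
              deg≈0 : deg μ ⁅ y ⁆ ≈ 0#
              deg≈0 = ∑-≈0 (𝒫 M) λ E → term E (⁅ y ⁆ ⊆? image π E) (suppμ E)

        iterate : ∀ j → suc j ℕ.≤ n → Partial (suc j)
        iterate zero    _   = base
        iterate (suc j) j<n = step j (ℕ.≤-trans (ℕ.n≤1+n (suc j)) j<n) (iterate j (ℕ.≤-trans (ℕ.n≤1+n (suc j)) j<n))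

      Spread-weight : Set
      Spread-weight = Σ[ ν ∈ Weights M ] (∀ E → 0# ≤ ν E) × SupportedIn X ν × ∑ˢ ν ≈ 1# × R * ΛU π ρ ν ≤ 1# ×
                      ⟦ n ⟧ * ∑ᶠ (λ y → deg ν ⁅ y ⁆ * deg ν ⁅ y ⁆) ≤ (θ + 1#) * ⟦ s ⟧

      scale : Partial (suc n′) → Spread-weight
      scale (ν , 0≤ν , supp , ∑ν , RΛ , degs) = ν′ , 0≤ν′ , supp′ , ∑ν′ ,
          ≤-resp₂ (trans (solve 3 (λ i r l → i :* i :* (r :* l) := r :* (i :* i :* l)) refl i R (ΛU π ρ ν)) (*-congˡ (sym (form-* (pairCoeff π ρ) ν i))))
            (trans (solve 2 (λ i m → i :* i :* (m :* m) := (i :* m) :* (i :* m)) refl i m) (trans (*-cong im im) (*-identityˡ 1#)))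
            (*-monoˡ-≤ (i * i) (*-nonneg 0≤i 0≤i) RΛ) ,
          squares
        where
        m : Carrier
        m = ⟦ suc n′ ⟧
        i : Carrier
        i = m ⁻¹
        0≤i : 0# ≤ i
        0≤i = <⇒≤ (0<⁻¹ (0<⟦suc⟧ n′))
        im : i * m ≈ 1#
        im = inverseˡ (0<⟦suc⟧ n′)
        ni : ⟦ n ⟧ * i ≈ 1#
        ni = trans (*-congʳ (≈-reflexive (≡.cong ⟦_⟧ n≡))) (inverseʳ (0<⟦suc⟧ n′))
        ν′ : Weights M
        ν′ E = i * ν E
        0≤ν′ : ∀ E → 0# ≤ ν′ E
        0≤ν′ E = *-nonneg 0≤i (0≤ν E)
        supp′ : SupportedIn X ν′
        supp′ E = [ (λ z → inj₁ (trans (*-congˡ z) (zeroʳ i))) , inj₂ ]′ (supp E)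
        ∑ν′ : ∑ˢ ν′ ≈ 1#
        ∑ν′ = trans (∑-*ˡ (𝒫 M) i _) (trans (*-congˡ ∑ν) im)
        degs′ : ∀ y → n̄ * deg ν′ ⁅ y ⁆ ≤ θ + 1#
        degs′ y = ≤-respˡ (sym (trans (*-congˡ (deg-* ν i ⁅ y ⁆)) (trans (sym (*-assoc _ _ _)) (trans (*-congʳ ni) (*-identityˡ _))))) (degs y)
        d′ : Fin N → Carrier
        d′ y = deg ν′ ⁅ y ⁆
        0≤d′ : ∀ y → 0# ≤ d′ y
        0≤d′ y = 0≤deg 0≤kU {ν′} 0≤ν′ ⁅ y ⁆
        ∑d′ : ∑ᶠ d′ ≈ s̄
        ∑d′ = trans (∑deg {ν′} supp′) (trans (*-congˡ ∑ν′) (*-identityʳ s̄))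
        -- One factor d′(y) is replaced by its bound (θ + 1)/n, and the other sums to s.
        squares : n̄ * ∑ᶠ (λ y → d′ y * d′ y) ≤ (θ + 1#) * s̄
        squares = ≤-trans (≤-reflexive (sym (∑-*ˡ (allFin N) n̄ (λ y → d′ y * d′ y))))
          (≤-trans (∑-mono (allFin N) {λ y → n̄ * (d′ y * d′ y)} {λ y → (θ + 1#) * d′ y} term)
            (≤-reflexive (trans (∑-*ˡ (allFin N) (θ + 1#) d′) (*-congˡ ∑d′))))
          where
          term : ∀ y → n̄ * (d′ y * d′ y) ≤ (θ + 1#) * d′ y
          term y = ≤-respˡ (*-assoc n̄ (d′ y) (d′ y)) (*-monoʳ-≤ (d′ y) (0≤d′ y) (degs′ y))

      spread-weight : Spread-weight
      spread-weight = scale (iterate n′ (ℕ.≤-reflexive (≡.sym n≡)))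

  -- Adding weights to F

  module _ {N : ℕ} (F : Hypergraph N) (p R′ : Carrier) (0<p : 0# < p) where

    -- Both properties are multiplied by R′ so as to cover R′ = 0, where the Janson property
    -- provides no weight and the zero weight is taken.
    normalise : IsJanson p R′ F → Σ[ ν ∈ (Subset N → Carrier) ] (∀ D → Edge F D → 0# ≤ ν D) ×
                R′ * totalWeight F ν ≈ R′ × R′ * Λ F ν p ≤ 1#
    normalise (inj₁ R′≈0) = (λ _ → 0#) , (λ _ _ → ≤-refl) , trans (*-congʳ R′≈0) (trans (zeroˡ _) (sym R′≈0)) ,
      ≤-respˡ (sym (trans (*-congʳ R′≈0) (zeroˡ _))) 0≤1
    normalise (inj₂ (0<R′ , ν₀ , 0≤ν₀ , lt)) = (λ D → i * ν₀ D) , (λ D e → *-nonneg 0≤i (0≤ν₀ D e)) ,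
        trans (*-congˡ (trans (∑-*ˡ (edges F) i ν₀) ie)) (*-identityʳ R′) , RΛ≤1
      where
      open Normalised F p R′ 0<p 0<R′ ν₀ 0≤ν₀ lt renaming (scale to i; 0≤scale to 0≤i; scale-total to ie)
      Λ-scale : Λ F (λ D → i * ν₀ D) p ≈ i * i * Λ F ν₀ p
      Λ-scale = trans (Λ≈ F (λ D → i * ν₀ D) p) (trans (∑-cong (𝒫 N) λ K →
          trans (*-congˡ (*-cong (∑-*ˡ (filter (K ⊆?_) (edges F)) i ν₀) (∑-*ˡ (filter (K ⊆?_) (edges F)) i ν₀)))
            (solve 3 (λ c i d → c :* ((i :* d) :* (i :* d)) := i :* i :* (c :* (d :* d))) refl _ i (degree F ν₀ K)))
        (trans (∑-*ˡ (𝒫 N) (i * i) _) (*-congˡ (sym (Λ≈ F ν₀ p)))))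
      RΛ≤1 : R′ * Λ F (λ D → i * ν₀ D) p ≤ 1#
      RΛ≤1 = ≤-respˡ (*-congˡ (sym Λ-scale)) scale-Λ

  module Mixing {M N : ℕ} (π : Fin M → Fin N) (F : Hypergraph N) (p R′ : Carrier) (0<p : 0# < p) (0≤R′ : 0# ≤ R′)
    (νF : Subset N → Carrier) (0≤νF : ∀ D → Edge F D → 0# ≤ νF D)
    (R′e≈R′ : R′ * totalWeight F νF ≈ R′) (R′Λ≤1 : R′ * Λ F νF p ≤ 1#) where

    private
      ρ : Carrier
      ρ = p ⁻¹
      0≤ρ : 0# ≤ ρ
      0≤ρ = <⇒≤ (0<⁻¹ 0<p)
      pc : Subset N → Carrier
      pc = pairCoeff π ρ
      0≤pc : ∀ K → 0# ≤ pc K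
      0≤pc = 0≤pairCoeff π 0≤ρ
      wF : Subset N → Carrier
      wF = edgeWeight F νF
      0≤wF : ∀ D → 0# ≤ wF D
      0≤wF = 0≤edgeWeight F νF 0≤νF
      dF : Subset N → Carrier
      dF = degree F νF
      0≤dF : ∀ K → 0# ≤ dF K
      0≤dF K = ≤-respʳ (sym (degree≈ F νF K)) (∑-0≤ (𝒫 N) λ D → *-nonneg (0≤𝟙 (K ⊆? D)) (0≤wF D))
      ΛF : Carrier
      ΛF = Λ F νF p

    cost : Subset M → Carrier
    cost E = ∑ˢ (λ K → pc K * (dF K * 𝟙 (K ⊆? image π E)))

    -- The cost of E is the cross term in `Λ` between the weight of F and a unit weight on E. The
    -- threshold 1/(2R′) is twice the bound on the average cost; with R′ multiplied out, every edge
    -- is good when R′ = 0.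
    Good : Subset M → Set
    Good E = ⟦ 2 ⟧ * (R′ * cost E) ≤ 1#

    private
      0≤cost : ∀ E → 0# ≤ cost E
      0≤cost E = ∑-0≤ (𝒫 N) λ K → *-nonneg (0≤pc K) (*-nonneg (0≤dF K) (0≤𝟙 (K ⊆? image π E)))

      ∑-cost : ∀ (k : Subset N → Subset M → Carrier) (ν : Weights M) →
               ∑ˢ (λ E → ∑ˢ (λ K → pc K * (dF K * k K E)) * ν E) ≈ ∑ˢ (λ K → pc K * (dF K * ∑ˢ (λ E → k K E * ν E)))
      ∑-cost k ν = trans (∑-cong (𝒫 M) λ E → sym (∑-*ʳ (𝒫 N) (ν E) _)) (trans (∑-swap (𝒫 M) (𝒫 N) _)
        (∑-cong (𝒫 N) λ K → trans (∑-cong (𝒫 M) λ E → solve 4 (λ c d k n → c :* (d :* k) :* n := c :* d :* (k :* n)) refl (pc K) (dF K) (k K E) (ν E))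
          (trans (∑-*ˡ (𝒫 M) (pc K * dF K) _) (*-assoc _ _ _))))

    -- The average cost is at most 1/(4R′) by Cauchy–Schwarz, so Markov leaves half of the weight on good edges.
    good-half : ∀ {R} (ν : Weights M) → (∀ E → 0# ≤ ν E) → ∑ˢ ν ≈ 1# → R * ΛU π ρ ν ≤ 1# → ⟦ 16 ⟧ * R′ ≤ R →
                1# ≤ ⟦ 2 ⟧ * ∑ˢ (λ E → 𝟙 (em {Good E}) * ν E)
    good-half {R} ν 0≤ν ∑ν RΛ 16R′≤R = by-cert
      (trans (+-congˡ (-‿cong (sym ∑ν))) (solve 3 (λ g n c → κ 2 :* g :- n := κ 2 :* (g :+ c :- n) :+ (n :- κ 2 :* c)) refl _ (∑ˢ ν) (⟦ 2 ⟧ * (R′ * avg))))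
      (0≤+ (*-nonneg (0≤⟦⟧ 2) (≤⇒0≤ markov)) (≤⇒0≤ (≤-respʳ (sym ∑ν) (≤-respˡ (solve 2 (λ r a → κ 4 :* (r :* a) := κ 2 :* (κ 2 :* (r :* a))) refl R′ avg) avg≤))))
      where
      open U π
      avg : Carrier
      avg = ∑ˢ (λ E → cost E * ν E)
      avg≈ : avg ≈ ∑ˢ (λ K → pc K * (dF K * deg ν K))
      avg≈ = ∑-cost (λ K E → 𝟙 (K ⊆? image π E)) ν
      ΛUν : Carrier
      ΛUν = ΛU π ρ ν
      0≤ΛUν : 0# ≤ ΛUν
      0≤ΛUν = 0≤form ν 0≤pc
      -- The factor 4 balances the two forms: R′ΛF ≤ 1 and 16R′ΛUν ≤ RΛUν ≤ 1.
      square : 0# ≤ ΛF - ⟦ 8 ⟧ * avg + ⟦ 16 ⟧ * ΛUν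
      square = ≤-respʳ (trans (∑-cong (𝒫 N) λ K → solve 3 (λ c a b → c :* ((a :- κ 4 :* b) :* (a :- κ 4 :* b)) := c :* (a :* a) :+ :- κ 8 :* (c :* (a :* b)) :+ κ 16 :* (c :* (b :* b))) refl (pc K) (dF K) (deg ν K))
          (trans (∑-+ (𝒫 N) _ _) (+-cong (trans (∑-+ (𝒫 N) _ _) (+-cong (sym (Λ≈ F νF p))
              (trans (∑-*ˡ (𝒫 N) (- ⟦ 8 ⟧) _) (trans (*-congˡ (sym avg≈)) (solve 1 (λ a → :- κ 8 :* a := :- (κ 8 :* a)) refl avg)))))
            (∑-*ˡ (𝒫 N) ⟦ 16 ⟧ _))))
        (∑-0≤ (𝒫 N) λ K → *-nonneg (0≤pc K) (0≤sq (dF K - ⟦ 4 ⟧ * deg ν K)))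
      avg≤ : ⟦ 4 ⟧ * (R′ * avg) ≤ 1#
      avg≤ = *-cancelˡ-≤ ⟦ 2 ⟧ (0<⟦suc⟧ 1) (by-cert
        (solve 5 (λ r R a l u → κ 2 :* κ 1 :- κ 2 :* (κ 4 :* (r :* a)) := r :* (l :- κ 8 :* a :+ κ 16 :* u) :+ (κ 1 :- r :* l) :+ (R :- κ 16 :* r) :* u :+ (κ 1 :- R :* u)) refl R′ R avg ΛF ΛUν)
        (0≤+ (0≤+ (0≤+ (*-nonneg 0≤R′ square) (≤⇒0≤ R′Λ≤1)) (*-nonneg (≤⇒0≤ 16R′≤R) 0≤ΛUν)) (≤⇒0≤ RΛ)))
      markov : ∑ˢ ν ≤ ∑ˢ (λ E → 𝟙 (em {Good E}) * ν E) + ⟦ 2 ⟧ * (R′ * avg)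
      markov = ≤-respʳ (trans (∑-+ (𝒫 M) _ _) (+-congˡ (trans (∑-cong (𝒫 M) λ E → solve 3 (λ r c n → κ 2 :* (r :* c) :* n := κ 2 :* r :* (c :* n)) refl R′ (cost E) (ν E))
          (trans (∑-*ˡ (𝒫 M) (⟦ 2 ⟧ * R′) _) (*-assoc _ _ _)))))
        (∑-mono (𝒫 M) λ E → term E em)
        where
        term : ∀ E (d : Dec (Good E)) → ν E ≤ 𝟙 d * ν E + ⟦ 2 ⟧ * (R′ * cost E) * ν E
        term E (yes _) = ≤-respˡ (trans (+-identityʳ _) (*-identityˡ _)) (+-mono-≤ ≤-refl (*-nonneg (*-nonneg (0≤⟦⟧ 2) (*-nonneg 0≤R′ (0≤cost E))) (0≤ν E)))
        term E (no bad) = ≤-respʳ (trans (sym (+-identityˡ _)) (+-congʳ (sym (zeroˡ _)))) (≤-respˡ (*-identityˡ _) (*-monoʳ-≤ (ν E) (0≤ν E) (<⇒≤ (≰⇒> bad))))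

    -- Joining edges through v to the weight of F

    module Add (H : Hypergraph M) (v : Fin N) (v∉F : v ∉ vertices F) (I : Subset M)
      (ν : Weights M) (0≤ν : ∀ E → 0# ≤ ν E) (supp : ∀ E → ν E ≈ 0# ⊎ (Edge H E × E ⊆ I × Good E)) (∑ν : ∑ˢ ν ≈ 1#)
      (z : Carrier) (0<z : 0# < z)
      (small : ⟦ 8 ⟧ * z * ((1# + ρ) * ΛU π ρ ν + ρ * ρ * ∑ᶠ (λ y → U.deg π ν ⁅ y ⁆ * U.deg π ν ⁅ y ⁆)) ≤ 1#) where

      open U π using () renaming (deg to degU)

      private
        G : Hypergraph N
        G = imageᴴ₊ π v (H [ I ]) ∪ᴴ F
        -- The mixture is `a` times the weight of F plus the image of `ν`. Raising R′ to R′ + z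
        -- costs zba on the F part; with zb = 1/4 this is a/4, while (a + 1)² offers 2a and the
        -- cross term takes only a of it.
        b : Carrier
        b = (⟦ 4 ⟧ * z) ⁻¹
        0<4z : 0# < ⟦ 4 ⟧ * z
        0<4z = 0<* (0<⟦suc⟧ 3) 0<z
        0<b : 0# < b
        0<b = 0<⁻¹ 0<4z
        4zb : ⟦ 4 ⟧ * z * b ≈ 1#
        4zb = inverseʳ 0<4z
        a : Carrier
        a = b * R′
        0≤a : 0# ≤ a
        0≤a = *-nonneg (<⇒≤ 0<b) 0≤R′
        π⁺ : Subset M → Subset N
        π⁺ E = image π E ∪ ⁅ v ⁆
        deg⁺ : Subset N → Carrier
        deg⁺ K = ∑ˢ (λ E → 𝟙 (K ⊆? π⁺ E) * ν E)
        push : Subset N → Carrier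
        push D = ∑ˢ (λ E → ν E * 𝟙 (D ≟ˢ π⁺ E))
        μ : Subset N → Carrier
        μ D = a * wF D + push D
        0≤push : ∀ D → 0# ≤ push D
        0≤push D = ∑-0≤ (𝒫 M) λ E → *-nonneg (0≤ν E) (0≤𝟙 (D ≟ˢ π⁺ E))
        0≤μ : ∀ D → 0# ≤ μ D
        0≤μ D = 0≤+ (*-nonneg 0≤a (0≤wF D)) (0≤push D)

        on-edges : ∀ D → edgeWeight G μ D ≈ μ D
        on-edges D = go (Edge? G D)
          where
          go : (d : Dec (Edge G D)) → 𝟙 d * μ D ≈ μ D
          go (yes _) = *-identityˡ _
          go (no ¬e) = trans (zeroˡ _) (sym (trans (+-cong
              (trans (*-congˡ (trans (*-congʳ (𝟙-no (Edge? F D) (¬e ∘ inj₂))) (zeroˡ _))) (zeroʳ a))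
              (∑-≈0 (𝒫 M) λ E → term E (supp E) (D ≟ˢ π⁺ E))) (+-identityˡ 0#)))
            where
            term : ∀ E → ν E ≈ 0# ⊎ (Edge H E × E ⊆ I × Good E) → (d : Dec (D ≡ π⁺ E)) → ν E * 𝟙 d ≈ 0#
            term E (inj₁ ν≈0) _ = trans (*-congʳ ν≈0) (zeroˡ _)
            term E (inj₂ _) (no _) = zeroʳ _
            term E (inj₂ (e , E⊆I , _)) (yes D≡) = ⊥-elim (¬e (inj₁ (E , (e , E⊆I) , D≡)))

        push-sum : ∀ (f : Subset N → Carrier) → ∑ˢ (λ D → f D * push D) ≈ ∑ˢ (λ E → f (π⁺ E) * ν E)
        push-sum f = trans (∑-cong (𝒫 N) λ D → sym (∑-*ˡ (𝒫 M) (f D) _)) (trans (∑-swap (𝒫 N) (𝒫 M) _)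
          (∑-cong (𝒫 M) λ E → trans (∑-cong (𝒫 N) λ D → solve 3 (λ f n a → f :* (n :* a) := n :* (a :* f)) refl (f D) (ν E) (𝟙 (D ≟ˢ π⁺ E)))
            (trans (∑-*ˡ (𝒫 N) (ν E) _) (trans (*-congˡ (∑ˢ-point (π⁺ E) f)) (*-comm _ _)))))

        total≈ : totalWeight G μ ≈ a * totalWeight F νF + 1#
        total≈ = trans (totalWeight≈ G μ) (trans (∑-cong (𝒫 N) on-edges) (trans (∑-+ (𝒫 N) _ _)
          (+-cong (trans (∑-*ˡ (𝒫 N) a _) (*-congˡ (sym (totalWeight≈ F νF))))
            (trans (∑-cong (𝒫 N) λ D → sym (*-identityˡ _)) (trans (push-sum (λ _ → 1#)) (trans (∑-cong (𝒫 M) λ E → *-identityˡ _) ∑ν))))))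

        degree-G : ∀ K → degree G μ K ≈ a * dF K + deg⁺ K
        degree-G K = trans (degree≈ G μ K) (trans (∑-cong (𝒫 N) λ D → trans (*-congˡ (on-edges D))
            (solve 4 (λ k a w q → k :* (a :* w :+ q) := a :* (k :* w) :+ k :* q) refl (𝟙 (K ⊆? D)) a (wF D) (push D)))
          (trans (∑-+ (𝒫 N) _ _) (+-cong (trans (∑-*ˡ (𝒫 N) a _) (*-congˡ (sym (degree≈ F νF K)))) (push-sum (λ D → 𝟙 (K ⊆? D))))))

        ⊆-drop : ∀ {K E} → v ∉ K → K ⊆ π⁺ E → K ⊆ image π E
        ⊆-drop {K} {E} v∉K h {x} x∈K = [ id , (λ x∈v → ⊥-elim (v∉K (≡.subst (_∈ K) (x∈⁅y⁆⇒x≡y v x∈v) x∈K))) ]′ (x∈p∪q⁻ (image π E) ⁅ v ⁆ (h x∈K))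

        deg⁺-out : ∀ {K} → v ∉ K → deg⁺ K ≈ degU ν K
        deg⁺-out {K} v∉K = ∑-cong (𝒫 M) λ E → *-congʳ (𝟙-iff (⊆-drop {K} {E} v∉K) (widen E) (K ⊆? π⁺ E) (K ⊆? image π E))
          where
          widen : ∀ E → K ⊆ image π E → K ⊆ π⁺ E
          widen E h x∈ = p⊆p∪q ⁅ v ⁆ (h x∈)

        deg⁺-in : ∀ {K} → v ∉ K → deg⁺ (K ∪ ⁅ v ⁆) ≈ degU ν K
        deg⁺-in {K} v∉K = ∑-cong (𝒫 M) λ E → *-congʳ (𝟙-iff (to E) (from E) ((K ∪ ⁅ v ⁆) ⊆? π⁺ E) (K ⊆? image π E))
          where
          to : ∀ E → K ∪ ⁅ v ⁆ ⊆ π⁺ E → K ⊆ image π E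
          to E h = ⊆-drop {K} {E} v∉K (λ {x} x∈ → h (p⊆p∪q ⁅ v ⁆ x∈))
          from : ∀ E → K ⊆ image π E → K ∪ ⁅ v ⁆ ⊆ π⁺ E
          from E h = ∪⁅⁆⊆ (λ {x} x∈ → p⊆p∪q ⁅ v ⁆ (h x∈)) (q⊆p∪q (image π E) ⁅ v ⁆ (x∈⁅x⁆ v))

        dF-v : ∀ {K} → v ∈ K → dF K ≈ 0#
        dF-v {K} v∈K = degree-outside F νF K λ h → v∉F (h v∈K)

        cross : Carrier
        cross = ∑ˢ (λ K → pc K * (dF K * deg⁺ K))

        -- Sets through `v` have degree 0 in F, so `cross` is the average cost under `ν`, and `ν`
        -- lives on good edges.
        cross≤ : ⟦ 2 ⟧ * (R′ * cross) ≤ 1#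
        cross≤ = ≤-resp₂
          (trans (∑-*ˡ (𝒫 M) (⟦ 2 ⟧ * R′) _) (trans (*-assoc _ _ _) (*-congˡ (*-congˡ (sym cross≈)))))
          ∑ν
          (∑-mono (𝒫 M) λ E → term E (supp E))
          where
          same : ∀ K (d : Dec (v ∈ K)) → dF K * deg⁺ K ≈ dF K * degU ν K
          same K (no v∉K)  = *-congˡ (deg⁺-out v∉K)
          same K (yes v∈K) = trans (*-congʳ (dF-v v∈K)) (trans (zeroˡ _) (sym (trans (*-congʳ (dF-v v∈K)) (zeroˡ _))))
          cross≈ : cross ≈ ∑ˢ (λ E → cost E * ν E)
          cross≈ = trans (∑-cong (𝒫 N) λ K → *-congˡ (same K (v ∈? K))) (sym (∑-cost (λ K E → 𝟙 (K ⊆? image π E)) ν))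
          term : ∀ E → ν E ≈ 0# ⊎ (Edge H E × E ⊆ I × Good E) → ⟦ 2 ⟧ * R′ * (cost E * ν E) ≤ ν E
          term E (inj₁ ν≈0) = ≤-reflexive (trans (*-congˡ (trans (*-congˡ ν≈0) (zeroʳ _))) (trans (zeroʳ _) (sym ν≈0)))
          term E (inj₂ (_ , _ , good)) = ≤-resp₂ (solve 3 (λ r c n → κ 2 :* (r :* c) :* n := κ 2 :* r :* (c :* n)) refl R′ (cost E) (ν E)) (*-identityˡ _)
            (*-monoʳ-≤ (ν E) (0≤ν E) good)

        ΛH singles lam : Carrier
        ΛH = ∑ˢ (λ K → pc K * (deg⁺ K * deg⁺ K))
        singles = ∑ᶠ (λ y → degU ν ⁅ y ⁆ * degU ν ⁅ y ⁆)
        lam = (1# + ρ) * ΛU π ρ ν + ρ * ρ * singles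

        -- Sets that avoid `v` contribute at most ΛU. A set K ∪ v carries one more factor ρ: sets K
        -- of size at least two contribute at most ρ ΛU, and singletons, absent from ΛU, at most ρ²
        -- d². The set {v} itself is too small to count.
        ΛH≤lam : ΛH ≤ lam
        ΛH≤lam = ≤-respˡ (sym split) (≤-respʳ (solve 3 (λ l r s → l :+ (r :* l :+ r :* r :* s) := (κ 1 :+ r) :* l :+ r :* r :* s) refl (ΛU π ρ ν) ρ singles)
            (+-mono-≤ without with-v))
          where
          f : Subset N → Carrier
          f K = pc K * (deg⁺ K * deg⁺ K)
          split : ΛH ≈ ∑ˢ (λ K → 𝟙 (¬? (v ∈? K)) * f K) + ∑ˢ (λ K → 𝟙 (v ∈? K) * f K)
          split = trans (∑-cong (𝒫 N) λ K → trans (sym (*-identityˡ (f K))) (trans (*-congʳ (sym (𝟙-¬ (v ∈? K)))) (trans (distribʳ (f K) _ _) (+-comm _ _)))) (∑-+ (𝒫 N) _ _)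
          without : ∑ˢ (λ K → 𝟙 (¬? (v ∈? K)) * f K) ≤ ΛU π ρ ν
          without = ∑-mono (𝒫 N) λ K → ≤-trans (𝟙*-mono (¬? (v ∈? K)) λ v∉K → ≤-reflexive (*-congˡ (*-cong (deg⁺-out v∉K) (deg⁺-out v∉K))))
            (𝟙*≤ (¬? (v ∈? K)) (*-nonneg (0≤pc K) (0≤sq (degU ν K))))
          g : ℕ → Carrier → Carrier
          g k d = 𝟙 (2 ℕ.≤? suc k) * (ρ * ρ ^ k) * (d * d)
          g≈ : ∀ k d → g k d ≈ ρ * (𝟙 (2 ℕ.≤? k) * ρ ^ k * (d * d)) + ρ * ρ * (𝟙 (k ℕ.≟ 1) * (d * d))
          g≈ 0 d = solve 2 (λ r d → κ 0 :* (r :* κ 1) :* (d :* d) := r :* (κ 0 :* κ 1 :* (d :* d)) :+ r :* r :* (κ 0 :* (d :* d))) refl ρ d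
          g≈ 1 d = solve 2 (λ r d → κ 1 :* (r :* (r :* κ 1)) :* (d :* d) := r :* (κ 0 :* (r :* κ 1) :* (d :* d)) :+ r :* r :* (κ 1 :* (d :* d))) refl ρ d
          g≈ (suc (suc k)) d = solve 3 (λ r d t → κ 1 :* (r :* t) :* (d :* d) := r :* (κ 1 :* t :* (d :* d)) :+ r :* r :* (κ 0 :* (d :* d))) refl ρ d (ρ ^ suc (suc k))
          with-v : ∑ˢ (λ K → 𝟙 (v ∈? K) * f K) ≤ ρ * ΛU π ρ ν + ρ * ρ * singles
          with-v = ≤-resp₂ (∑ˢ-insert v f)
            (trans (∑-+ (𝒫 N) _ _) (+-cong (∑-*ˡ (𝒫 N) ρ _) (trans (∑-*ˡ (𝒫 N) (ρ * ρ) _) (*-congˡ (∑ˢ-singletons (λ K → degU ν K * degU ν K))))))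
            (∑-mono (𝒫 N) λ K → ≤-respʳ (g≈ ∣ K ∣ (degU ν K)) (≤-trans
              (𝟙*-mono (¬? (v ∈? K)) λ v∉K → ≤-reflexive (*-cong (≈-reflexive (≡.cong (λ k → 𝟙 (2 ℕ.≤? k) * ρ ^ k) (∣∪⁅⁆∣ v∉K))) (*-cong (deg⁺-in v∉K) (deg⁺-in v∉K))))
              (𝟙*≤ (¬? (v ∈? K)) (*-nonneg (*-nonneg (0≤𝟙 (2 ℕ.≤? suc ∣ K ∣)) (*-nonneg 0≤ρ (0≤^ ∣ K ∣ 0≤ρ))) (0≤sq (degU ν K))))))

        Λ-G : Λ G μ p ≈ a * a * ΛF + ⟦ 2 ⟧ * (a * cross) + ΛH
        Λ-G = trans (Λ≈ G μ p) (trans (∑-cong (𝒫 N) λ K → trans (*-congˡ (*-cong (degree-G K) (degree-G K)))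
            (solve 4 (λ c a x y → c :* ((a :* x :+ y) :* (a :* x :+ y)) := a :* a :* (c :* (x :* x)) :+ κ 2 :* a :* (c :* (x :* y)) :+ c :* (y :* y)) refl (pc K) a (dF K) (deg⁺ K)))
          (trans (∑-+ (𝒫 N) _ _) (+-congʳ (trans (∑-+ (𝒫 N) _ _)
            (+-cong (trans (∑-*ˡ (𝒫 N) (a * a) _) (*-congˡ (sym (Λ≈ F νF p)))) (trans (∑-*ˡ (𝒫 N) (⟦ 2 ⟧ * a) _) (*-assoc _ _ _)))))))

        τ : Carrier
        τ = totalWeight G μ
        τ≈ : τ ≈ a + 1#
        τ≈ = trans total≈ (+-congʳ (trans (*-assoc _ _ _) (*-congˡ R′e≈R′)))
        0<c : 0# < R′ + z
        0<c = <-respʳ (+-comm z R′) (0<+ 0<z 0≤R′)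

        2lam≤b : ⟦ 2 ⟧ * lam ≤ b
        2lam≤b = *-cancelˡ-≤ (⟦ 4 ⟧ * z) 0<4z (≤-resp₂ (solve 2 (λ z l → κ 8 :* z :* l := κ 4 :* z :* (κ 2 :* l)) refl z lam) (sym 4zb) small)

        Λ≤ : Λ G μ p ≤ b * a + b + lam
        Λ≤ = ≤-respˡ (sym Λ-G) (by-cert
          (solve 6 (λ b r f x h l → (b :* (b :* r) :+ b :+ l) :- (b :* r :* (b :* r) :* f :+ κ 2 :* (b :* r :* x) :+ h)
             := b :* b :* r :* (κ 1 :- r :* f) :+ b :* (κ 1 :- κ 2 :* (r :* x)) :+ (l :- h)) refl b R′ ΛF cross ΛH lam)
          (0≤+ (0≤+ (*-nonneg (*-nonneg (*-nonneg (<⇒≤ 0<b) (<⇒≤ 0<b)) 0≤R′) (≤⇒0≤ R′Λ≤1)) (*-nonneg (<⇒≤ 0<b) (≤⇒0≤ cross≤))) (≤⇒0≤ ΛH≤lam)))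

      janson : IsJanson p (R′ + z) G
      janson = inj₂ (0<c , μ , (λ E _ → 0≤μ E) , ≰⇒> λ le → <⇒≱ (0<⟦suc⟧ 4) (contra (≤-respʳ (*-comm _ _) (clear le))))
        where
        clear : τ ^ 2 / (R′ + z) ≤ Λ G μ p → τ * τ ≤ Λ G μ p * (R′ + z)
        clear le = ≤-respˡ (trans (*-assoc _ _ _) (trans (*-congˡ (inverseˡ 0<c)) (solve 1 (λ t → t :* (t :* κ 1) :* κ 1 := t :* t) refl τ)))
          (*-monoʳ-≤ (R′ + z) (<⇒≤ 0<c) le)
        -- With zb = 1/4, 2 lam ≤ b and 8z lam ≤ 1, the product (R′ + z)(ba + b + lam) is at most a²
        -- + 7a/4 + 3/8. It falls short of (a + 1)² by at least a/4 + 5/8, and eight times this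
        -- shortfall is 2a + 5.
        contra : τ * τ ≤ (R′ + z) * Λ G μ p → ⟦ 5 ⟧ ≤ 0#
        contra le = by-cert
          (begin
            0# - ⟦ 5 ⟧
              ≈⟨ solve 4 (λ b r z l → κ 0 :- κ 5 := κ 8 :* ((r :+ z) :* (b :* (b :* r) :+ b :+ l) :- (b :* r :+ κ 1) :* (b :* r :+ κ 1)) :+ κ 4 :* r :* (b :- κ 2 :* l) :+ (κ 1 :- κ 8 :* z :* l) :+ κ 2 :* (b :* r)
                   :+ (κ 1 :- κ 4 :* z :* b) :* (κ 2 :+ κ 2 :* (b :* r))) refl b R′ z lam ⟩
            ⟦ 8 ⟧ * ((R′ + z) * (b * a + b + lam) - (a + 1#) * (a + 1#)) + ⟦ 4 ⟧ * R′ * (b - ⟦ 2 ⟧ * lam) + (1# - ⟦ 8 ⟧ * z * lam) + ⟦ 2 ⟧ * a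
              + (1# - ⟦ 4 ⟧ * z * b) * (⟦ 2 ⟧ + ⟦ 2 ⟧ * a)
              ≈⟨ trans (+-congˡ (trans (*-congʳ (trans (+-congˡ (-‿cong 4zb)) (-‿inverseʳ 1#))) (zeroˡ _))) (+-identityʳ _) ⟩
            ⟦ 8 ⟧ * ((R′ + z) * (b * a + b + lam) - (a + 1#) * (a + 1#)) + ⟦ 4 ⟧ * R′ * (b - ⟦ 2 ⟧ * lam) + (1# - ⟦ 8 ⟧ * z * lam) + ⟦ 2 ⟧ * a ∎)
          (0≤+ (0≤+ (0≤+ (*-nonneg (0≤⟦⟧ 8) (≤⇒0≤ (≤-respˡ (*-cong τ≈ τ≈) (≤-trans le (*-monoˡ-≤ _ (<⇒≤ 0<c) Λ≤)))))
            (*-nonneg (*-nonneg (0≤⟦⟧ 4) 0≤R′) (≤⇒0≤ 2lam≤b))) (≤⇒0≤ small)) (*-nonneg (0≤⟦⟧ 2) 0≤a))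

  -- The containers

  module Containers
    (s r n : ℕ) (1≤s : 1 ℕ.≤ s) (s≤n : s ℕ.≤ n) (2≤r : 2 ℕ.≤ r)
    (p q R R′ η : Carrier) (0<q : 0# < q) (q<⅛ : q < 1# / ⟦ 8 ⟧) (0<p : 0# < p)
    (p≤ : p ≤ q / (⟦ 2 ⟧ ^ 10 * ⟦ r ⟧ ^ 2 * ⟦ s ⟧ ^ 2))
    (R≈ : R ≈ (⟦ 2 ⟧ ^ 6) ⁻¹ * p * ⟦ n ⟧) (0≤R′ : 0# ≤ R′) (R′≤ : R′ ≤ R / ⟦ 16 ⟧)
    (η≈ : η ≈ p ^ 4 * (q / ⟦ 2 ⟧) ^ (4 ℕ.* s))
    {M N : ℕ} (V : Subset M)
    (F : Hypergraph N) (F-janson : IsJanson p R′ F)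
    (H : Hypergraph M) (H⊆V : ∀ E → Edge H E → E ⊆ V) (H-uniform : Uniform s H) (∣V∣≡n : ∣ V ∣ ≡ n)
    (π : Fin M → Fin N)
    (halving : ∀ L → L ⊆ V → ⟦ ∣ L ∣ ⟧ / ⟦ 2 ⟧ ≤ ⟦ ∣ image π L ∣ ⟧)
    (π-card : ∀ E → Edge H E → ∣ image π E ∣ ≡ ∣ E ∣)
    (v : Fin N) (v∉F : v ∉ vertices F) where

    private
      r̄ s̄ n̄ ρ x c z : Carrier
      r̄ = ⟦ r ⟧
      s̄ = ⟦ s ⟧
      n̄ = ⟦ n ⟧
      ρ = p ⁻¹
      x = p / q
      c = (q / ⟦ 2 ⟧) ^ s
      z = η * R

      1≤n : 1 ℕ.≤ n
      1≤n = ℕ.≤-trans 1≤s s≤n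
      1≤r : 1 ℕ.≤ r
      1≤r = ℕ.≤-trans (ℕ.s≤s ℕ.z≤n) 2≤r
      1≤∣V∣ : 1 ℕ.≤ ∣ V ∣
      1≤∣V∣ = ≡.subst (1 ℕ.≤_) (≡.sym ∣V∣≡n) 1≤n
      0<n̄ : 0# < n̄
      0<n̄ = <-≤-trans (0<⟦suc⟧ 0) (⟦⟧-mono 1≤n)
      2≤r̄ : ⟦ 2 ⟧ ≤ r̄
      2≤r̄ = ⟦⟧-mono 2≤r
      1≤r̄ : 1# ≤ r̄
      1≤r̄ = ≤-respˡ ⟦1⟧≈1 (⟦⟧-mono 1≤r)
      1≤s̄ : 1# ≤ s̄
      1≤s̄ = ≤-respˡ ⟦1⟧≈1 (⟦⟧-mono 1≤s)
      0<r̄ : 0# < r̄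
      0<r̄ = <-≤-trans 0<1 1≤r̄
      0<s̄ : 0# < s̄
      0<s̄ = <-≤-trans 0<1 1≤s̄
      0≤p : 0# ≤ p
      0≤p = <⇒≤ 0<p
      0≤q : 0# ≤ q
      0≤q = <⇒≤ 0<q

      8q<1 : ⟦ 8 ⟧ * q < 1#
      8q<1 = <-respʳ (trans (solve 2 (λ a b → a :* (κ 1 :* b) := a :* b) refl ⟦ 8 ⟧ (⟦ 8 ⟧ ⁻¹)) (inverseʳ (0<⟦suc⟧ 7))) (*-monoˡ-< ⟦ 8 ⟧ (0<⟦suc⟧ 7) q<⅛)
      q<1 : q < 1#
      q<1 = ≤-<-trans (by-cert (solve 1 (λ q → κ 8 :* q :- q := κ 7 :* q) refl q) (*-nonneg (0≤⟦⟧ 7) 0≤q)) 8q<1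
      q≤1 : q ≤ 1#
      q≤1 = <⇒≤ q<1

      den : Carrier
      den = ⟦ 2 ⟧ ^ 10 * r̄ ^ 2 * s̄ ^ 2
      0<den : 0# < den
      0<den = 0<* (0<* (0<^ 10 0<2) (0<^ 2 0<r̄)) (0<^ 2 0<s̄)
      p·den≤q : p * den ≤ q
      p·den≤q = ≤-respʳ (trans (*-assoc _ _ _) (trans (*-congˡ (inverseˡ 0<den)) (*-identityʳ q))) (*-monoʳ-≤ den (<⇒≤ 0<den) p≤)

      1≤r̄s̄² : 1# ≤ r̄ * (s̄ * s̄)
      1≤r̄s̄² = ≤-respˡ (solve 0 (κ 1 :* (κ 1 :* κ 1) := κ 1) refl) (*-mono-≤ 0≤1 (*-nonneg 0≤1 0≤1) 1≤r̄ (*-mono-≤ 0≤1 0≤1 1≤s̄ 1≤s̄))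

      prs : p * (⟦ 2 ⟧ ^ 10 * (r̄ * (s̄ * s̄))) ≤ 1#
      prs = ≤-trans (*-monoˡ-≤ p 0≤p (by-cert
          (solve 3 (λ t r s → t :* (r :* (r :* κ 1)) :* (s :* (s :* κ 1)) :- t :* (r :* (s :* s)) := t :* (r :* (s :* s)) :* (r :- κ 1)) refl (⟦ 2 ⟧ ^ 10) r̄ s̄)
          (*-nonneg (*-nonneg (0≤^ 10 (0≤⟦⟧ 2)) (*-nonneg (0≤⟦⟧ r) (*-nonneg (0≤⟦⟧ s) (0≤⟦⟧ s)))) (≤⇒0≤ 1≤r̄))))
        (≤-trans p·den≤q q≤1)

      32p≤1 : ⟦ 32 ⟧ * p ≤ 1#
      32p≤1 = ≤-trans (by-cert
          (solve 2 (λ p w → p :* (κ 2 :^ 10 :* w) :- κ 32 :* p := (κ 2 :^ 10) :* p :* (w :- κ 1) :+ κ 992 :* p) refl p (r̄ * (s̄ * s̄)))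
          (0≤+ (*-nonneg (*-nonneg (0≤^ 10 (0≤⟦⟧ 2)) 0≤p) (≤⇒0≤ 1≤r̄s̄²)) (*-nonneg (0≤⟦⟧ 992) 0≤p))) prs
      p≤1 : p ≤ 1#
      p≤1 = ≤-trans (by-cert (solve 1 (λ p → κ 32 :* p :- p := κ 31 :* p) refl p) (*-nonneg (0≤⟦⟧ 31) 0≤p)) 32p≤1

      0<x : 0# < x
      0<x = 0<* 0<p (0<⁻¹ 0<q)
      qx≈p : q * x ≈ p
      qx≈p = trans (solve 3 (λ q p i → q :* (p :* i) := p :* (q :* i)) refl q p (q ⁻¹)) (trans (*-congˡ (inverseʳ 0<q)) (*-identityʳ p))

      -- As r ≥ 2, the constant 2¹⁰r² in the bound on p is at least 2¹² = 16³.
      x-small : ⟦ 16 ⟧ * ⟦ 16 ⟧ * ⟦ 16 ⟧ * (s̄ * s̄) * x ≤ 1#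
      x-small = *-cancelˡ-≤ q 0<q (≤-resp₂ (sym (trans (solve 3 (λ q a x → q :* (a :* x) := a :* (q :* x)) refl q (⟦ 16 ⟧ * ⟦ 16 ⟧ * ⟦ 16 ⟧ * (s̄ * s̄)) x) (*-congˡ qx≈p))) (sym (*-identityʳ q))
        (≤-trans (by-cert
            (solve 3 (λ p r s → p :* (κ 2 :^ 10 :* (r :* (r :* κ 1)) :* (s :* (s :* κ 1))) :- κ 16 :* κ 16 :* κ 16 :* (s :* s) :* p
                := (κ 2 :^ 10) :* (p :* (s :* s)) :* (r :- κ 2) :* (r :+ κ 2)) refl p r̄ s̄)
            (*-nonneg (*-nonneg (*-nonneg (0≤^ 10 (0≤⟦⟧ 2)) (*-nonneg 0≤p (0≤sq s̄))) (≤⇒0≤ 2≤r̄)) (0≤+ (0≤⟦⟧ r) (0≤⟦⟧ 2))))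
          p·den≤q))

      pρ≈1 : p * ρ ≈ 1#
      pρ≈1 = inverseʳ 0<p
      0≤ρ : 0# ≤ ρ
      0≤ρ = <⇒≤ (0<⁻¹ 0<p)
      64R≈pn : ⟦ 2 ⟧ ^ 6 * R ≈ p * n̄
      64R≈pn = trans (*-congˡ R≈) (trans (solve 4 (λ a i p n → a :* (i :* p :* n) := (a :* i) :* (p :* n)) refl (⟦ 2 ⟧ ^ 6) _ p n̄)
        (trans (*-congʳ (inverseʳ (0<^ 6 0<2))) (*-identityˡ _)))
      0<R : 0# < R
      0<R = <-respʳ (sym R≈) (0<* (0<* (0<⁻¹ (0<^ 6 0<2)) 0<p) 0<n̄)
      16R′≤R : ⟦ 16 ⟧ * R′ ≤ R
      16R′≤R = ≤-respʳ (trans (solve 3 (λ a r i → a :* (r :* i) := r :* (a :* i)) refl ⟦ 16 ⟧ R (⟦ 16 ⟧ ⁻¹)) (trans (*-congˡ (inverseʳ (0<⟦suc⟧ 15))) (*-identityʳ R)))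
        (*-monoˡ-≤ ⟦ 16 ⟧ (0≤⟦⟧ 16) R′≤)
      0<q/2 : 0# < q / ⟦ 2 ⟧
      0<q/2 = 0<* 0<q (0<⁻¹ 0<2)
      0<c : 0# < c
      0<c = 0<^ s 0<q/2
      q/2≤1 : q / ⟦ 2 ⟧ ≤ 1#
      q/2≤1 = ≤-trans (≤-respˡ (*-comm _ _) (≤-respʳ (*-identityˡ q) (*-monoʳ-≤ q 0≤q ½≤1))) q≤1
        where
        ½≤1 : ⟦ 2 ⟧ ⁻¹ ≤ 1#
        ½≤1 = *-cancelˡ-≤ ⟦ 2 ⟧ 0<2 (≤-resp₂ (sym (inverseʳ 0<2)) (sym (*-identityʳ _)) 1≤2)
      c≤1 : c ≤ 1#
      c≤1 = ^≤1 s (<⇒≤ 0<q/2) q/2≤1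
      η≈pc : η ≈ p ^ 4 * c ^ 4
      η≈pc = trans η≈ (*-congˡ (trans (≈-reflexive (≡.cong ((q / ⟦ 2 ⟧) ^_) (ℕ.*-comm 4 s))) (sym (^-^ (q / ⟦ 2 ⟧) s 4))))
      0<z : 0# < z
      0<z = 0<* (<-respʳ (sym η≈pc) (0<* (0<^ 4 0<p) (0<^ 4 0<c))) 0<R

      weightF : Σ[ ν ∈ (Subset N → Carrier) ] (∀ D → Edge F D → 0# ≤ ν D) × R′ * totalWeight F ν ≈ R′ × R′ * Λ F ν p ≤ 1#
      weightF = normalise F p R′ 0<p F-janson

    open Mixing π F p R′ 0<p 0≤R′ (proj₁ weightF) (proj₁ (proj₂ weightF)) (proj₁ (proj₂ (proj₂ weightF))) (proj₂ (proj₂ (proj₂ weightF)))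

    Bad : Subset M → Set
    Bad I = I ⊆ V × ¬ IsJanson p (R′ + η * R) (imageᴴ₊ π v (H [ I ]) ∪ᴴ F)

    -- Closing the bad sets downwards gives monotonicity at once. A weight found inside a member is
    -- later read as a weight on the bad set above it.
    𝓘 : Subset M → Set
    𝓘 A = ∃[ I ] A ⊆ I × Bad I

    𝓘-down : ∀ {A B} → A ⊆ B → 𝓘 B → 𝓘 A
    𝓘-down A⊆B (I , B⊆I , bad) = I , (λ x∈ → B⊆I (A⊆B x∈)) , bad

    open Random q 0<q q<1
    open Sampling V 𝓘 𝓘-down

    Light : Subset M → Subset M → Set
    Light S E = ⟦ 2 ⟧ ^ s * μ (S ∪ E) < μ S

    Scarce : Subset M → Subset M → Set
    Scarce S E = (Edge H E × Good E) × Light S E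

    Scarce⊆V : ∀ S E → Scarce S E → E ⊆ V
    Scarce⊆V S E ((e , _) , _) = H⊆V E e

    module P (S : Subset M) = Potential V (Scarce S) (Scarce⊆V S) p ρ 0<p p≤1 pρ≈1

    -- Freeness of S₂ ∪ u is part of the condition because otherwise `J` at that set is the supremum
    -- of an unbounded set and its value is unconstrained.
    InContainer : Subset M → Subset M → Fin M → Set
    InContainer S₁ S₂ u = u ∈ V × P.Free S₁ (S₂ ∪ ⁅ u ⁆) × P.J S₁ (S₂ ∪ ⁅ u ⁆) ≤ P.J S₁ S₂ + x

    container : Subset M × Subset M → Subset M
    container (S₁ , S₂) = subsetOf (λ u → em {InContainer S₁ S₂ u})

    -- The fingerprints of a bad set have both properties. Keeping only such pairs makes (2)
    -- provable for every member of the family, whether or not it comes from a bad set.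
    Valid : Subset M × Subset M → Set
    Valid (S₁ , S₂) = 0# < μ S₁ × P.Free S₁ S₂

    -- A container on which (2) fails leads to a contradiction

    module Core (S₁ S₂ : Subset M) (0<μ : 0# < μ S₁) (free : P.Free S₁ S₂)
      (robust : ∀ Y → Y ⊆ container (S₁ , S₂) →
         ⟦ ∣ container (S₁ , S₂) ∣ ⟧ - (⟦ 2 ⟧ ^ 8) ⁻¹ * ⟦ r ⟧ ⁻¹ * ⟦ n ⟧ ≤ ⟦ ∣ Y ∣ ⟧ → IsJanson p R (imageᴴ π (H [ Y ])))
      (n′ : ℕ) (n≡ : n ≡ suc n′) where

      private
        X : Subset M
        X = container (S₁ , S₂)
        X⁻ : ∀ {u} → u ∈ X → InContainer S₁ S₂ u
        X⁻ = ∈-subsetOf⁻ (λ u → em {InContainer S₁ S₂ u})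
        X⊆V : X ⊆ V
        X⊆V u∈ = proj₁ (X⁻ u∈)
        image-size : ∀ E → Edge H E → ∣ image π E ∣ ≡ s
        image-size E e = ≡.trans (π-card E e) (H-uniform E e)
        module A = Robust.Averaging π H p R 0<p 0<R s r n 1≤s 1≤r n′ n≡ V image-size halving X X⊆V robust

      open U π using () renaming (deg to degU; form-mono to formU-mono; form-* to formU-*; deg-mono to degU-mono; deg-* to degU-*; 0≤deg to 0≤degU)

      module Weighted (ν : Weights M) (0≤ν : ∀ E → 0# ≤ ν E) (supp : ∀ E → ν E ≈ 0# ⊎ (Edge H E × E ⊆ X)) (∑ν : ∑ˢ ν ≈ 1#)
        (RΛ≤1 : R * ΛU π ρ ν ≤ 1#) (squares : n̄ * ∑ᶠ (λ y → degU ν ⁅ y ⁆ * degU ν ⁅ y ⁆) ≤ (A.θ + 1#) * s̄) where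

        ν₁ ν₂ : Weights M
        ν₁ E = 𝟙 (em {Good E}) * (𝟙 (¬? (em {Light S₁ E})) * ν E)
        ν₂ E = 𝟙 (em {Good E}) * (𝟙 (em {Light S₁ E}) * ν E)

        halves : 1# ≤ ⟦ 2 ⟧ * (∑ˢ ν₁ + ∑ˢ ν₂)
        halves = ≤-respʳ (*-congˡ (trans (∑-cong (𝒫 M) λ E → trans (*-congˡ (trans (sym (*-identityˡ (ν E))) (*-congʳ (sym (𝟙-¬ (em {Light S₁ E}))))))
              (solve 4 (λ g a b n → g :* ((a :+ b) :* n) := g :* (b :* n) :+ g :* (a :* n)) refl (𝟙 (em {Good E})) (𝟙 (em {Light S₁ E})) (𝟙 (¬? (em {Light S₁ E}))) (ν E)))
            (∑-+ (𝒫 M) ν₁ ν₂)))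
          (good-half ν 0≤ν ∑ν RΛ≤1 16R′≤R)

        0≤kU : ∀ (K : Subset N) (E : Subset M) → 0# ≤ 𝟙 (K ⊆? image π E)
        0≤kU K E = 0≤𝟙 (K ⊆? image π E)

        ν₂≤ν : ∀ E → ν₂ E ≤ ν E
        ν₂≤ν E = ≤-trans (𝟙*≤ (em {Good E}) (*-nonneg (0≤𝟙 (em {Light S₁ E})) (0≤ν E))) (𝟙*≤ (em {Light S₁ E}) (0≤ν E))
        0≤ν₂ : ∀ E → 0# ≤ ν₂ E
        0≤ν₂ E = *-nonneg (0≤𝟙 (em {Good E})) (*-nonneg (0≤𝟙 (em {Light S₁ E})) (0≤ν E))

        scarce-case : ⟦ 3 ⟧ ≤ ⟦ 8 ⟧ * ∑ˢ ν₂ → ⊥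
        scarce-case 3≤8e = P.Spread.impossible S₁
            s 1≤s (λ E sc → H-uniform E (proj₁ (proj₁ sc))) x 0<x x-small S₂ X free X⊆V
            (λ u u∈ → proj₂ (X⁻ u∈)) 1≤∣V∣ ν₂ (0≤ν₂ , λ E ¬sc → off E ¬sc (supp E) em em) (λ E E⊈X → outside-X E E⊈X (supp E)) 3≤8e Λ-small
          where
          zero-if : ∀ E → ν E ≈ 0# → ν₂ E ≈ 0#
          zero-if E z = trans (*-congˡ (trans (*-congˡ z) (zeroʳ _))) (zeroʳ _)
          off : ∀ E → ¬ Scarce S₁ E → ν E ≈ 0# ⊎ (Edge H E × E ⊆ X) → (g : Dec (Good E)) (l : Dec (Light S₁ E)) → 𝟙 g * (𝟙 l * ν E) ≈ 0#
          off E ¬sc (inj₁ z) g l = trans (*-congˡ (trans (*-congˡ z) (zeroʳ _))) (zeroʳ _)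
          off E ¬sc (inj₂ _) (no _) l = zeroˡ _
          off E ¬sc (inj₂ _) (yes _) (no _) = trans (*-congˡ (zeroˡ _)) (zeroʳ _)
          off E ¬sc (inj₂ (e , _)) (yes g) (yes l) = ⊥-elim (¬sc ((e , g) , l))
          outside-X : ∀ E → ¬ (E ⊆ X) → ν E ≈ 0# ⊎ (Edge H E × E ⊆ X) → ν₂ E ≈ 0#
          outside-X E E⊈X (inj₁ z) = zero-if E z
          outside-X E E⊈X (inj₂ (_ , E⊆X)) = ⊥-elim (E⊈X E⊆X)
          inj : ∀ E → ν₂ E ≈ 0# ⊎ InjectiveOn π E
          inj E = [ (λ z → inj₁ (zero-if E z)) , (λ (e , _) → inj₂ (card-image⇒InjectiveOn π (π-card E e))) ]′ (supp E)
          -- The 64 is pn/R: restricting `ν` and passing from U to V only decrease the form, for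
          -- which RΛ ≤ 1.
          Λ-small : p * ⟦ ∣ V ∣ ⟧ * P.Λ₂ S₁ ν₂ ≤ ⟦ 64 ⟧
          Λ-small = ≤-trans (*-monoˡ-≤ (p * ⟦ ∣ V ∣ ⟧) (*-nonneg 0≤p (0≤⟦⟧ ∣ V ∣)) (≤-trans (ΛV≤ΛU π {ρ} ν₂ 0≤ρ 0≤ν₂ inj) (formU-mono 0≤kU {pairCoeff π ρ} {ν₂} {ν} (0≤pairCoeff π 0≤ρ) 0≤ν₂ ν₂≤ν)))
            (≤-trans (≤-reflexive pn≈) (≤-respʳ (trans (*-identityʳ _) (solve 0 (κ 2 :^ 6 := κ 64) refl)) (*-monoˡ-≤ (⟦ 2 ⟧ ^ 6) (0≤^ 6 (0≤⟦⟧ 2)) RΛ≤1)))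
            where
            pn≈ : p * ⟦ ∣ V ∣ ⟧ * ΛU π ρ ν ≈ ⟦ 2 ⟧ ^ 6 * (R * ΛU π ρ ν)
            pn≈ = trans (*-congʳ (trans (*-congˡ (≈-reflexive (≡.cong ⟦_⟧ ∣V∣≡n))) (sym 64R≈pn))) (*-assoc _ _ _)

        -- The bound for `Λ` once `v` has been added to every edge, in the form in which `Add` asks
        -- for it.
        lam : Weights M → Carrier
        lam ν = (1# + ρ) * ΛU π ρ ν + ρ * ρ * ∑ᶠ (λ y → degU ν ⁅ y ⁆ * degU ν ⁅ y ⁆)

        -- With z = p⁴ c⁴ R and 64 R = p n the claim only needs p · 2¹⁰ r s² ≤ 1.
        budget : ⟦ 8 ⟧ * (⟦ 16 ⟧ * ⟦ 16 ⟧) * (z * lam ν) ≤ c * c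
        budget = ≤-trans (≤-reflexive rearrange) (≤-respʳ (*-identityʳ _) (*-monoˡ-≤ (c * c) (*-nonneg (<⇒≤ 0<c) (<⇒≤ 0<c)) bound))
          where
          D Sq w : Carrier
          D = ΛU π ρ ν
          Sq = ∑ᶠ (λ y → degU ν ⁅ y ⁆ * degU ν ⁅ y ⁆)
          w = r̄ * (s̄ * s̄)
          rearrange : ⟦ 8 ⟧ * (⟦ 16 ⟧ * ⟦ 16 ⟧) * (z * lam ν) ≈ c * c * (⟦ 8 ⟧ * (⟦ 16 ⟧ * ⟦ 16 ⟧) * (p * p * (c * c)) * (p * (p * (R * lam ν))))
          rearrange = trans (*-congˡ (*-congʳ (*-congʳ η≈pc)))
            (solve 4 (λ p c R l → κ 8 :* (κ 16 :* κ 16) :* ((p :^ 4 :* c :^ 4) :* R :* l) := c :* c :* (κ 8 :* (κ 16 :* κ 16) :* (p :* p :* (c :* c)) :* (p :* (p :* (R :* l))))) refl p c R (lam ν))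
          pRlam : p * (R * lam ν) ≈ p * (R * D) + R * D + ρ * (R * Sq)
          pRlam = trans (solve 5 (λ p R r D S → p :* (R :* ((κ 1 :+ r) :* D :+ r :* r :* S)) := p :* (R :* D) :+ (p :* r) :* (R :* D) :+ (p :* r) :* (r :* (R :* S))) refl p R ρ D Sq)
            (+-cong (+-congˡ (trans (*-congʳ pρ≈1) (*-identityˡ _))) (trans (*-congʳ pρ≈1) (*-identityˡ _)))
          64ρRSq : ⟦ 2 ⟧ ^ 6 * (ρ * (R * Sq)) ≤ (A.θ + 1#) * s̄
          64ρRSq = ≤-trans (≤-reflexive (trans (solve 4 (λ a r R S → a :* (r :* (R :* S)) := r :* (a :* R) :* S) refl (⟦ 2 ⟧ ^ 6) ρ R Sq)
              (trans (*-congʳ (*-congˡ 64R≈pn)) (trans (solve 4 (λ r p n S → r :* (p :* n) :* S := p :* r :* (n :* S)) refl ρ p n̄ Sq) (trans (*-congʳ pρ≈1) (*-identityˡ _)))))) squares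
          -- p + 1 + (2⁹ r s + 1) s / 64 ≤ 11 r s²
          pRlam≤ : p * (R * lam ν) ≤ ⟦ 11 ⟧ * w
          pRlam≤ = *-cancelˡ-≤ (⟦ 2 ⟧ ^ 6) (0<^ 6 0<2) (≤-trans (≤-reflexive (*-congˡ pRlam)) (by-cert
            (solve 5 (λ p RD X r s → (κ 2 :^ 6) :* (κ 11 :* (r :* (s :* s))) :- (κ 2 :^ 6) :* (p :* RD :+ RD :+ X)
                := ((κ 2 :^ 9 :* r :* s :+ κ 1) :* s :- (κ 2 :^ 6) :* X) :+ (κ 64 :* p :+ κ 64) :* (κ 1 :- RD) :+ κ 64 :* (κ 1 :- p) :+ κ 128 :* (r :* (s :* s) :- κ 1) :+ (r :* (s :* s) :- s :* s) :+ (s :* s :- s) :+ κ 63 :* (r :* (s :* s)))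
              refl p (R * D) (ρ * (R * Sq)) r̄ s̄)
            (0≤+ (0≤+ (0≤+ (0≤+ (0≤+ (0≤+ (≤⇒0≤ 64ρRSq) (*-nonneg (0≤+ (*-nonneg (0≤⟦⟧ 64) 0≤p) (0≤⟦⟧ 64)) (≤⇒0≤ RΛ≤1)))
              (*-nonneg (0≤⟦⟧ 64) (≤⇒0≤ p≤1))) (*-nonneg (0≤⟦⟧ 128) (≤⇒0≤ 1≤r̄s̄²)))
              (≤⇒0≤ (≤-respˡ (*-identityˡ _) (*-monoʳ-≤ (s̄ * s̄) (0≤sq s̄) 1≤r̄))))
              (≤⇒0≤ (≤-respˡ (*-identityˡ _) (*-monoʳ-≤ s̄ (0≤⟦⟧ s) 1≤s̄))))
              (*-nonneg (0≤⟦⟧ 63) (≤-trans 0≤1 1≤r̄s̄²)))))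
          ppRlam≤ : ⟦ 2 ⟧ ^ 10 * (p * (p * (R * lam ν))) ≤ ⟦ 11 ⟧
          ppRlam≤ = ≤-trans (*-monoˡ-≤ _ (0≤^ 10 (0≤⟦⟧ 2)) (*-monoˡ-≤ p 0≤p pRlam≤))
            (≤-resp₂ (solve 3 (λ p t w → κ 11 :* (p :* (t :* w)) := t :* (p :* (κ 11 :* w))) refl p (⟦ 2 ⟧ ^ 10) w) (*-identityʳ _) (*-monoˡ-≤ ⟦ 11 ⟧ (0≤⟦⟧ 11) prs))
          cc≤1 : c * c ≤ 1#
          cc≤1 = ≤-respʳ (*-identityˡ 1#) (*-mono-≤ (<⇒≤ 0<c) (<⇒≤ 0<c) c≤1 c≤1)
          bound : ⟦ 8 ⟧ * (⟦ 16 ⟧ * ⟦ 16 ⟧) * (p * p * (c * c)) * (p * (p * (R * lam ν))) ≤ 1#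
          bound = by-cert
            (solve 3 (λ p cc y → κ 1 :- κ 8 :* (κ 16 :* κ 16) :* (p :* p :* cc) :* y
               := κ 2 :* (p :* p :* cc) :* (κ 11 :- κ 2 :^ 10 :* y) :+ κ 22 :* (p :* p) :* (κ 1 :- cc) :+ κ 22 :* p :* (κ 1 :- p) :+ (κ 1 :- κ 32 :* p) :+ κ 10 :* p)
              refl p (c * c) (p * (p * (R * lam ν))))
            (0≤+ (0≤+ (0≤+ (0≤+ (*-nonneg (*-nonneg (0≤⟦⟧ 2) (*-nonneg (0≤sq p) (0≤sq c))) (≤⇒0≤ ppRlam≤))
              (*-nonneg (*-nonneg (0≤⟦⟧ 22) (0≤sq p)) (≤⇒0≤ cc≤1))) (*-nonneg (*-nonneg (0≤⟦⟧ 22) 0≤p) (≤⇒0≤ p≤1))) (≤⇒0≤ 32p≤1)) (*-nonneg (0≤⟦⟧ 10) 0≤p))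

        module Dense (1≤8e : 1# ≤ ⟦ 8 ⟧ * ∑ˢ ν₁) (B : Subset M)
          (dense : c * ∑ˢ ν₁ ≤ ⟦ 2 ⟧ * ∑ˢ (λ E → 𝟙 (E ⊆? B) * ν₁ E)) (I : Subset M) (B⊆I : B ⊆ I) where

          private
            ν₃ : Weights M
            ν₃ E = 𝟙 (E ⊆? B) * ν₁ E
            0≤ν₁ : ∀ E → 0# ≤ ν₁ E
            0≤ν₁ E = *-nonneg (0≤𝟙 (em {Good E})) (*-nonneg (0≤𝟙 (¬? (em {Light S₁ E}))) (0≤ν E))
            0≤ν₃ : ∀ E → 0# ≤ ν₃ E
            0≤ν₃ E = *-nonneg (0≤𝟙 (E ⊆? B)) (0≤ν₁ E)
            ν₃≤ν : ∀ E → ν₃ E ≤ ν E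
            ν₃≤ν E = ≤-trans (𝟙*≤ (E ⊆? B) (0≤ν₁ E)) (≤-trans (𝟙*≤ (em {Good E}) (*-nonneg (0≤𝟙 (¬? (em {Light S₁ E}))) (0≤ν E))) (𝟙*≤ (¬? (em {Light S₁ E})) (0≤ν E)))
            e i : Carrier
            e = ∑ˢ ν₃
            i = e ⁻¹
            -- Half of a c-fraction of a weight of at least 1/8. Normalising by 1/e therefore costs
            -- at most 256/c², which is why `budget` has the factor 16 · 16 on the left and c · c on
            -- the right.
            c≤16e : c ≤ ⟦ 16 ⟧ * e
            c≤16e = by-cert (solve 3 (λ c e f → κ 16 :* e :- c := κ 8 :* (κ 2 :* e :- c :* f) :+ c :* (κ 8 :* f :- κ 1)) refl c e (∑ˢ ν₁))
              (0≤+ (*-nonneg (0≤⟦⟧ 8) (≤⇒0≤ dense)) (*-nonneg (<⇒≤ 0<c) (≤⇒0≤ 1≤8e)))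
            0<e : 0# < e
            0<e = ≰⇒> λ e≤0 → <⇒≱ 0<c (≤-trans c≤16e (≤-respʳ (zeroʳ ⟦ 16 ⟧) (*-monoˡ-≤ ⟦ 16 ⟧ (0≤⟦⟧ 16) e≤0)))
            0≤i : 0# ≤ i
            0≤i = <⇒≤ (0<⁻¹ 0<e)
            ie : i * e ≈ 1#
            ie = inverseˡ 0<e
            ν₄ : Weights M
            ν₄ E = i * ν₃ E
            lam-mono : lam ν₃ ≤ lam ν
            lam-mono = +-mono-≤ (*-monoˡ-≤ (1# + ρ) (0≤+ 0≤1 0≤ρ) (formU-mono 0≤kU {pairCoeff π ρ} {ν₃} {ν} (0≤pairCoeff π 0≤ρ) 0≤ν₃ ν₃≤ν))
              (*-monoˡ-≤ (ρ * ρ) (*-nonneg 0≤ρ 0≤ρ) (∑-mono (allFin N) λ y → *-mono-≤ (0≤degU 0≤kU {ν₃} 0≤ν₃ ⁅ y ⁆) (0≤degU 0≤kU {ν₃} 0≤ν₃ ⁅ y ⁆) (degU-mono 0≤kU {ν₃} {ν} ν₃≤ν ⁅ y ⁆) (degU-mono 0≤kU {ν₃} {ν} ν₃≤ν ⁅ y ⁆)))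
            lam-scale : lam ν₄ ≈ i * i * lam ν₃
            lam-scale = trans (+-cong (*-congˡ (formU-* (pairCoeff π ρ) ν₃ i)) (*-congˡ (trans (∑-cong (allFin N) λ y →
                  trans (*-cong (degU-* ν₃ i ⁅ y ⁆) (degU-* ν₃ i ⁅ y ⁆)) (solve 2 (λ i d → (i :* d) :* (i :* d) := i :* i :* (d :* d)) refl i (degU ν₃ ⁅ y ⁆)))
                  (∑-*ˡ (allFin N) (i * i) _))))
              (solve 5 (λ a i f b g → a :* (i :* i :* f) :+ b :* (i :* i :* g) := i :* i :* (a :* f :+ b :* g)) refl (1# + ρ) i _ (ρ * ρ) _)
            small : ⟦ 8 ⟧ * z * lam ν₄ ≤ 1#
            small = ≤-trans (≤-reflexive (trans (*-congˡ lam-scale) (solve 3 (λ z i l → κ 8 :* z :* (i :* i :* l) := i :* i :* (κ 8 :* (z :* l))) refl z i (lam ν₃))))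
              (≤-trans (*-monoˡ-≤ (i * i) (*-nonneg 0≤i 0≤i) 8zlam≤) (≤-reflexive (trans (solve 2 (λ i e → i :* i :* (e :* e) := (i :* e) :* (i :* e)) refl i e) (trans (*-cong ie ie) (*-identityˡ 1#)))))
              where
              8zlam≤ : ⟦ 8 ⟧ * (z * lam ν₃) ≤ e * e
              8zlam≤ = *-cancelˡ-≤ (⟦ 16 ⟧ * ⟦ 16 ⟧) (0<* (0<⟦suc⟧ 15) (0<⟦suc⟧ 15)) (by-cert
                (solve 5 (λ z l l′ e c → κ 16 :* κ 16 :* (e :* e) :- κ 16 :* κ 16 :* (κ 8 :* (z :* l))
                    := (c :* c :- κ 8 :* (κ 16 :* κ 16) :* (z :* l′)) :+ κ 8 :* (κ 16 :* κ 16) :* (z :* (l′ :- l)) :+ (κ 16 :* e :- c) :* (κ 16 :* e :+ c)) refl z (lam ν₃) (lam ν) e c)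
                (0≤+ (0≤+ (≤⇒0≤ budget) (*-nonneg (*-nonneg (0≤⟦⟧ 8) (*-nonneg (0≤⟦⟧ 16) (0≤⟦⟧ 16))) (*-nonneg (<⇒≤ 0<z) (≤⇒0≤ lam-mono))))
                  (*-nonneg (≤⇒0≤ c≤16e) (0≤+ (*-nonneg (0≤⟦⟧ 16) (<⇒≤ 0<e)) (<⇒≤ 0<c)))))
            supp₄ : ∀ E → ν₄ E ≈ 0# ⊎ (Edge H E × E ⊆ I × Good E)
            supp₄ E = go (E ⊆? B) em (supp E)
              where
              go : (b : Dec (E ⊆ B)) (g : Dec (Good E)) → ν E ≈ 0# ⊎ (Edge H E × E ⊆ X) → i * (𝟙 b * (𝟙 g * (𝟙 (¬? (em {Light S₁ E})) * ν E))) ≈ 0# ⊎ (Edge H E × E ⊆ I × Good E)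
              go (no _) g _ = inj₁ (trans (*-congˡ (zeroˡ _)) (zeroʳ i))
              go (yes _) (no _) _ = inj₁ (trans (*-congˡ (trans (*-congˡ (zeroˡ _)) (zeroʳ _))) (zeroʳ i))
              go (yes E⊆B) (yes g) (inj₁ ν≈0) = inj₁ (trans (*-congˡ (*-congˡ (*-congˡ (*-congˡ ν≈0)))) (solve 4 (λ i a b c → i :* (a :* (b :* (c :* κ 0))) := κ 0) refl i 1# 1# _))
              go (yes E⊆B) (yes g) (inj₂ (e , _)) = inj₂ (e , (λ x∈ → B⊆I (E⊆B x∈)) , g)

          janson : IsJanson p (R′ + z) (imageᴴ₊ π v (H [ I ]) ∪ᴴ F)
          janson = Add.janson H v v∉F I ν₄ (λ E → *-nonneg 0≤i (0≤ν₃ E)) supp₄ (trans (∑-*ˡ (𝒫 M) i ν₃) ie) z 0<z small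

        dense-case : 1# ≤ ⟦ 8 ⟧ * ∑ˢ ν₁ → ⊥
        dense-case 1≤8e = finish (dense-member S₁ s ν₁ 0≤ν₁ heavy 0<μ 0<e₁)
          where
          0≤ν₁ : ∀ E → 0# ≤ ν₁ E
          0≤ν₁ E = *-nonneg (0≤𝟙 (em {Good E})) (*-nonneg (0≤𝟙 (¬? (em {Light S₁ E}))) (0≤ν E))
          0<e₁ : 0# < ∑ˢ ν₁
          0<e₁ = ≰⇒> λ e≤0 → <⇒≱ 0<1 (≤-trans 1≤8e (≤-respʳ (zeroʳ ⟦ 8 ⟧) (*-monoˡ-≤ ⟦ 8 ⟧ (0≤⟦⟧ 8) e≤0)))
          heavy : ∀ E → ν₁ E ≈ 0# ⊎ (E ⊆ V × ∣ E ∣ ≡ s × μ S₁ ≤ ⟦ 2 ⟧ ^ s * μ (S₁ ∪ E))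
          heavy E = go em (supp E)
            where
            go : (l : Dec (Light S₁ E)) → ν E ≈ 0# ⊎ (Edge H E × E ⊆ X) → 𝟙 (em {Good E}) * (𝟙 (¬? l) * ν E) ≈ 0# ⊎ (E ⊆ V × ∣ E ∣ ≡ s × μ S₁ ≤ ⟦ 2 ⟧ ^ s * μ (S₁ ∪ E))
            go (yes _) _ = inj₁ (trans (*-congˡ (zeroˡ _)) (zeroʳ _))
            go (no _) (inj₁ ν≈0) = inj₁ (trans (*-congˡ (trans (*-congˡ ν≈0) (zeroʳ _))) (zeroʳ _))
            go (no heavy) (inj₂ (e , _)) = inj₂ (H⊆V E e , H-uniform E e , ≮⇒≥ heavy)
          finish : (∃[ A ] A ⊆ V × 𝓘 (A ∪ S₁) × c * ∑ˢ ν₁ ≤ ⟦ 2 ⟧ * ∑ˢ (λ E → 𝟙 (E ⊆? A) * ν₁ E)) → ⊥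
          finish (A , _ , (I , A∪S⊆I , _ , ¬janson) , dense) = ¬janson (Dense.janson 1≤8e A dense I (λ x∈ → A∪S⊆I (p⊆p∪q S₁ x∈)))

        absurd : ⊥
        -- At least 1/2 of the weight is on good edges, so either 1/8 of it avoids the scarce edges
        -- or 3/8 lies on them; 3/8 is what `Spread` needs against the losses computed there.
        absurd = [ dense-case , (λ e₁-small → scarce-case (by-cert
              (solve 2 (λ a b → κ 8 :* b :- κ 3 := κ 4 :* (κ 2 :* (a :+ b) :- κ 1) :+ (κ 1 :- κ 8 :* a)) refl (∑ˢ ν₁) (∑ˢ ν₂))
              (0≤+ (*-nonneg (0≤⟦⟧ 4) (≤⇒0≤ halves)) (≤⇒0≤ e₁-small)))) ]′ (total 1# (⟦ 8 ⟧ * ∑ˢ ν₁))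

      absurd : ⊥
      absurd = go A.spread-weight
        where
        go : A.Spread-weight → ⊥
        go (ν , 0≤ν , supp , ∑ν , RΛ , squares) = Weighted.absurd ν 0≤ν supp ∑ν RΛ squares

    -- The family of containers: its size and the two properties

    module Family (k : ℕ) (k≤ : ⟦ k ⟧ ≤ ⟦ 4 ⟧ * q * ⟦ ∣ V ∣ ⟧) (k> : ⟦ 4 ⟧ * q * ⟦ ∣ V ∣ ⟧ < ⟦ suc k ⟧) where
      open Pairs V k

      fingerprints : List (Subset M × Subset M)
      fingerprints = filter (λ SS → em {Valid SS}) smallPairs

      family : List (Subset M)
      family = deduplicate _≟ˢ_ (map container fingerprints)

      family-unique : Unique family
      family-unique = Unique.deduplicate-! _≟ˢ_ (map container fingerprints)

      family-size : ⟦ length family ⟧ ≤ ⟦ 4 ⟧ * (⟦ 2 ⟧ / q) ^ᴿ (⟦ 4 ⟧ * q * ⟦ ∣ V ∣ ⟧)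
      family-size = ≤-trans (⟦⟧-mono (ℕ.≤-trans (List.length-deduplicate _≟ˢ_ (map container fingerprints))
          (ℕ.≤-trans (ℕ.≤-reflexive (List.length-map container fingerprints)) (List.length-filter (λ SS → em {Valid SS}) smallPairs))))
        (smallPairs-bound q 0<q q≤1 1≤∣V∣ 8q<1 k≤ k>)

      family⁻ : ∀ X → X ∈ˡ family → ∃[ SS ] Valid SS × X ≡ container SS
      family⁻ X X∈ = go (∈-map⁻ container (∈-deduplicate⁻ _≟ˢ_ (map container fingerprints) X∈))
        where
        go : (∃[ SS ] SS ∈ˡ fingerprints × X ≡ container SS) → ∃[ SS ] Valid SS × X ≡ container SS
        go (SS , SS∈ , X≡) = SS , proj₂ (∈-filter⁻ (λ SS → em {Valid SS}) {xs = smallPairs} SS∈) , X≡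

      family⊆V : ∀ X → X ∈ˡ family → X ⊆ V
      family⊆V X X∈ = go (family⁻ X X∈)
        where
        go : (∃[ SS ] Valid SS × X ≡ container SS) → X ⊆ V
        go ((S₁ , S₂) , _ , ≡.refl) u∈ = proj₁ (∈-subsetOf⁻ (λ u → em {InContainer S₁ S₂ u}) u∈)

      sparse : ∀ X → X ∈ˡ family → ∃[ Y ] Y ⊆ X ×
               (⟦ ∣ X ∣ ⟧ - (⟦ 2 ⟧ ^ 8) ⁻¹ * ⟦ r ⟧ ⁻¹ * ⟦ n ⟧ ≤ ⟦ ∣ Y ∣ ⟧) × ¬ IsJanson p R (imageᴴ π (H [ Y ]))
      sparse X X∈ = go (family⁻ X X∈)
        where
        Sparse : Subset M → Set
        Sparse X = ∃[ Y ] Y ⊆ X × (⟦ ∣ X ∣ ⟧ - (⟦ 2 ⟧ ^ 8) ⁻¹ * ⟦ r ⟧ ⁻¹ * ⟦ n ⟧ ≤ ⟦ ∣ Y ∣ ⟧) × ¬ IsJanson p R (imageᴴ π (H [ Y ]))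
        stable : ∀ Y → Dec (IsJanson p R (imageᴴ π (H [ Y ]))) → ¬ ¬ IsJanson p R (imageᴴ π (H [ Y ])) → IsJanson p R (imageᴴ π (H [ Y ]))
        stable Y (yes j) _  = j
        stable Y (no ¬j) ¬¬j = ⊥-elim (¬¬j ¬j)
        predecessor : ∀ {m} → 1 ℕ.≤ m → ∃[ m′ ] m ≡ suc m′
        predecessor (ℕ.s≤s _) = _ , ≡.refl
        decide : ∀ SS → Valid SS → Dec (Sparse (container SS)) → Sparse (container SS)
        decide SS _ (yes h) = h
        decide (S₁ , S₂) (0<μ , free) (no ¬h) = ⊥-elim (Core.absurd S₁ S₂ 0<μ free
          (λ Y Y⊆X large → stable Y em λ ¬j → ¬h (Y , Y⊆X , large , ¬j)) (proj₁ (predecessor 1≤n)) (proj₂ (predecessor 1≤n)))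
        go : (∃[ SS ] Valid SS × X ≡ container SS) → Sparse X
        go (SS , valid , X≡) = ≡.subst Sparse (≡.sym X≡) (decide SS valid em)

      module Cover (I : Subset M) (bad : Bad I) where
        private
          I⊆V : I ⊆ V
          I⊆V = proj₁ bad

        Fingerprint : Set
        Fingerprint = ∃[ S ] S ⊆ I × (∀ L → L ⊆ I → μ S ≤ ⟦ 2 ⟧ ^ ∣ L ∣ * μ (S ∪ L)) ×
                      ⟦ 2 ⟧ ^ ∣ S ∣ * (1# - q) ^ ∣ V ∣ ≤ 1# × 0# < μ S

        module _ (S₁ : Subset M) (S₁⊆I : S₁ ⊆ I) (grow : ∀ L → L ⊆ I → μ S₁ ≤ ⟦ 2 ⟧ ^ ∣ L ∣ * μ (S₁ ∪ L))
          (S₁-size : ⟦ 2 ⟧ ^ ∣ S₁ ∣ * (1# - q) ^ ∣ V ∣ ≤ 1#) (0<μ : 0# < μ S₁) where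
          open P S₁

          -- For an edge E inside I, `grow` at L = E is the negation of lightness.
          free : ∀ S → S ⊆ I → Free S
          free S S⊆I E ((e , _) , light) E⊆S = <⇒≱ light
            (≤-respʳ (*-congʳ (≈-reflexive (≡.cong (⟦ 2 ⟧ ^_) (H-uniform E e)))) (grow E (λ x∈ → S⊆I (E⊆S x∈))))

          score : Subset M → Carrier
          score S = x * ⟦ ∣ S ∣ ⟧ - J S

          covered : (∃[ S ] S ⊆ I × (∀ S′ → S′ ⊆ I → score S ≤ score S′)) → ∃[ X ] X ∈ˡ family × I ⊆ X
          covered (S₂ , S₂⊆I , least) = container (S₁ , S₂) , member , I⊆X
            where
            -- Comparison with the empty set gives x|S₂| ≤ J(S₂) - J(∅) ≤ pn, and x = p/q.
            S₂-size : ⟦ ∣ S₂ ∣ ⟧ ≤ q * ⟦ ∣ V ∣ ⟧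
            S₂-size = *-cancelˡ-≤ p 0<p (≤-resp₂ (trans (sym (*-assoc _ _ _)) (*-congʳ qx≈p)) (solve 3 (λ q p n → q :* (p :* n) := p :* (q :* n)) refl q p ⟦ ∣ V ∣ ⟧)
              (*-monoˡ-≤ q 0≤q (by-cert
                (solve 5 (λ a j j₀ b o → b :- a := (((o :- j₀) :- (a :- j)) :+ (b :- j)) :+ (j₀ :- o)) refl (x * ⟦ ∣ S₂ ∣ ⟧) (J S₂) (J ∅) (p * ⟦ ∣ V ∣ ⟧) (x * ⟦ ∣ ∅ {M} ∣ ⟧))
                (0≤+ (0≤+ (≤⇒0≤ (least ∅ ⊥⊆)) (≤⇒0≤ (J≤pn (free S₂ S₂⊆I)))) (≤-respʳ (trans (solve 2 (λ j x → j := j :- x :* κ 0) refl (J ∅) x) (+-congˡ (-‿cong (*-congˡ (sym (≈-reflexive (≡.cong ⟦_⟧ (∣⊥∣≡0 M)))))))) (0≤J (free ∅ ⊥⊆)))))))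
            -- 3qn + qn = 4qn < k + 1, and the sizes are integers.
            sizes : ∣ S₁ ∣ ℕ.+ ∣ S₂ ∣ ℕ.≤ k
            sizes = bounded (∣ S₁ ∣ ℕ.+ ∣ S₂ ∣ ℕ.≤? k)
              where
              bounded : Dec (∣ S₁ ∣ ℕ.+ ∣ S₂ ∣ ℕ.≤ k) → ∣ S₁ ∣ ℕ.+ ∣ S₂ ∣ ℕ.≤ k
              bounded (yes h) = h
              bounded (no ¬h) = ⊥-elim (<⇒≱ k> (≤-trans (⟦⟧-mono (ℕ.≰⇒> ¬h)) (≤-trans (≤-reflexive (⟦⟧-+ ∣ S₁ ∣ ∣ S₂ ∣))
                (≤-respʳ (solve 2 (λ q n → κ 3 :* q :* n :+ q :* n := κ 4 :* q :* n) refl q ⟦ ∣ V ∣ ⟧)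
                  (+-mono-≤ (size-bound ∣ S₁ ∣ ∣ V ∣ 1≤∣V∣ 0<q 8q<1 S₁-size) S₂-size)))))
            member : container (S₁ , S₂) ∈ˡ family
            member = ∈-deduplicate⁺ _≟ˢ_ (∈-map⁺ container (∈-filter⁺ (λ SS → em {Valid SS})
              (∈-filter⁺ Small? (∈-cartesianProduct⁺ (∈-allSubsets S₁) (∈-allSubsets S₂)) ((λ x∈ → I⊆V (S₁⊆I x∈)) , (λ x∈ → I⊆V (S₂⊆I x∈)) , sizes))
              (0<μ , free S₂ S₂⊆I)))
            I⊆X : I ⊆ container (S₁ , S₂)
            -- Minimality of the score against S₂ ∪ u, whose size is at most |S₂| + 1, lets `J` rise
            -- by at most `x`.
            I⊆X {u} u∈I = ∈-subsetOf⁺ (λ u → em {InContainer S₁ S₂ u}) (I⊆V u∈I , free (S₂ ∪ ⁅ u ⁆) S₂u⊆I , by-cert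
                (solve 5 (λ x a b j j′ → (j :+ x) :- j′ := ((x :* b :- j′) :- (x :* a :- j)) :+ x :* ((a :+ κ 1) :- b)) refl x ⟦ ∣ S₂ ∣ ⟧ ⟦ ∣ S₂ ∪ ⁅ u ⁆ ∣ ⟧ (J S₂) (J (S₂ ∪ ⁅ u ⁆)))
                (0≤+ (≤⇒0≤ (least (S₂ ∪ ⁅ u ⁆) S₂u⊆I)) (*-nonneg (<⇒≤ 0<x) (≤⇒0≤ (≤-respʳ (trans (⟦⟧-+ ∣ S₂ ∣ ∣ ⁅ u ⁆ ∣)
                   (+-congˡ (trans (≈-reflexive (≡.cong ⟦_⟧ (∣⁅x⁆∣≡1 u))) ⟦1⟧≈1))) (⟦⟧-mono (∣∪∣≤ S₂ ⁅ u ⁆)))))))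
              where
              S₂u⊆I : S₂ ∪ ⁅ u ⁆ ⊆ I
              S₂u⊆I = ∪⁅⁆⊆ S₂⊆I u∈I

        cover : ∃[ X ] X ∈ˡ family × I ⊆ X
        cover = go (fingerprint I (I , id , bad))
          where
          go : Fingerprint → ∃[ X ] X ∈ˡ family × I ⊆ X
          go (S₁ , S₁⊆I , grow , size , 0<μ) = covered S₁ S₁⊆I grow size 0<μ (argmin I (score S₁ S₁⊆I grow size 0<μ))

    Conclusion : Set
    Conclusion =
      Σ[ 𝒳 ∈ List (Subset M) ]
        Unique 𝒳 ×
        (∀ X → X ∈ˡ 𝒳 → X ⊆ V) ×
        (⟦ length 𝒳 ⟧ ≤ ⟦ 4 ⟧ * (⟦ 2 ⟧ / q) ^ᴿ (⟦ 4 ⟧ * q * ⟦ n ⟧)) ×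
        (∀ I → I ⊆ V →
           ¬ IsJanson p (R′ + η * R) (imageᴴ₊ π v (H [ I ]) ∪ᴴ F) →
           ∃[ X ] X ∈ˡ 𝒳 × I ⊆ X) ×
        (∀ X → X ∈ˡ 𝒳 → ⟦ n ⟧ / (⟦ 8 ⟧ * ⟦ r ⟧) ≤ ⟦ ∣ X ∣ ⟧ →
           ∃[ Y ] Y ⊆ X ×
             (⟦ ∣ X ∣ ⟧ - (⟦ 2 ⟧ ^ 8) ⁻¹ * ⟦ r ⟧ ⁻¹ * ⟦ n ⟧ ≤ ⟦ ∣ Y ∣ ⟧) ×
             ¬ IsJanson p R (imageᴴ π (H [ Y ])))

    conclusion : Conclusion
    conclusion = go (floor ∣ V ∣ (*-nonneg (*-nonneg (0≤⟦⟧ 4) 0≤q) (0≤⟦⟧ ∣ V ∣)) below)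
      where
      0<V̄ : 0# < ⟦ ∣ V ∣ ⟧
      0<V̄ = <-≤-trans (0<⟦suc⟧ 0) (⟦⟧-mono 1≤∣V∣)
      below : ⟦ 4 ⟧ * q * ⟦ ∣ V ∣ ⟧ < ⟦ ∣ V ∣ ⟧
      below = ≰⇒> λ le → <⇒≱ (0<* (0<- 8q<1) 0<V̄) (by-cert
        (solve 2 (λ q n → κ 0 :- (κ 1 :- κ 8 :* q) :* n := (κ 4 :* q :* n :- n) :+ κ 4 :* (q :* n)) refl q ⟦ ∣ V ∣ ⟧)
        (0≤+ (≤⇒0≤ le) (*-nonneg (0≤⟦⟧ 4) (*-nonneg 0≤q (0≤⟦⟧ ∣ V ∣)))))
      go : (∃[ k ] ⟦ k ⟧ ≤ ⟦ 4 ⟧ * q * ⟦ ∣ V ∣ ⟧ × ⟦ 4 ⟧ * q * ⟦ ∣ V ∣ ⟧ < ⟦ suc k ⟧) → Conclusion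
      go (k , k≤ , k>) = family , family-unique , family⊆V ,
          ≡.subst (λ m → ⟦ length family ⟧ ≤ ⟦ 4 ⟧ * (⟦ 2 ⟧ / q) ^ᴿ (⟦ 4 ⟧ * q * ⟦ m ⟧)) ∣V∣≡n family-size ,
          (λ I I⊆V ¬j → Cover.cover I (I⊆V , ¬j)) , λ X X∈ _ → sparse X X∈
        where open Family k k≤ k>

theorem5p4 :
  ExcludedMiddle 0ℓ →
  (ℝ : CompleteOrderedField) →
  let open CompleteOrderedField ℝ
      open Janson ℝ
  in
  (s r n : ℕ) → 1 ℕ.≤ s → s ℕ.≤ n → 2 ℕ.≤ r →
  (p q R R′ η : Carrier) →
  0# < q → q < 1# / ⟦ 8 ⟧ →
  0# < p → p ≤ q / (⟦ 2 ⟧ ^ 10 * ⟦ r ⟧ ^ 2 * ⟦ s ⟧ ^ 2) →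
  R ≈ (⟦ 2 ⟧ ^ 6) ⁻¹ * p * ⟦ n ⟧ →
  0# ≤ R′ → R′ ≤ R / ⟦ 16 ⟧ →
  η ≈ p ^ 4 * (q / ⟦ 2 ⟧) ^ (4 ℕ.* s) →
  {M N : ℕ} (U : Subset N) (V : Subset M) →
  (F : Hypergraph N) → vertices F ≡ U → Uniform (suc s) F → IsJanson p R′ F →
  (H : Hypergraph M) → vertices H ≡ V → Uniform s H → ∣ V ∣ ≡ n →
  (π : Fin M → Fin N) → (∀ x → x ∈ V → π x ∈ U) →
  (∀ L → L ⊆ V → ⟦ ∣ L ∣ ⟧ / ⟦ 2 ⟧ ≤ ⟦ ∣ image π L ∣ ⟧) →
  (∀ E → Edge H E → ∣ image π E ∣ ≡ ∣ E ∣) →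
  (v : Fin N) → v ∉ U →
  Σ[ 𝒳 ∈ List (Subset M) ]
    Unique 𝒳 ×
    (∀ X → X ∈ˡ 𝒳 → X ⊆ V) ×
    (⟦ length 𝒳 ⟧ ≤ ⟦ 4 ⟧ * (⟦ 2 ⟧ / q) ^ᴿ (⟦ 4 ⟧ * q * ⟦ n ⟧)) ×
    (∀ I → I ⊆ V →
       ¬ IsJanson p (R′ + η * R) (imageᴴ₊ π v (H [ I ]) ∪ᴴ F) →
       ∃[ X ] X ∈ˡ 𝒳 × I ⊆ X) ×
    (∀ X → X ∈ˡ 𝒳 → ⟦ n ⟧ / (⟦ 8 ⟧ * ⟦ r ⟧) ≤ ⟦ ∣ X ∣ ⟧ →
       ∃[ Y ] Y ⊆ X ×
         (⟦ ∣ X ∣ ⟧ - (⟦ 2 ⟧ ^ 8) ⁻¹ * ⟦ r ⟧ ⁻¹ * ⟦ n ⟧ ≤ ⟦ ∣ Y ∣ ⟧) ×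
         ¬ IsJanson p R (imageᴴ π (H [ Y ])))
theorem5p4 em ℝ s r n 1≤s s≤n 2≤r p q R R′ η 0<q q<⅛ 0<p p≤ R≈ 0≤R′ R′≤ η≈
  U V F F≡U _ F-janson H H≡V H-uniform ∣V∣≡n π _ halving π-card v v∉U =
  Proof.Containers.conclusion em ℝ s r n 1≤s s≤n 2≤r p q R R′ η 0<q q<⅛ 0<p p≤ R≈ 0≤R′ R′≤ η≈
    V F F-janson H (λ E e → ≡.subst (E ⊆_) H≡V (edge⊆ H e)) H-uniform ∣V∣≡n π halving π-card
    v (≡.subst (v ∉_) (≡.sym F≡U) v∉U)
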